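{- Let $x \in \mathbb{Z}_{\ge 0}^n$ be the frequency vector of an insertion-only stream of length $m$. Suppose that $0 \leq x_i \leq B$ for all $i \in [n]$. Then there exists a streaming algorithm that, with probability at least $1 - \delta$, computes a $(1 \pm \varepsilon)$-approximation to $\|x\|_2^2$ using space (in bits) $$O\left(\frac{1}{\varepsilon^2}\log^2\frac{B}{\varepsilon}\,\log\frac{1}{\delta}\left(\log B + \log\frac{1}{\varepsilon}\right)\right) + O\left(\log\frac{n}{\delta}\right).$$
   Context: Insertion-only streaming model: elements of the universe $[n]=\{1,\dots,n\}$ arrive one at a time, and $x_i$ is the number of occurrences of $i$ in the stream, so $\|x\|_2^2=\sum_i x_i^2$ is the second frequency moment $F_2$. A streaming algorithm makes one pass over the stream, may use internal randomness, and its space is the number of bits of memory it maintains. A $(1\pm\varepsilon)$-approximation to a quantity $Q\ge 0$ is a value in $[(1-\varepsilon)Q,(1+\varepsilon)Q]$. The parameters $n$, $B$, $\varepsilon,\delta\in(0,1)$ are given to the algorithm. The paper's convention is that $n=\mathrm{poly}(m)$. Logarithms are base $2$; $O(\cdot)$ hides absolute constants. -}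

module Defs where

open import Algebra.Definitions.RawSemiring using () renaming (_^_ to pow)
open import Data.Bool.Base using (Bool)
open import Data.Fin.Base using (Fin; zero; suc; finToFun)
import Data.Fin.Properties as Fin
open import Data.Integer.Base using (+_; ∣_∣)
open import Data.Nat.Base as ℕ using (ℕ; suc; NonZero)
import Data.Nat.Properties as ℕ
open import Data.Product.Base using (_×_)
open import Data.Rational.Base
  using (ℚ; 0ℚ; 1ℚ; _+_; _-_; _*_; _÷_; _/_; _≤_; ↥_; ↧ₙ_; Positive; +-*-rawSemiring)
open import Data.Rational.Properties using (_≤?_; pos⇒nonZero)
open import Data.Vec.Base using (Vec; []; _∷_; count; allFin; tabulate; sum)
open import Level using (0ℓ)
open import Relation.Nullary.Decidable using (_×-dec_)
open import Relation.Unary using (Pred; Decidable)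

fromℕ : ℕ → ℚ
fromℕ k = + k / 1

infixr 8 _^ℚ_
_^ℚ_ : ℚ → ℕ → ℚ
_^ℚ_ = pow +-*-rawSemiring

Stream : ℕ → ℕ → Set
Stream n m = Vec (Fin n) m

frequency : ∀ {n m} → Stream n m → Fin n → ℕ
frequency xs i = count (i Fin.≟_) xs

‖_‖² : ∀ {n} → (Fin n → ℕ) → ℕ
‖ x ‖² = sum (tabulate (λ i → x i ℕ.^ 2))

IsApprox : ℚ → ℚ → Pred ℚ 0ℓ
IsApprox ε Q v = (1ℚ - ε) * Q ≤ v × v ≤ (1ℚ + ε) * Q

isApprox? : ∀ ε Q → Decidable (IsApprox ε Q)
isApprox? ε Q v = ((1ℚ - ε) * Q ≤? v) ×-dec (v ≤? (1ℚ + ε) * Q)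

-- Only the `space` bits of memory survive from one stream element to the
-- next.  Initialization, each update and the final output receive a fresh,
-- independent, uniform element of Fin draws; a random value that is needed
-- again later (such as a hash seed) has to be kept in memory.  The length of
-- the stream is not known to the algorithm.

record StreamingAlgorithm (n : ℕ) : Set where
  field
    space           : ℕ
    draws           : ℕ
    {{draws-nonZero}} : NonZero draws

  Memory : Set
  Memory = Vec Bool space

  field
    initial : Fin draws → Memory
    update  : Fin draws → Fin n → Memory → Memory
    output  : Fin draws → Memory → ℚ

  process : ∀ {m} → Memory → Stream n m → (Fin m → Fin draws) → Memory
  process mem []       ω = mem
  process mem (x ∷ xs) ω = process (update (ω zero) x mem) xs (λ j → ω (suc j))

  run : ∀ {m} → Stream n m → (Fin (2 ℕ.+ m) → Fin draws) → ℚ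
  run xs ω =
    output (ω zero) (process (initial (ω (suc zero))) xs (λ j → ω (suc (suc j))))

Pr : (N : ℕ) .{{_ : NonZero N}} {P : Pred (Fin N) 0ℓ} → Decidable P → ℚ
Pr N P? = + count P? (allFin N) / N

-- The sequence of all draws is uniform on Fin (2 + m) → Fin draws, which finToFun
-- identifies with Fin (draws ^ (2 + m)).
PrOutput : ∀ {n m} (A : StreamingAlgorithm n) → Stream n m →
           {P : Pred ℚ 0ℓ} → Decidable P → ℚ
PrOutput {m = m} A xs P? =
  Pr (draws ℕ.^ (2 ℕ.+ m)) {{ℕ.m^n≢0 draws (2 ℕ.+ m)}} (λ ω → P? (run xs (finToFun ω)))
  where open StreamingAlgorithm A

-- For q ≥ 1: the real number log₂ q is at most r, where r = a / b is in
-- lowest terms; equivalently r ≥ 0 and q ^ b ≤ 2 ^ a.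
infix 4 log₂_≤_
log₂_≤_ : ℚ → ℚ → Set
log₂ q ≤ r = 0ℚ ≤ r × q ^ℚ (↧ₙ r) ≤ fromℕ (2 ℕ.^ ∣ ↥ r ∣)

-- The real inequality
--
--   s ≤ C₁ · (1/ε²) log²(B/ε) log(1/δ) (log B + log(1/ε)) + C₂ · log(n/δ).
--
-- For n, B ≥ 1 and ε, δ < 1 all logarithms are nonnegative, and the right-hand
-- side is continuous and nondecreasing in each of them, so the inequality holds
-- exactly when it holds with the logarithms replaced by arbitrary rational
-- upper bounds.
SpaceBound : (C₁ C₂ n B : ℕ) (ε δ : ℚ) .{{_ : Positive ε}} .{{_ : Positive δ}} → ℕ → Set
SpaceBound C₁ C₂ n B ε δ s =
  ∀ ℓB/ε ℓ1/δ ℓB ℓ1/ε ℓn/δ →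
  log₂ (fromℕ B ÷ ε) ≤ ℓB/ε →
  log₂ (1ℚ ÷ δ)      ≤ ℓ1/δ →
  log₂ (fromℕ B)     ≤ ℓB →
  log₂ (1ℚ ÷ ε)      ≤ ℓ1/ε →
  log₂ (fromℕ n ÷ δ) ≤ ℓn/δ →
  fromℕ s ≤ fromℕ C₁ * ((1ℚ ÷ ε) ^ℚ 2 * ℓB/ε ^ℚ 2 * ℓ1/δ * (ℓB + ℓ1/ε))
          + fromℕ C₂ * ℓn/δ
  where
  instance
    ε≢0 = pos⇒nonZero ε
    δ≢0 = pos⇒nonZero δ

module Submission where

-- A row of the sketch is a random vector σ with independent entries, ±1 with
-- probability p / 2 each and 0 otherwise.  The square of ∑ σᵢ xᵢ has mean
-- p ‖x‖² and, once p ‖x‖² dominates the squares of the frequencies, standard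
-- deviation at most √3 p ‖x‖², whatever n is.  Averaging 48 e² rows and
-- taking a majority over groups gives an estimate that fails rarely.
--
-- Since the model is nonuniform, the vectors σ need not be computed from short
-- seeds: by a Chernoff bound and a union bound over all frequency vectors, a
-- fixed table of 2 ^ γ · 2 ^ c sketches, c ≈ log (n B), is good for every
-- vector except for fewer than 2 ^ c of its entries, and only the index of an
-- entry has to be stored.
--
-- The sampling rate must follow the length of the stream.  Levels change each
-- time the length grows by a factor R = poly (B / ε), and the sketch for a
-- level starts one level early; the part of the stream that it misses is
-- negligible because no frequency exceeds B.  The counters are kept modulo a
-- number M = poly (B / ε), which is harmless as an accurate row is small.  The
-- output is the least value near the estimates of most groups.
--
-- When δ > ½, only the probability η = 1 − δ of success is required while
-- log (1 / δ) ≈ η shrinks the space.  Then the sketch is run with a precision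
-- coarser by a factor of about 1 / η, and a point of a fine grid in the
-- resulting window is guessed; if η is so small that even the octave of ‖x‖²
-- can be guessed, no sketch is kept at all.

open import Defs
open import Algebra.Bundles using (CommutativeRing)
import Algebra.Properties.CommutativeMonoid.Sum as CommutativeMonoidSum
open import Algebra.Properties.CommutativeSemigroup using (interchange)
import Algebra.Properties.CommutativeSemiring.Exp as CommutativeSemiringExp
import Algebra.Properties.Semiring.Exp as SemiringExp
import Algebra.Properties.Semiring.Sum as SemiringSum
open import Data.Bool.Base using (Bool; true; false; if_then_else_)
open import Data.Empty using (⊥-elim)
open import Data.Fin.Base as Fin
  using (Fin; zero; suc; toℕ; combine; quotient; remainder; remQuot; finToFun; _↑ˡ_; _↑ʳ_)
import Data.Fin.Properties as Fin
open import Data.Fin.Properties using (remQuot-combine; combine-remQuot)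
import Data.Integer.Base as ℤ
import Data.Integer.Properties as ℤ
open import Data.List.Base as List using (List; []; _∷_; length; cartesianProductWith; upTo; filter; _ʳ++_)
open import Data.List.Membership.Propositional using (_∈_)
open import Data.List.Membership.Propositional.Properties
  using (∈-cartesianProductWith⁺; ∈-upTo⁺; ∈-filter⁺; ∈-filter⁻; ∈-map⁻; ∈-map⁺)
import Data.List.Properties as List
open import Data.List.Relation.Unary.Any using (here; there)
open import Data.Nat.Base as ℕ using (ℕ; zero; suc; pred; NonZero; NonTrivial; z≤n; s≤s; ∣_-_∣)
import Data.Nat.Coprimality as Coprime
open import Data.Nat.DivMod using (_%_; _mod_; m%n<n; m<n⇒m%n≡m; %-distribˡ-+; [m+kn]%n≡m%n; m%n%n≡m%n)
import Data.Nat.Properties as ℕ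
open import Data.Nat.Tactic.RingSolver using () renaming (solve-∀ to solve-ℕ)
open import Data.Product.Base using (∃-syntax; Σ-syntax; _×_; _,_; proj₁; proj₂; uncurry)
open import Data.Rational.Base as ℚ using (ℚ; 0ℚ; 1ℚ; ½; Positive; _÷_)
import Data.Rational.Properties as ℚ
import Data.Rational.Unnormalised.Base as ℚᵘ
import Data.Rational.Unnormalised.Properties as ℚᵘ
open import Data.Sum.Base using (_⊎_; inj₁; inj₂; [_,_]′)
open import Data.Unit.Base using (⊤; tt)
open import Data.Vec.Base as Vec
  using (Vec; []; _∷_; count; allFin; lookup; tabulate; zipWith; replicate; toList)
import Data.Vec.Properties as Vec
open import Function.Base using (_∘_; id)
open import Level using (0ℓ)
open import Relation.Binary.PropositionalEquality
  using (_≡_; refl; sym; trans; cong; cong₂; subst; subst₂; module ≡-Reasoning)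
open import Relation.Nullary using (¬_; Dec; yes; no; does; contradiction)
open import Relation.Nullary.Decidable using (¬?; _×-dec_; decidable-stable; dec⇒maybe)
open import Relation.Unary using (Pred; Decidable)
open import Tactic.RingSolver using (solve-∀)
open import Tactic.RingSolver.Core.AlmostCommutativeRing using (AlmostCommutativeRing; fromCommutativeRing)

-- A union bound over all frequency vectors is affordable because the chance that a random table has
-- `a` or more bad entries decays like 2^-a. The vectors number fewer than 2^a already for some `a`
-- = O (n B), so the index of an entry costs log (1/δ) + log n + log B + O (1) bits. A stream is
-- judged only by the level of its final length, so the levels need no joint guarantee and one index
-- serves the tables of all of them.
--
-- The share log B of this cost is not covered by log (n/δ). It is charged to the first summand of
-- the bound, which works as soon as log (B/ε) ≥ 1 and log (1/δ) ≥ 1. For B = 1 and ε near 1 that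
-- summand may vanish, but then F₂ is the length of the stream and a plain counter suffices; if also
-- n = 1 and δ > ½, not even one bit may be available, and the length, 0 or 1, is guessed. For δ
-- near 1 the first summand shrinks as well. A counter of log (n B) bits is then affordable only if
-- log B is at most about log n; otherwise F₂ has O (log B) possible octaves altogether and is
-- guessed without any memory.

module Expectations where

  -- Rational inequalities, expectations, Chernoff and union bounds.

  open import Data.Rational.Base hiding (NonZero; nonZero; ∣_∣)
  open import Data.Rational.Properties hiding (_≟_)

  ℚ-ring : AlmostCommutativeRing 0ℓ 0ℓ
  ℚ-ring = fromCommutativeRing +-*-commutativeRing λ x → dec⇒maybe (0ℚ ℚ.≟ x)

  fromℕ≡mkℚ : ∀ k → fromℕ k ≡ mkℚ (ℤ.+ k) 0 (Coprime.sym (Coprime.1-coprimeTo k))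
  fromℕ≡mkℚ k = normalize-coprime _

  fromℕ-+ : ∀ a b → fromℕ (a ℕ.+ b) ≡ fromℕ a + fromℕ b
  fromℕ-+ a b rewrite fromℕ≡mkℚ a | fromℕ≡mkℚ b =
    cong (_/ 1) (sym (cong₂ ℤ._+_ (ℤ.*-identityʳ (ℤ.+ a)) (ℤ.*-identityʳ (ℤ.+ b))))

  fromℕ-* : ∀ a b → fromℕ (a ℕ.* b) ≡ fromℕ a * fromℕ b
  fromℕ-* a b rewrite fromℕ≡mkℚ a | fromℕ≡mkℚ b = cong (_/ 1) (ℤ.pos-* a b)

  fromℕ-suc : ∀ a → fromℕ (suc a) ≡ 1ℚ + fromℕ a
  fromℕ-suc = fromℕ-+ 1

  fromℕ-^ : ∀ a b → fromℕ (a ℕ.^ b) ≡ fromℕ a ^ℚ b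
  fromℕ-^ a zero    = refl
  fromℕ-^ a (suc b) = trans (fromℕ-* a (a ℕ.^ b)) (cong (fromℕ a *_) (fromℕ-^ a b))

  fromℕ-mono-≤ : ∀ {a b} → a ℕ.≤ b → fromℕ a ≤ fromℕ b
  fromℕ-mono-≤ {a} {b} a≤b rewrite fromℕ≡mkℚ a | fromℕ≡mkℚ b =
    *≤* (ℤ.*-monoʳ-≤-nonNeg (ℤ.+ 1) (ℤ.+≤+ a≤b))

  fromℕ-mono-< : ∀ {a b} → a ℕ.< b → fromℕ a < fromℕ b
  fromℕ-mono-< {a} {b} a<b rewrite fromℕ≡mkℚ a | fromℕ≡mkℚ b =
    *<* (ℤ.*-monoʳ-<-pos (ℤ.+ 1) (ℤ.+<+ a<b))

  fromℕ-cancel-≤ : ∀ {a b} → fromℕ a ≤ fromℕ b → a ℕ.≤ b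
  fromℕ-cancel-≤ a≤b = ℕ.≮⇒≥ λ b<a → <-irrefl refl (<-≤-trans (fromℕ-mono-< b<a) a≤b)

  fromℕ-cancel-< : ∀ {a b} → fromℕ a < fromℕ b → a ℕ.< b
  fromℕ-cancel-< a<b = ℕ.≰⇒> λ b≤a → <-irrefl refl (<-≤-trans a<b (fromℕ-mono-≤ b≤a))

  0≤fromℕ : ∀ a → 0ℚ ≤ fromℕ a
  0≤fromℕ a = fromℕ-mono-≤ {0} {a} ℕ.z≤n

  0≤1 : 0ℚ ≤ 1ℚ
  0≤1 = 0≤fromℕ 1

  +-nonNeg : ∀ {a b} → 0ℚ ≤ a → 0ℚ ≤ b → 0ℚ ≤ a + b
  +-nonNeg {a} {b} 0≤a 0≤b = subst (_≤ a + b) (+-identityˡ 0ℚ) (+-mono-≤ 0≤a 0≤b)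

  *-nonNeg : ∀ {a b} → 0ℚ ≤ a → 0ℚ ≤ b → 0ℚ ≤ a * b
  *-nonNeg {a} {b} 0≤a 0≤b =
    nonNegative⁻¹ _ {{nonNeg*nonNeg⇒nonNeg a {{nonNegative 0≤a}} b {{nonNegative 0≤b}}}}

  *-pos : ∀ {a b} → 0ℚ < a → 0ℚ < b → 0ℚ < a * b
  *-pos {a} {b} 0<a 0<b = positive⁻¹ _ {{pos*pos⇒pos a {{positive 0<a}} b {{positive 0<b}}}}

  *-monoˡ-≤ : ∀ {a b} c → 0ℚ ≤ c → a ≤ b → c * a ≤ c * b
  *-monoˡ-≤ c 0≤c = *-monoˡ-≤-nonNeg c {{nonNegative 0≤c}}

  *-monoʳ-≤ : ∀ {a b} c → 0ℚ ≤ c → a ≤ b → a * c ≤ b * c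
  *-monoʳ-≤ c 0≤c = *-monoʳ-≤-nonNeg c {{nonNegative 0≤c}}

  *-mono-≤ : ∀ {a b c d} → 0ℚ ≤ a → 0ℚ ≤ d → a ≤ b → c ≤ d → a * c ≤ b * d
  *-mono-≤ 0≤a 0≤d a≤b c≤d = ≤-trans (*-monoˡ-≤ _ 0≤a c≤d) (*-monoʳ-≤ _ 0≤d a≤b)

  square-nonNeg : ∀ a → 0ℚ ≤ a * a
  square-nonNeg a with ≤-total 0ℚ a
  ... | inj₁ 0≤a = *-nonNeg 0≤a 0≤a
  ... | inj₂ a≤0 = subst (0ℚ ≤_) (neg-square a) (*-nonNeg (neg-antimono-≤ a≤0) (neg-antimono-≤ a≤0))
    where
    neg-square : ∀ a → (- a) * (- a) ≡ a * a
    neg-square = solve-∀ ℚ-ring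

  p≤p+q : ∀ {p q} → 0ℚ ≤ q → p ≤ p + q
  p≤p+q {p} {q} 0≤q = subst (_≤ p + q) (+-identityʳ p) (+-monoʳ-≤ p 0≤q)

  p≤q⇒0≤q-p : ∀ {p q} → p ≤ q → 0ℚ ≤ q - p
  p≤q⇒0≤q-p {p} {q} p≤q = subst (_≤ q - p) (+-inverseʳ p) (+-monoˡ-≤ (- p) p≤q)

  0≤q-p⇒p≤q : ∀ {p q} → 0ℚ ≤ q - p → p ≤ q
  0≤q-p⇒p≤q {p} {q} 0≤q-p = subst (p ≤_) (cancel p q) (p≤p+q 0≤q-p)
    where
    cancel : ∀ p q → p + (q - p) ≡ q
    cancel = solve-∀ ℚ-ring

  open CommutativeSemiringExp (CommutativeRing.commutativeSemiring +-*-commutativeRing) using (^-distrib-*) public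
  open SemiringExp (CommutativeRing.semiring +-*-commutativeRing) using () renaming (^-assocʳ to ^-*-assoc) public

  ^-nonNeg : ∀ {a} → 0ℚ ≤ a → ∀ n → 0ℚ ≤ a ^ℚ n
  ^-nonNeg 0≤a zero    = 0≤1
  ^-nonNeg 0≤a (suc n) = *-nonNeg 0≤a (^-nonNeg 0≤a n)

  ^-mono-≤ : ∀ {a b} → 0ℚ ≤ a → a ≤ b → ∀ n → a ^ℚ n ≤ b ^ℚ n
  ^-mono-≤ 0≤a a≤b zero    = ≤-refl
  ^-mono-≤ 0≤a a≤b (suc n) =
    *-mono-≤ 0≤a (^-nonNeg (≤-trans 0≤a a≤b) n) a≤b (^-mono-≤ 0≤a a≤b n)

  1≤^ : ∀ {a} → 1ℚ ≤ a → ∀ n → 1ℚ ≤ a ^ℚ n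
  1≤^ 1≤a zero    = ≤-refl
  1≤^ 1≤a (suc n) = *-mono-≤ 0≤1 (≤-trans 0≤1 (1≤^ 1≤a n)) 1≤a (1≤^ 1≤a n)

  ^-monoʳ-≤ : ∀ {a m n} → 1ℚ ≤ a → m ℕ.≤ n → a ^ℚ m ≤ a ^ℚ n
  ^-monoʳ-≤ {n = n} 1≤a ℕ.z≤n       = 1≤^ 1≤a n
  ^-monoʳ-≤ {a = a} 1≤a (ℕ.s≤s m≤n) =
    *-monoˡ-≤ a (≤-trans 0≤1 1≤a) (^-monoʳ-≤ 1≤a m≤n)

  𝟙 : ∀ {P : Set} → Dec P → ℚ
  𝟙 d = if does d then 1ℚ else 0ℚ

  𝟙-nonNeg : ∀ {P : Set} (d : Dec P) → 0ℚ ≤ 𝟙 d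
  𝟙-nonNeg (yes _) = 0≤1
  𝟙-nonNeg (no  _) = ≤-refl

  𝟙<1⇒¬ : ∀ {P : Set} (d : Dec P) → 𝟙 d < 1ℚ → ¬ P
  𝟙<1⇒¬ (yes _) 1<1 _ = <-irrefl refl 1<1
  𝟙<1⇒¬ (no ¬p) _   = ¬p

  *-𝟙-≤ : ∀ {P : Set} (d : Dec P) {x y} → 0ℚ ≤ y → (P → x ≤ y) → x * 𝟙 d ≤ y
  *-𝟙-≤ (yes p) {x} {y} 0≤y x≤y = subst (_≤ y) (sym (*-identityʳ x)) (x≤y p)
  *-𝟙-≤ (no  _) {x} {y} 0≤y x≤y = subst (_≤ y) (sym (*-zeroʳ x)) 0≤y

  -- Probability enters as a monotone, linear, normalised functional, so that a rational sampling
  -- rate needs no finite sample space. It serves only to prove that good tables exist; the success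
  -- probability of the algorithm is counted separately, over its draws.
  record Expectation (A : Set) : Set₁ where
    field
      E       : (A → ℚ) → ℚ
      E-mono  : ∀ {f g} → (∀ a → f a ≤ g a) → E f ≤ E g
      E-+     : ∀ f g → E (λ a → f a + g a) ≡ E f + E g
      E-*     : ∀ c f → E (λ a → c * f a) ≡ c * E f
      E-const : ∀ c → E (λ _ → c) ≡ c
      -- the probabilistic method
      choose  : ∀ {f c} → E f < c → ∃[ a ] f a < c

    E-cong : ∀ {f g} → (∀ a → f a ≡ g a) → E f ≡ E g
    E-cong f≗g = ≤-antisym (E-mono λ a → ≤-reflexive (f≗g a))
                           (E-mono λ a → ≤-reflexive (sym (f≗g a)))

    E-nonNeg : ∀ {f} → (∀ a → 0ℚ ≤ f a) → 0ℚ ≤ E f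
    E-nonNeg {f} 0≤f = subst (_≤ E f) (E-const 0ℚ) (E-mono 0≤f)

  open Expectation

  power : ∀ {A} → Expectation A → ∀ n → Expectation (Vec A n)
  power D zero = record
    { E       = λ f → f []
    ; E-mono  = λ f≤g → f≤g []
    ; E-+     = λ _ _ → refl
    ; E-*     = λ _ _ → refl
    ; E-const = λ _ → refl
    ; choose  = λ f<c → [] , f<c
    }
  power D (suc n) = record
    { E       = λ f → E Dⁿ λ v → E D λ a → f (a ∷ v)
    ; E-mono  = λ f≤g → E-mono Dⁿ λ v → E-mono D λ a → f≤g (a ∷ v)
    ; E-+     = λ f g → trans (E-cong Dⁿ λ v → E-+ D _ _) (E-+ Dⁿ _ _)
    ; E-*     = λ c f → trans (E-cong Dⁿ λ v → E-* D c (λ a → f (a ∷ v))) (E-* Dⁿ c _)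
    ; E-const = λ c → trans (E-cong Dⁿ λ v → E-const D c) (E-const Dⁿ c)
    ; choose  = λ Ef<c → let v , Efv<c = choose Dⁿ Ef<c
                             a , fav<c = choose D Efv<c
                         in a ∷ v , fav<c
    }
    where Dⁿ = power D n

  ∑ : ∀ {A : Set} {n} → (A → ℚ) → Vec A n → ℚ
  ∑ f []      = 0ℚ
  ∑ f (x ∷ v) = f x + ∑ f v

  ∏ : ∀ {A : Set} {n} → (A → ℚ) → Vec A n → ℚ
  ∏ f []      = 1ℚ
  ∏ f (x ∷ v) = f x * ∏ f v

  module _ {A : Set} (D : Expectation A) where

    E-∏ : ∀ g n → E (power D n) (∏ g) ≡ E D g ^ℚ n
    E-∏ g zero    = refl
    E-∏ g (suc n) = begin
      E Dⁿ (λ v → E D λ a → g a * ∏ g v) ≡⟨ E-cong Dⁿ (λ v → trans (E-cong D λ a → *-comm (g a) (∏ g v)) (trans (E-* D (∏ g v) g) (*-comm (∏ g v) (E D g)))) ⟩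
      E Dⁿ (λ v → E D g * ∏ g v)         ≡⟨ E-* Dⁿ (E D g) (∏ g) ⟩
      E D g * E Dⁿ (∏ g)                 ≡⟨ cong (E D g *_) (E-∏ g n) ⟩
      E D g * E D g ^ℚ n                 ∎
      where
      open ≡-Reasoning
      Dⁿ = power D n

    -- The coordinates are independent and centred, so the cross terms vanish and the variances add
    -- up.
    E-square-sum : ∀ X → E D X ≡ 0ℚ → ∀ n →
                   E (power D n) (λ v → ∑ X v * ∑ X v) ≡ fromℕ n * E D (λ a → X a * X a)
    E-square-sum X EX≡0 zero    = sym (*-zeroˡ (E D λ a → X a * X a))
    E-square-sum X EX≡0 (suc n) = begin
      E Dⁿ (λ v → E D λ a → (X a + ∑ X v) * (X a + ∑ X v))
        ≡⟨ E-cong Dⁿ (λ v → step (∑ X v)) ⟩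
      E Dⁿ (λ v → V + ∑ X v * ∑ X v)
        ≡⟨ E-+ Dⁿ _ _ ⟩
      E Dⁿ (λ _ → V) + E Dⁿ (λ v → ∑ X v * ∑ X v)
        ≡⟨ cong₂ _+_ (E-const Dⁿ V) (E-square-sum X EX≡0 n) ⟩
      V + fromℕ n * V
        ≡⟨ factor V (fromℕ n) ⟩
      (1ℚ + fromℕ n) * V
        ≡⟨ cong (_* V) (sym (fromℕ-suc n)) ⟩
      fromℕ (suc n) * V ∎
      where
      open ≡-Reasoning
      Dⁿ = power D n
      V = E D (λ a → X a * X a)
      factor : ∀ V n → V + n * V ≡ (1ℚ + n) * V
      factor = solve-∀ ℚ-ring
      expand : ∀ x s → (x + s) * (x + s) ≡ x * x + ((s + s) * x + s * s)
      expand = solve-∀ ℚ-ring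
      drop : ∀ V s → V + ((s + s) * 0ℚ + s * s) ≡ V + s * s
      drop = solve-∀ ℚ-ring
      step : ∀ s → E D (λ a → (X a + s) * (X a + s)) ≡ V + s * s
      step s = begin
        E D (λ a → (X a + s) * (X a + s))             ≡⟨ E-cong D (λ a → expand (X a) s) ⟩
        E D (λ a → X a * X a + ((s + s) * X a + s * s)) ≡⟨ E-+ D _ _ ⟩
        V + E D (λ a → (s + s) * X a + s * s)         ≡⟨ cong (V +_) (E-+ D _ _) ⟩
        V + (E D (λ a → (s + s) * X a) + E D (λ _ → s * s)) ≡⟨ cong₂ (λ x y → V + (x + y)) (trans (E-* D (s + s) X) (cong ((s + s) *_) EX≡0)) (E-const D _) ⟩
        V + ((s + s) * 0ℚ + s * s)                    ≡⟨ drop V s ⟩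
        V + s * s                                     ∎

    module _ {P : Pred A 0ℓ} (P? : Decidable P) where

      -- Chernoff's argument: E (1 + μ)^#P factors over the coordinates.
      tail-bound : ∀ N a {μ} → 0ℚ ≤ μ →
                   E (power D N) (λ v → 𝟙 (a ℕ.≤? count P? v)) * (1ℚ + μ) ^ℚ a
                   ≤ (1ℚ + μ * E D (λ x → 𝟙 (P? x))) ^ℚ N
      tail-bound N a {μ} 0≤μ = begin
        E Dᴺ (λ v → 𝟙 (a ℕ.≤? count P? v)) * (1ℚ + μ) ^ℚ a   ≡⟨ trans (*-comm (E Dᴺ (λ v → 𝟙 (a ℕ.≤? count P? v))) ((1ℚ + μ) ^ℚ a)) (sym (E-* Dᴺ ((1ℚ + μ) ^ℚ a) _)) ⟩
        E Dᴺ (λ v → (1ℚ + μ) ^ℚ a * 𝟙 (a ℕ.≤? count P? v))   ≤⟨ E-mono Dᴺ markov ⟩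
        E Dᴺ (∏ g)                                            ≡⟨ E-∏ g N ⟩
        E D g ^ℚ N                                            ≡⟨ cong (_^ℚ N) Eg ⟩
        (1ℚ + μ * E D (λ x → 𝟙 (P? x))) ^ℚ N                  ∎
        where
        open ≤-Reasoning
        Dᴺ = power D N
        g : A → ℚ
        g x = 1ℚ + μ * 𝟙 (P? x)
        Eg : E D g ≡ 1ℚ + μ * E D (λ x → 𝟙 (P? x))
        Eg = trans (E-+ D _ _) (cong₂ _+_ (E-const D 1ℚ) (E-* D μ _))
        1≤1+μ : 1ℚ ≤ 1ℚ + μ
        1≤1+μ = p≤p+q 0≤μ
        ∏≡^ : ∀ {n} (v : Vec A n) → ∏ g v ≡ (1ℚ + μ) ^ℚ count P? v
        ∏≡^ []      = refl
        ∏≡^ (x ∷ v) with does (P? x)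
        ... | true  = cong₂ (λ m r → (1ℚ + m) * r) (*-identityʳ μ) (∏≡^ v)
        ... | false = trans (cong₂ (λ m r → (1ℚ + m) * r) (*-zeroʳ μ) (∏≡^ v)) (*-identityˡ _)
        markov : ∀ v → (1ℚ + μ) ^ℚ a * 𝟙 (a ℕ.≤? count P? v) ≤ ∏ g v
        markov v = subst ((1ℚ + μ) ^ℚ a * 𝟙 (a ℕ.≤? count P? v) ≤_) (sym (∏≡^ v)) (*-𝟙-≤ (a ℕ.≤? count P? v)
          (^-nonNeg (≤-trans 0≤1 1≤1+μ) (count P? v)) (^-monoʳ-≤ 1≤1+μ))

  module _ {A I : Set} (D : Expectation A) {f : I → A → ℚ} (0≤f : ∀ i a → 0ℚ ≤ f i a) where

    private
      total : List I → A → ℚ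
      total []      a = 0ℚ
      total (i ∷ L) a = f i a + total L a

      total-nonNeg : ∀ L a → 0ℚ ≤ total L a
      total-nonNeg []      a = ≤-refl
      total-nonNeg (i ∷ L) a = +-nonNeg (0≤f i a) (total-nonNeg L a)

      ∈⇒≤total : ∀ {i L} → i ∈ L → ∀ a → f i a ≤ total L a
      ∈⇒≤total {L = _ ∷ L} (here refl) a = p≤p+q (total-nonNeg L a)
      ∈⇒≤total {L = j ∷ L} (there i∈L) a =
        subst (_ ≤_) (+-comm _ (f j a)) (≤-trans (∈⇒≤total i∈L a) (p≤p+q (0≤f j a)))

      E-total : ∀ {c} L → (∀ {i} → i ∈ L → E D (f i) ≤ c) → E D (total L) ≤ fromℕ (length L) * c
      E-total {c} []      Ef≤c = ≤-reflexive (trans (E-const D 0ℚ) (sym (*-zeroˡ c)))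
      E-total {c} (i ∷ L) Ef≤c = begin
        E D (λ a → f i a + total L a)    ≡⟨ E-+ D _ _ ⟩
        E D (f i) + E D (total L)        ≤⟨ +-mono-≤ (Ef≤c (here refl)) (E-total L (λ i∈L → Ef≤c (there i∈L))) ⟩
        c + fromℕ (length L) * c         ≡⟨ factor c (fromℕ (length L)) ⟩
        (1ℚ + fromℕ (length L)) * c      ≡⟨ cong (_* c) (sym (fromℕ-suc (length L))) ⟩
        fromℕ (suc (length L)) * c       ∎
        where
        open ≤-Reasoning
        factor : ∀ V n → V + n * V ≡ (1ℚ + n) * V
        factor = solve-∀ ℚ-ring

    -- The sum over `L` has expectation below 1, so at some outcome it is below 1, and so is each of
    -- its nonnegative terms. For indicators, a value below 1 says that the bad event does not
    -- occur.
    union-bound : ∀ {c} L → (∀ {i} → i ∈ L → E D (f i) ≤ c) → fromℕ (length L) * c < 1ℚ →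
                  ∃[ a ] (∀ {i} → i ∈ L → f i a < 1ℚ)
    union-bound L Ef≤c small with choose D (≤-<-trans (E-total L Ef≤c) small)
    ... | a , total<1 = a , λ i∈L → ≤-<-trans (∈⇒≤total i∈L a) total<1

-- Moments of sparse random signed sums and Chebyshev's inequality.

module SignedSums where

  open import Data.Rational.Base hiding (NonZero; nonZero; ∣_∣)
  open import Data.Rational.Properties hiding (_≟_)
  open Expectations

  open Expectation

  data Ternary : Set where
    plus minus none : Ternary

  value : Ternary → ℚ
  value plus  = 1ℚ
  value minus = - 1ℚ
  value none  = 0ℚ

  ternary : ∀ {p} → 0ℚ ≤ p → p ≤ 1ℚ → Expectation Ternary
  ternary {p} 0≤p p≤1 = record
    { E       = mean
    ; E-mono  = mono
    ; E-+     = λ f g → additive p (f plus) (f minus) (f none) (g plus) (g minus) (g none)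
    ; E-*     = λ c f → homogeneous p c (f plus) (f minus) (f none)
    ; E-const = constant p
    ; choose  = pick
    }
    where
    mean : (Ternary → ℚ) → ℚ
    mean f = ½ * p * f plus + ½ * p * f minus + (1ℚ - p) * f none
    0≤½p : 0ℚ ≤ ½ * p
    0≤½p = *-nonNeg {½} {p} (nonNegative⁻¹ ½) 0≤p
    0≤1-p : 0ℚ ≤ 1ℚ - p
    0≤1-p = p≤q⇒0≤q-p p≤1
    mono : ∀ {f g} → (∀ s → f s ≤ g s) → mean f ≤ mean g
    mono f≤g = +-mono-≤ (+-mono-≤ (*-monoˡ-≤ (½ * p) 0≤½p (f≤g plus)) (*-monoˡ-≤ (½ * p) 0≤½p (f≤g minus)))
                        (*-monoˡ-≤ (1ℚ - p) 0≤1-p (f≤g none))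
    additive : ∀ p a b c a′ b′ c′ →
      ½ * p * (a + a′) + ½ * p * (b + b′) + (1ℚ - p) * (c + c′) ≡
      (½ * p * a + ½ * p * b + (1ℚ - p) * c) + (½ * p * a′ + ½ * p * b′ + (1ℚ - p) * c′)
    additive = solve-∀ ℚ-ring
    homogeneous : ∀ p d a b c →
      ½ * p * (d * a) + ½ * p * (d * b) + (1ℚ - p) * (d * c) ≡ d * (½ * p * a + ½ * p * b + (1ℚ - p) * c)
    homogeneous = solve-∀ ℚ-ring
    constant : ∀ p c → ½ * p * c + ½ * p * c + (1ℚ - p) * c ≡ c
    constant = solve-∀ ℚ-ring
    pick : ∀ {f c} → mean f < c → ∃[ s ] f s < c
    pick {f} {c} mf<c with f plus <? c | f minus <? c | f none <? c
    ... | yes f<c | _       | _       = plus , f<c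
    ... | no  _   | yes f<c | _       = minus , f<c
    ... | no  _   | no  _   | yes f<c = none , f<c
    ... | no f≮c₁ | no f≮c₂ | no f≮c₃ = ⊥-elim (<-irrefl refl (≤-<-trans c≤mf mf<c))
      where
      c≤f : ∀ s → c ≤ f s
      c≤f plus  = ≮⇒≥ f≮c₁
      c≤f minus = ≮⇒≥ f≮c₂
      c≤f none  = ≮⇒≥ f≮c₃
      c≤mf : c ≤ mean f
      c≤mf = subst (_≤ mean f) (constant p c) (mono c≤f)

  dot : ∀ {n} → Vec ℚ n → Vec Ternary n → ℚ
  dot []      []      = 0ℚ
  dot (x ∷ w) (s ∷ σ) = value s * x + dot w σ

  square fourth : ℚ → ℚ
  square x = x * x
  fourth x = x * x * (x * x)

  module Moments {p} (0≤p : 0ℚ ≤ p) (p≤1 : p ≤ 1ℚ) where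

    rows : ∀ n → Expectation (Vec Ternary n)
    rows = power (ternary 0≤p p≤1)

    second-moment : ∀ {n} (w : Vec ℚ n) → E (rows n) (λ σ → square (dot w σ)) ≡ p * ∑ square w
    second-moment []              = sym (*-zeroʳ p)
    second-moment {suc n} (x ∷ w) = begin
      E Dⁿ (λ σ → E D λ s → square (value s * x + dot w σ)) ≡⟨ E-cong Dⁿ (λ σ → average p x (dot w σ)) ⟩
      E Dⁿ (λ σ → p * (x * x) + square (dot w σ))           ≡⟨ E-+ Dⁿ _ _ ⟩
      E Dⁿ (λ _ → p * (x * x)) + E Dⁿ (λ σ → square (dot w σ)) ≡⟨ cong₂ _+_ (E-const Dⁿ _) (second-moment w) ⟩
      p * (x * x) + p * ∑ square w                          ≡⟨ sym (*-distribˡ-+ p (x * x) (∑ square w)) ⟩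
      p * (x * x + ∑ square w)                              ∎
      where
      open ≡-Reasoning
      D  = ternary 0≤p p≤1
      Dⁿ = rows n
      average : ∀ p x z → ½ * p * ((1ℚ * x + z) * (1ℚ * x + z)) + ½ * p * ((- 1ℚ * x + z) * (- 1ℚ * x + z))
                          + (1ℚ - p) * ((0ℚ * x + z) * (0ℚ * x + z)) ≡ p * (x * x) + z * z
      average = solve-∀ ℚ-ring

    -- By symmetry of the signs the odd powers cancel, and a new entry x contributes p x⁴ and the
    -- cross term 6 p x² · p ∑ w². The square of p (x² + ∑ w²), taken three times, yields exactly
    -- this cross term, with 3 (p x²)² to spare.
    fourth-moment : ∀ {n} (w : Vec ℚ n) →
      E (rows n) (λ σ → fourth (dot w σ)) ≤ p * ∑ fourth w + fromℕ 3 * square (p * ∑ square w)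
    fourth-moment []              = ≤-reflexive (sym (vanish p))
      where
      vanish : ∀ p → p * 0ℚ + fromℕ 3 * (p * 0ℚ * (p * 0ℚ)) ≡ 0ℚ
      vanish = solve-∀ ℚ-ring
    fourth-moment {suc n} (x ∷ w) = begin
      E Dⁿ (λ σ → E D λ s → fourth (value s * x + dot w σ))
        ≡⟨ E-cong Dⁿ (λ σ → average p x (dot w σ)) ⟩
      E Dⁿ (λ σ → p * fourth x + (fromℕ 6 * (p * (x * x)) * square (dot w σ) + fourth (dot w σ)))
        ≡⟨ trans (E-+ Dⁿ _ _) (cong₂ _+_ (E-const Dⁿ (p * fourth x)) (trans (E-+ Dⁿ _ _) (cong (_+ E Dⁿ (λ σ → fourth (dot w σ)))
             (trans (E-* Dⁿ (fromℕ 6 * (p * (x * x))) _) (cong (fromℕ 6 * (p * (x * x)) *_) (second-moment w)))))) ⟩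
      p * fourth x + (fromℕ 6 * (p * (x * x)) * (p * ∑ square w) + E Dⁿ (λ σ → fourth (dot w σ)))
        ≤⟨ +-monoʳ-≤ (p * fourth x) (+-monoʳ-≤ (fromℕ 6 * (p * (x * x)) * (p * ∑ square w)) (fourth-moment w)) ⟩
      p * fourth x + (fromℕ 6 * (p * (x * x)) * (p * ∑ square w) + (p * ∑ fourth w + fromℕ 3 * square (p * ∑ square w)))
        ≤⟨ p≤p+q (*-nonNeg {fromℕ 3} {square (p * (x * x))} (0≤fromℕ 3) (square-nonNeg (p * (x * x)))) ⟩
      p * fourth x + (fromℕ 6 * (p * (x * x)) * (p * ∑ square w) + (p * ∑ fourth w + fromℕ 3 * square (p * ∑ square w)))
        + fromℕ 3 * square (p * (x * x))
        ≡⟨ collect p x (∑ square w) (∑ fourth w) ⟩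
      p * (fourth x + ∑ fourth w) + fromℕ 3 * square (p * (square x + ∑ square w)) ∎
      where
      open ≤-Reasoning
      D  = ternary 0≤p p≤1
      Dⁿ = rows n
      average : ∀ p x z →
        ½ * p * ((1ℚ * x + z) * (1ℚ * x + z) * ((1ℚ * x + z) * (1ℚ * x + z)))
        + ½ * p * ((- 1ℚ * x + z) * (- 1ℚ * x + z) * ((- 1ℚ * x + z) * (- 1ℚ * x + z)))
        + (1ℚ - p) * ((0ℚ * x + z) * (0ℚ * x + z) * ((0ℚ * x + z) * (0ℚ * x + z)))
        ≡ p * (x * x * (x * x)) + (fromℕ 6 * (p * (x * x)) * (z * z) + z * z * (z * z))
      average = solve-∀ ℚ-ring
      collect : ∀ p x s t →
        p * (x * x * (x * x)) + (fromℕ 6 * (p * (x * x)) * (p * s) + (p * t + fromℕ 3 * (p * s * (p * s))))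
          + fromℕ 3 * (p * (x * x) * (p * (x * x)))
        ≡ p * (x * x * (x * x) + t) + fromℕ 3 * (p * (x * x + s) * (p * (x * x + s)))
      collect = solve-∀ ℚ-ring

    module _ {n} (w : Vec ℚ n) where

      private
        G = p * ∑ square w

      deviation : Vec Ternary n → ℚ
      deviation σ = square (dot w σ) - G

      E-deviation : E (rows n) deviation ≡ 0ℚ
      E-deviation = begin
        E (rows n) (λ σ → square (dot w σ) - G) ≡⟨ E-+ (rows n) _ _ ⟩
        E (rows n) (λ σ → square (dot w σ)) + E (rows n) (λ _ → - G) ≡⟨ cong₂ _+_ (second-moment w) (E-const (rows n) (- G)) ⟩
        G - G                                   ≡⟨ +-inverseʳ G ⟩
        0ℚ                                      ∎
        where open ≡-Reasoning

      -- The hypothesis turns the bound on the fourth moment into 4 G²; subtracting the squared mean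
      -- leaves 3 G².
      variance : p * ∑ fourth w ≤ G * G → E (rows n) (λ σ → deviation σ * deviation σ) ≤ fromℕ 3 * (G * G)
      variance light = begin
        E (rows n) (λ σ → deviation σ * deviation σ)
          ≡⟨ E-cong (rows n) (λ σ → expand (dot w σ) G) ⟩
        E (rows n) (λ σ → fourth (dot w σ) + ((- (G + G)) * square (dot w σ) + G * G))
          ≡⟨ trans (E-+ (rows n) _ _) (cong (E (rows n) (λ σ → fourth (dot w σ)) +_) (trans (E-+ (rows n) _ _)
               (cong₂ _+_ (trans (E-* (rows n) (- (G + G)) _) (cong (- (G + G) *_) (second-moment w))) (E-const (rows n) (G * G))))) ⟩
        E (rows n) (λ σ → fourth (dot w σ)) + (- (G + G) * G + G * G)
          ≤⟨ +-monoˡ-≤ (- (G + G) * G + G * G) (≤-trans (fourth-moment w) (+-monoˡ-≤ (fromℕ 3 * (G * G)) light)) ⟩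
        G * G + fromℕ 3 * (G * G) + (- (G + G) * G + G * G)
          ≡⟨ cancel G ⟩
        fromℕ 3 * (G * G) ∎
        where
        open ≤-Reasoning
        expand : ∀ z G → (z * z - G) * (z * z - G) ≡ z * z * (z * z) + ((- (G + G)) * (z * z) + G * G)
        expand = solve-∀ ℚ-ring
        cancel : ∀ G → G * G + fromℕ 3 * (G * G) + (- (G + G) * G + G * G) ≡ fromℕ 3 * (G * G)
        cancel = solve-∀ ℚ-ring

      -- Squared form of |∑ deviation| > k G / e: the average of the k rows misses its mean by a
      -- relative error above 1/e.
      GroupBad : ℕ → ∀ {k} → Pred (Vec (Vec Ternary n) k) 0ℓ
      GroupBad e {k} v = square (fromℕ k * G) < fromℕ (e ℕ.* e) * square (∑ deviation v)

      groupBad? : ∀ e {k} → Decidable (GroupBad e {k})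
      groupBad? e v = _ <? _

      -- The variance of the sum is at most 3 k G², so a group is bad with probability at most 3 e²
      -- / k, and 48 = 3 · 16 makes this 1/16.
      chebyshev : 0ℚ < G → p * ∑ fourth w ≤ G * G → ∀ e k .{{_ : NonZero k}} → 48 ℕ.* (e ℕ.* e) ℕ.≤ k →
                  fromℕ 16 * E (power (rows n) k) (λ v → 𝟙 (groupBad? e v)) ≤ 1ℚ
      chebyshev 0<G light e k 48e²≤k = *-cancelˡ-≤-pos (square (fromℕ k * G)) {{positive 0<kG²}} (begin
        square kG * (fromℕ 16 * P)  ≡⟨ trans (rotate (square kG) (fromℕ 16) P) (cong (fromℕ 16 *_) (sym (E-* Dᵏ (square kG) _))) ⟩
        fromℕ 16 * E Dᵏ (λ v → square kG * 𝟙 (groupBad? e v))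
          ≤⟨ *-monoˡ-≤ (fromℕ 16) (0≤fromℕ 16) (E-mono Dᵏ λ v → *-𝟙-≤ (groupBad? e v) {square kG}
               (*-nonNeg {fromℕ (e ℕ.* e)} (0≤fromℕ (e ℕ.* e)) (square-nonNeg (∑ deviation v))) <⇒≤) ⟩
        fromℕ 16 * E Dᵏ (λ v → e² * square (∑ deviation v))
          ≡⟨ cong (fromℕ 16 *_) (trans (E-* Dᵏ e² _) (cong (e² *_) (E-square-sum (rows n) deviation E-deviation k))) ⟩
        fromℕ 16 * (e² * (fromℕ k * E (rows n) (λ σ → deviation σ * deviation σ)))
          ≤⟨ *-monoˡ-≤ (fromℕ 16) (0≤fromℕ 16) (*-monoˡ-≤ e² (0≤fromℕ (e ℕ.* e)) (*-monoˡ-≤ (fromℕ k) (0≤fromℕ k) (variance light))) ⟩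
        fromℕ 16 * (e² * (fromℕ k * (fromℕ 3 * (G * G))))
          ≡⟨ trans (regroup e² (fromℕ k) G) (cong (_* (fromℕ k * (G * G))) (sym (fromℕ-* 48 (e ℕ.* e)))) ⟩
        fromℕ (48 ℕ.* (e ℕ.* e)) * (fromℕ k * (G * G))
          ≤⟨ *-monoʳ-≤ (fromℕ k * (G * G)) (*-nonNeg {fromℕ k} (0≤fromℕ k) (square-nonNeg G)) (fromℕ-mono-≤ 48e²≤k) ⟩
        fromℕ k * (fromℕ k * (G * G))
          ≡⟨ regroup′ (fromℕ k) G ⟩
        square kG * 1ℚ ∎)
        where
        open ≤-Reasoning
        Dᵏ = power (rows n) k
        kG = fromℕ k * G
        e² = fromℕ (e ℕ.* e)
        P  = E Dᵏ (λ v → 𝟙 (groupBad? e v))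
        0<kG² : 0ℚ < square kG
        0<kG² = *-pos {kG} {kG} 0<kG 0<kG
          where 0<kG = *-pos {fromℕ k} {G} (fromℕ-mono-< (ℕ.>-nonZero⁻¹ k)) 0<G
        rotate : ∀ a b c → a * (b * c) ≡ b * (a * c)
        rotate = solve-∀ ℚ-ring
        regroup : ∀ e k G → fromℕ 16 * (e * (k * (fromℕ 3 * (G * G)))) ≡ fromℕ 48 * e * (k * (G * G))
        regroup = solve-∀ ℚ-ring
        regroup′ : ∀ k G → k * (k * (G * G)) ≡ k * G * (k * G) * 1ℚ
        regroup′ = solve-∀ ℚ-ring

-- Random tables of sketches that serve many vectors at once.

module RandomTables where

  open import Data.Rational.Base hiding (NonZero; nonZero; ∣_∣)
  open import Data.Rational.Properties hiding (_≟_)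
  open Expectations
  open SignedSums

  open Expectation

  -- Induction with (1 + x) (1 - (d + 1) x) ≤ 1 - d x. It takes the place of the estimate of (1 +
  -- x)^d by an exponential.
  ^-upper-bound : ∀ {x} → 0ℚ ≤ x → ∀ d → (1ℚ + x) ^ℚ d * (1ℚ - fromℕ d * x) ≤ 1ℚ
  ^-upper-bound {x} 0≤x zero    = ≤-reflexive (base x)
    where
    base : ∀ x → 1ℚ * (1ℚ - 0ℚ * x) ≡ 1ℚ
    base = solve-∀ ℚ-ring
  ^-upper-bound {x} 0≤x (suc d) = begin
    (1ℚ + x) * X * (1ℚ - fromℕ (suc d) * x)   ≡⟨ cong (λ c → (1ℚ + x) * X * (1ℚ - c * x)) (fromℕ-suc d) ⟩
    (1ℚ + x) * X * (1ℚ - (1ℚ + fromℕ d) * x)  ≤⟨ p≤p+q (*-nonNeg {X} {(1ℚ + fromℕ d) * (x * x)}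
                                                    (^-nonNeg (+-nonNeg 0≤1 0≤x) d)
                                                    (*-nonNeg {1ℚ + fromℕ d} {x * x} (+-nonNeg 0≤1 (0≤fromℕ d)) (square-nonNeg x))) ⟩
    (1ℚ + x) * X * (1ℚ - (1ℚ + fromℕ d) * x) + X * ((1ℚ + fromℕ d) * (x * x)) ≡⟨ expand x X (fromℕ d) ⟩
    X * (1ℚ - fromℕ d * x)                    ≤⟨ ^-upper-bound 0≤x d ⟩
    1ℚ ∎
    where
    open ≤-Reasoning
    X = (1ℚ + x) ^ℚ d
    expand : ∀ x X d → (1ℚ + x) * X * (1ℚ - (1ℚ + d) * x) + X * ((1ℚ + d) * (x * x)) ≡ X * (1ℚ - d * x)
    expand = solve-∀ ℚ-ring

  ^≤2 : ∀ {x} → 0ℚ ≤ x → ∀ d → x * (fromℕ 2 * fromℕ d) ≤ 1ℚ → (1ℚ + x) ^ℚ d ≤ fromℕ 2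
  ^≤2 {x} 0≤x d 2dx≤1 = begin
    X                                       ≤⟨ p≤p+q (*-nonNeg {X} {1ℚ - x * (fromℕ 2 * fromℕ d)} (^-nonNeg (+-nonNeg 0≤1 0≤x) d) (p≤q⇒0≤q-p 2dx≤1)) ⟩
    X + X * (1ℚ - x * (fromℕ 2 * fromℕ d))  ≡⟨ double x X (fromℕ d) ⟩
    fromℕ 2 * (X * (1ℚ - fromℕ d * x))      ≤⟨ *-monoˡ-≤ (fromℕ 2) (0≤fromℕ 2) (^-upper-bound 0≤x d) ⟩
    fromℕ 2                                 ∎
    where
    open ≤-Reasoning
    X = (1ℚ + x) ^ℚ d
    double : ∀ x X d → X + X * (1ℚ - x * (fromℕ 2 * d)) ≡ fromℕ 2 * (X * (1ℚ - d * x))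
    double = solve-∀ ℚ-ring

  1^ : ∀ m → 1ℚ ^ℚ m ≡ 1ℚ
  1^ zero    = refl
  1^ (suc m) = trans (*-identityˡ (1ℚ ^ℚ m)) (1^ m)

  Grid : ℕ → ℕ → ℕ → Set
  Grid n k r = Vec (Vec (Vec Ternary n) k) r

  module Amplification {p} (0≤p : 0ℚ ≤ p) (p≤1 : p ≤ 1ℚ) {n : ℕ} (e k γ a : ℕ) .{{_ : NonZero k}}
                       (48e²≤k : 48 ℕ.* (e ℕ.* e) ℕ.≤ k) where

    open Moments 0≤p p≤1

    private
      s : ℕ
      s = γ ℕ.+ 2
      groups = power (rows n) k
      grids  = power groups (2 ℕ.* s)
      tables = power grids (2 ℕ.^ γ ℕ.* a)

    gridBad? : ∀ (w : Vec ℚ n) → Decidable (λ (g : Grid n k (2 ℕ.* s)) → s ℕ.≤ count (groupBad? w e) g)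
    gridBad? w g = s ℕ.≤? count (groupBad? w e) g

    record Light (w : Vec ℚ n) : Set where
      constructor light
      field
        positive-mass : 0ℚ < p * ∑ square w
        light-fourth  : p * ∑ fourth w ≤ square (p * ∑ square w)

    -- Chernoff's bound with weight 16 = 1 + 15: a group is bad with probability Q ≤ 1/16, so 16^s P
    -- ≤ (1 + 15 Q)^(2 s) ≤ 4^s, that is, P ≤ 4^-s. As s = γ + 2, 4^s is 16 · 4^γ; the factor 6 ·
    -- 2^γ is the part of it used for tables.
    grid-tail : ∀ {w} → Light w →
                E grids (λ g → 𝟙 (gridBad? w g)) * (fromℕ 6 * fromℕ (2 ℕ.^ γ)) ≤ 1ℚ
    grid-tail {w} (light 0<G p∑⁴≤G²) = ≤-trans (*-monoˡ-≤ P 0≤P 6·2^γ≤4^s) P4^s≤1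
      where
      open ≤-Reasoning
      P = E grids (λ g → 𝟙 (gridBad? w g))
      0≤P : 0ℚ ≤ P
      0≤P = E-nonNeg grids λ g → 𝟙-nonNeg (gridBad? w g)
      Q = E groups (λ v → 𝟙 (groupBad? w e v))
      0≤Q : 0ℚ ≤ Q
      0≤Q = E-nonNeg groups λ v → 𝟙-nonNeg (groupBad? w e v)
      0≤1+15Q : 0ℚ ≤ 1ℚ + fromℕ 15 * Q
      0≤1+15Q = +-nonNeg 0≤1 (*-nonNeg {fromℕ 15} {Q} (0≤fromℕ 15) 0≤Q)
      1+15Q≤2 : 1ℚ + fromℕ 15 * Q ≤ fromℕ 2
      1+15Q≤2 = +-monoʳ-≤ 1ℚ (≤-trans (*-monoʳ-≤ Q 0≤Q (fromℕ-mono-≤ {15} {16} (ℕ.n≤1+n 15)))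
                  (chebyshev w 0<G p∑⁴≤G² e k 48e²≤k))
      16^s : fromℕ 16 ^ℚ s ≡ fromℕ 4 ^ℚ s * fromℕ 4 ^ℚ s
      16^s = ^-distrib-* (fromℕ 4) (fromℕ 4) s
      2^2s : fromℕ 2 ^ℚ (2 ℕ.* s) ≡ fromℕ 4 ^ℚ s
      2^2s = sym (^-*-assoc (fromℕ 2) 2 s)
      4^s>0 : 0ℚ < fromℕ 4 ^ℚ s
      4^s>0 = <-≤-trans {0ℚ} {1ℚ} {fromℕ 4 ^ℚ s} (fromℕ-mono-< {0} {1} (ℕ.n<1+n 0)) (1≤^ (fromℕ-mono-≤ {1} {4} (ℕ.s≤s ℕ.z≤n)) s)
      tail : P * fromℕ 16 ^ℚ s ≤ fromℕ 4 ^ℚ s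
      tail = begin
        P * fromℕ 16 ^ℚ s                    ≤⟨ tail-bound groups (groupBad? w e) (2 ℕ.* s) s (0≤fromℕ 15) ⟩
        (1ℚ + fromℕ 15 * Q) ^ℚ (2 ℕ.* s)     ≤⟨ ^-mono-≤ 0≤1+15Q 1+15Q≤2 (2 ℕ.* s) ⟩
        fromℕ 2 ^ℚ (2 ℕ.* s)                 ≡⟨ 2^2s ⟩
        fromℕ 4 ^ℚ s                         ∎
      P4^s≤1 : P * fromℕ 4 ^ℚ s ≤ 1ℚ
      P4^s≤1 = *-cancelʳ-≤-pos (fromℕ 4 ^ℚ s) {{positive 4^s>0}} (begin
        P * fromℕ 4 ^ℚ s * fromℕ 4 ^ℚ s      ≡⟨ trans (*-assoc P (fromℕ 4 ^ℚ s) (fromℕ 4 ^ℚ s)) (cong (P *_) (sym 16^s)) ⟩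
        P * fromℕ 16 ^ℚ s                    ≤⟨ tail ⟩
        fromℕ 4 ^ℚ s                         ≡⟨ sym (*-identityˡ (fromℕ 4 ^ℚ s)) ⟩
        1ℚ * fromℕ 4 ^ℚ s                    ∎)
      6·2^γ≤4^s : fromℕ 6 * fromℕ (2 ℕ.^ γ) ≤ fromℕ 4 ^ℚ s
      6·2^γ≤4^s = subst₂ _≤_ (fromℕ-* 6 (2 ℕ.^ γ)) (fromℕ-^ 4 s) (fromℕ-mono-≤
        (ℕ.≤-trans (ℕ.*-mono-≤ (ℕ.m≤m+n 6 10) (ℕ.^-monoˡ-≤ γ (ℕ.m≤m+n 2 2)))
          (ℕ.≤-reflexive (trans (ℕ.*-comm 16 (4 ℕ.^ γ)) (sym (ℕ.^-distribˡ-+-* 4 γ 2))))))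

    -- Chernoff's bound once more, now with weight 4 = 1 + 3. Since 3 P · 2 · 2^γ ≤ 1, (1 + 3
    -- P)^(2^γ) is at most 2, and therefore R · 4^a ≤ 2^a. The tolerated fraction 2^-γ of bad
    -- entries is what buys a failure probability exponential in `a`.
    table-tail : ∀ {w} → Light w →
                 E tables (λ T → 𝟙 (a ℕ.≤? count (gridBad? w) T)) ≤ ½ ^ℚ a
    table-tail {w} light-w = begin
      R                          ≡⟨ sym (*-identityʳ R) ⟩
      R * 1ℚ                     ≡⟨ cong (R *_) (sym 4^a½^a½^a) ⟩
      R * (fromℕ 4 ^ℚ a * (½ ^ℚ a * ½ ^ℚ a)) ≡⟨ sym (*-assoc R (fromℕ 4 ^ℚ a) (½ ^ℚ a * ½ ^ℚ a)) ⟩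
      R * fromℕ 4 ^ℚ a * (½ ^ℚ a * ½ ^ℚ a)   ≤⟨ *-monoʳ-≤ (½ ^ℚ a * ½ ^ℚ a) (square-nonNeg (½ ^ℚ a)) tail ⟩
      fromℕ 2 ^ℚ a * (½ ^ℚ a * ½ ^ℚ a)       ≡⟨ sym (*-assoc (fromℕ 2 ^ℚ a) (½ ^ℚ a) (½ ^ℚ a)) ⟩
      fromℕ 2 ^ℚ a * ½ ^ℚ a * ½ ^ℚ a         ≡⟨ cong (_* ½ ^ℚ a) (trans (sym (^-distrib-* (fromℕ 2) ½ a)) (1^ a)) ⟩
      1ℚ * ½ ^ℚ a                            ≡⟨ *-identityˡ (½ ^ℚ a) ⟩
      ½ ^ℚ a ∎
      where
      open ≤-Reasoning
      R = E tables (λ T → 𝟙 (a ℕ.≤? count (gridBad? w) T))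
      P = E grids (λ g → 𝟙 (gridBad? w g))
      0≤P : 0ℚ ≤ P
      0≤P = E-nonNeg grids λ g → 𝟙-nonNeg (gridBad? w g)
      0≤3P : 0ℚ ≤ fromℕ 3 * P
      0≤3P = *-nonNeg {fromℕ 3} {P} (0≤fromℕ 3) 0≤P
      4^a½^a½^a : fromℕ 4 ^ℚ a * (½ ^ℚ a * ½ ^ℚ a) ≡ 1ℚ
      4^a½^a½^a = trans (cong (fromℕ 4 ^ℚ a *_) (sym (^-distrib-* ½ ½ a)))
                    (trans (sym (^-distrib-* (fromℕ 4) (½ * ½) a)) (1^ a))
      double : ∀ P d → P * (fromℕ 6 * d) ≡ fromℕ 3 * P * (fromℕ 2 * d)
      double = solve-∀ ℚ-ring
      tail : R * fromℕ 4 ^ℚ a ≤ fromℕ 2 ^ℚ a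
      tail = begin
        R * fromℕ 4 ^ℚ a
          ≤⟨ tail-bound grids (gridBad? w) (2 ℕ.^ γ ℕ.* a) a (0≤fromℕ 3) ⟩
        (1ℚ + fromℕ 3 * P) ^ℚ (2 ℕ.^ γ ℕ.* a)
          ≡⟨ sym (^-*-assoc (1ℚ + fromℕ 3 * P) (2 ℕ.^ γ) a) ⟩
        ((1ℚ + fromℕ 3 * P) ^ℚ (2 ℕ.^ γ)) ^ℚ a
          ≤⟨ ^-mono-≤ (^-nonNeg (+-nonNeg 0≤1 0≤3P) (2 ℕ.^ γ))
               (^≤2 0≤3P (2 ℕ.^ γ) (subst (_≤ 1ℚ) (double P (fromℕ (2 ℕ.^ γ))) (grid-tail light-w))) a ⟩
        fromℕ 2 ^ℚ a ∎

    good-table : ∀ L → (∀ {w} → w ∈ L → Light w) → length L ℕ.< 2 ℕ.^ a →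
                 ∃[ T ] (∀ {w} → w ∈ L → count {n = 2 ℕ.^ γ ℕ.* a} (gridBad? w) T ℕ.< a)
    good-table L light-L ∣L∣<2^a = proj₁ found , λ {w} w∈L →
      ℕ.≰⇒> (𝟙<1⇒¬ (a ℕ.≤? count (gridBad? w) (proj₁ found)) (proj₂ found w∈L))
      where
      2^a½^a : fromℕ (2 ℕ.^ a) * ½ ^ℚ a ≡ 1ℚ
      2^a½^a = trans (cong (_* ½ ^ℚ a) (fromℕ-^ 2 a)) (trans (sym (^-distrib-* (fromℕ 2) ½ a)) (1^ a))
      0<½^ : ∀ m → 0ℚ < ½ ^ℚ m
      0<½^ zero    = fromℕ-mono-< {0} {1} (ℕ.n<1+n 0)
      0<½^ (suc m) = *-pos {½} {½ ^ℚ m} (positive⁻¹ ½) (0<½^ m)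
      small : fromℕ (length L) * ½ ^ℚ a < 1ℚ
      small = subst (fromℕ (length L) * ½ ^ℚ a <_) 2^a½^a
        (*-monoˡ-<-pos (½ ^ℚ a) {{positive (0<½^ a)}} (fromℕ-mono-< ∣L∣<2^a))
      bad : Vec ℚ n → Vec (Grid n k (2 ℕ.* s)) (2 ℕ.^ γ ℕ.* a) → ℚ
      bad w T = 𝟙 (a ℕ.≤? count (gridBad? w) T)
      found : ∃[ T ] (∀ {w} → w ∈ L → bad w T < 1ℚ)
      found = union-bound tables {bad} (λ w T → 𝟙-nonNeg (a ℕ.≤? count (gridBad? w) T))
                {½ ^ℚ a} L (λ {w} w∈L → table-tail {w} (light-L w∈L)) small

-- Good tables in terms of natural numbers.

module GoodTables where

  open import Data.Rational.Base hiding (NonZero; nonZero; ∣_∣)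
  open import Data.Rational.Properties hiding (_≟_)
  open Expectations
  open SignedSums
  open RandomTables

  open Expectation

  reciprocal : ∀ q .{{_ : NonZero q}} → ∃[ p ] (0ℚ < p × p ≤ 1ℚ × p * fromℕ q ≡ 1ℚ)
  reciprocal q = 1/ fromℕ q , 0<p , p≤1 , *-inverseˡ (fromℕ q)
    where
    instance
      q-pos : Positive (fromℕ q)
      q-pos = positive (fromℕ-mono-< {0} {q} (ℕ.>-nonZero⁻¹ q))
      q-nonZero = pos⇒nonZero (fromℕ q)
    0<p : 0ℚ < 1/ fromℕ q
    0<p = positive⁻¹ (1/ fromℕ q) {{1/pos⇒pos (fromℕ q)}}
    p≤1 : 1/ fromℕ q ≤ 1ℚ
    p≤1 = subst₂ _≤_ (*-identityʳ (1/ fromℕ q)) (*-inverseˡ (fromℕ q))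
            (*-monoˡ-≤ (1/ fromℕ q) (<⇒≤ 0<p) (fromℕ-mono-≤ {1} {q} (ℕ.>-nonZero⁻¹ q)))

  fromℕ-∸ : ∀ {m n} → m ℕ.≤ n → fromℕ (n ℕ.∸ m) ≡ fromℕ n - fromℕ m
  fromℕ-∸ {m} {n} m≤n = trans (cancel (fromℕ (n ℕ.∸ m)) (fromℕ m))
    (cong (_- fromℕ m) (trans (sym (fromℕ-+ (n ℕ.∸ m) m)) (cong fromℕ (ℕ.m∸n+n≡m m≤n))))
    where
    cancel : ∀ a b → a ≡ a + b - b
    cancel = solve-∀ ℚ-ring

  square-∣-∣ : ∀ m n → square (fromℕ ∣ m - n ∣) ≡ square (fromℕ m - fromℕ n)
  square-∣-∣ m n with ℕ.≤-total m n
  ... | inj₁ m≤n = trans (cong square (trans (cong fromℕ (ℕ.m≤n⇒∣m-n∣≡n∸m m≤n)) (fromℕ-∸ m≤n)))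
                         (flip (fromℕ n) (fromℕ m))
    where
    flip : ∀ a b → (a - b) * (a - b) ≡ (b - a) * (b - a)
    flip = solve-∀ ℚ-ring
  ... | inj₂ n≤m = cong square (trans (cong fromℕ (trans (ℕ.∣-∣-comm m n) (ℕ.m≤n⇒∣m-n∣≡n∸m n≤m))) (fromℕ-∸ n≤m))

  square-cancel-≤ : ∀ {m n} → m ℕ.* m ℕ.≤ n ℕ.* n → m ℕ.≤ n
  square-cancel-≤ m²≤n² = ℕ.≮⇒≥ λ n<m → ℕ.<⇒≱ (ℕ.*-mono-< n<m n<m) m²≤n²

  count-map-≤ : ∀ {A B : Set} {P : Pred A 0ℓ} {Q : Pred B 0ℓ} (P? : Decidable P) (Q? : Decidable Q) (f : B → A) →
                (∀ b → P (f b) → Q b) → ∀ {n} (v : Vec B n) → count P? (Vec.map f v) ℕ.≤ count Q? v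
  count-map-≤ P? Q? f P⇒Q []      = ℕ.z≤n
  count-map-≤ P? Q? f P⇒Q (b ∷ v) with P? (f b) | Q? b
  ... | yes _ | yes _ = ℕ.s≤s (count-map-≤ P? Q? f P⇒Q v)
  ... | yes p | no ¬q = contradiction (P⇒Q b p) ¬q
  ... | no _  | yes _ = ℕ.m≤n⇒m≤1+n (count-map-≤ P? Q? f P⇒Q v)
  ... | no _  | no _  = count-map-≤ P? Q? f P⇒Q v

  count-mono-≤ : ∀ {A : Set} {P Q : Pred A 0ℓ} (P? : Decidable P) (Q? : Decidable Q) →
                 (∀ x → P x → Q x) → ∀ {n} (v : Vec A n) → count P? v ℕ.≤ count Q? v
  count-mono-≤ P? Q? P⇒Q v = subst (λ u → count P? u ℕ.≤ count Q? v) (Vec.map-id v) (count-map-≤ P? Q? id P⇒Q v)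

  vectors : ℕ → ∀ n → List (Vec ℕ n)
  vectors b zero    = [] ∷ []
  vectors b (suc n) = cartesianProductWith _∷_ (upTo b) (vectors b n)

  length-cartesianProductWith : ∀ {A B C : Set} (f : A → B → C) xs ys →
    length (cartesianProductWith f xs ys) ≡ length xs ℕ.* length ys
  length-cartesianProductWith f []       ys = refl
  length-cartesianProductWith f (x ∷ xs) ys = trans (List.length-++ (List.map (f x) ys))
    (cong₂ ℕ._+_ (List.length-map (f x) ys) (length-cartesianProductWith f xs ys))

  length-vectors : ∀ b n → length (vectors b n) ≡ b ℕ.^ n
  length-vectors b zero    = refl
  length-vectors b (suc n) = trans (length-cartesianProductWith _∷_ (upTo b) (vectors b n))
    (cong₂ ℕ._*_ (List.length-upTo b) (length-vectors b n))

  ∈-vectors : ∀ {b n} (v : Vec ℕ n) → (∀ i → lookup v i ℕ.< b) → v ∈ vectors b n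
  ∈-vectors []      v<b = here refl
  ∈-vectors (x ∷ v) v<b =
    ∈-cartesianProductWith⁺ _∷_ (∈-upTo⁺ (v<b zero)) (∈-vectors v (v<b ∘ suc))

  powerSum : ℕ → ∀ {n} → Vec ℕ n → ℕ
  powerSum d v = Vec.sum (Vec.map (ℕ._^ d) v)

  fromℕ-powerSum : ∀ d (f : ℚ → ℚ) → (∀ x → fromℕ (x ℕ.^ d) ≡ f (fromℕ x)) →
                   ∀ {n} (v : Vec ℕ n) → ∑ f (Vec.map fromℕ v) ≡ fromℕ (powerSum d v)
  fromℕ-powerSum d f f≗^ []      = refl
  fromℕ-powerSum d f f≗^ (x ∷ v) = trans (cong₂ _+_ (sym (f≗^ x)) (fromℕ-powerSum d f f≗^ v))
    (sym (fromℕ-+ (x ℕ.^ d) (powerSum d v)))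

  ∑-square : ∀ {n} (v : Vec ℕ n) → ∑ square (Vec.map fromℕ v) ≡ fromℕ (powerSum 2 v)
  ∑-square = fromℕ-powerSum 2 square λ x → trans (fromℕ-^ x 2) (expand (fromℕ x))
    where
    expand : ∀ x → x * (x * 1ℚ) ≡ x * x
    expand = solve-∀ ℚ-ring

  ∑-fourth : ∀ {n} (v : Vec ℕ n) → ∑ fourth (Vec.map fromℕ v) ≡ fromℕ (powerSum 4 v)
  ∑-fourth = fromℕ-powerSum 4 fourth λ x → trans (fromℕ-^ x 4) (expand (fromℕ x))
    where
    expand : ∀ x → x * (x * (x * (x * 1ℚ))) ≡ x * x * (x * x)
    expand = solve-∀ ℚ-ring

  -- The sign is split into two natural weights, so that a signed sum becomes a difference of two
  -- sums in ℕ and can be counted modulo M.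
  positivePart negativePart : Ternary → ℕ
  positivePart plus  = 1
  positivePart minus = 0
  positivePart none  = 0
  negativePart plus  = 0
  negativePart minus = 1
  negativePart none  = 0

  weigh : ∀ {n} → (Ternary → ℕ) → Vec ℕ n → Vec Ternary n → ℕ
  weigh g []      []      = 0
  weigh g (x ∷ v) (s ∷ σ) = x ℕ.* g s ℕ.+ weigh g v σ

  amplitude : ∀ {n} → Vec ℕ n → Vec Ternary n → ℕ
  amplitude v σ = ∣ weigh positivePart v σ - weigh negativePart v σ ∣

  energy : ∀ {n k} → Vec ℕ n → Vec (Vec Ternary n) k → ℕ
  energy v σs = Vec.sum (Vec.map (λ σ → amplitude v σ ℕ.^ 2) σs)

  dot-fromℕ : ∀ {n} (v : Vec ℕ n) σ →
              dot (Vec.map fromℕ v) σ ≡ fromℕ (weigh positivePart v σ) - fromℕ (weigh negativePart v σ)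
  dot-fromℕ []      []      = refl
  dot-fromℕ (x ∷ v) (s ∷ σ) = begin
    value s * fromℕ x + dot (Vec.map fromℕ v) σ
      ≡⟨ cong₂ (λ c d → c * fromℕ x + d) (value≡ s) (dot-fromℕ v σ) ⟩
    (fromℕ (positivePart s) - fromℕ (negativePart s)) * fromℕ x + (fromℕ P - fromℕ N)
      ≡⟨ rearrange (fromℕ (positivePart s)) (fromℕ (negativePart s)) (fromℕ x) (fromℕ P) (fromℕ N) ⟩
    (fromℕ x * fromℕ (positivePart s) + fromℕ P) - (fromℕ x * fromℕ (negativePart s) + fromℕ N)
      ≡⟨ cong₂ _-_ (merge (positivePart s) P) (merge (negativePart s) N) ⟩
    fromℕ (x ℕ.* positivePart s ℕ.+ P) - fromℕ (x ℕ.* negativePart s ℕ.+ N) ∎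
    where
    open ≡-Reasoning
    P = weigh positivePart v σ
    N = weigh negativePart v σ
    value≡ : ∀ s → value s ≡ fromℕ (positivePart s) - fromℕ (negativePart s)
    value≡ plus  = refl
    value≡ minus = refl
    value≡ none  = refl
    rearrange : ∀ a b x P N → (a - b) * x + (P - N) ≡ (x * a + P) - (x * b + N)
    rearrange = solve-∀ ℚ-ring
    merge : ∀ c m → fromℕ x * fromℕ c + fromℕ m ≡ fromℕ (x ℕ.* c ℕ.+ m)
    merge c m = trans (cong (_+ fromℕ m) (sym (fromℕ-* x c))) (sym (fromℕ-+ (x ℕ.* c) m))

  -- The estimate q Y / k of F = `powerSum 2 v`, with Y the energy, is off by more than F / e;
  -- denominators are cleared.
  Far : ℕ → ℕ → ∀ {n k} → Vec ℕ n → Pred (Vec (Vec Ternary n) k) 0ℓ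
  Far e q {k = k} v σs = k ℕ.* powerSum 2 v ℕ.< e ℕ.* ∣ q ℕ.* energy v σs - k ℕ.* powerSum 2 v ∣

  far? : ∀ e q {n k} (v : Vec ℕ n) → Decidable (Far e q {n} {k} v)
  far? e q v σs = _ ℕ.<? _

  module _ {p} (0≤p : 0ℚ ≤ p) (p≤1 : p ≤ 1ℚ) {q} (pq≡1 : p * fromℕ q ≡ 1ℚ) where

    open Moments 0≤p p≤1

    ∑-deviation : ∀ {n k} (v : Vec ℕ n) (σs : Vec (Vec Ternary n) k) →
      ∑ (deviation (Vec.map fromℕ v)) σs ≡ fromℕ (energy v σs) - fromℕ k * (p * ∑ square (Vec.map fromℕ v))
    ∑-deviation v [] = sym (vanish (p * ∑ square (Vec.map fromℕ v)))
      where
      vanish : ∀ G → 0ℚ - 0ℚ * G ≡ 0ℚ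
      vanish = solve-∀ ℚ-ring
    ∑-deviation {k = suc k} v (σ ∷ σs) = begin
      (square (dot (Vec.map fromℕ v) σ) - G) + ∑ (deviation (Vec.map fromℕ v)) σs
        ≡⟨ cong₂ (λ x y → (x - G) + y) amplitude² (∑-deviation v σs) ⟩
      (fromℕ A² - G) + (fromℕ (energy v σs) - fromℕ k * G)
        ≡⟨ rearrange (fromℕ A²) G (fromℕ (energy v σs)) (fromℕ k) ⟩
      (fromℕ A² + fromℕ (energy v σs)) - (1ℚ + fromℕ k) * G
        ≡⟨ cong₂ (λ x y → x - y * G) (sym (fromℕ-+ A² (energy v σs))) (sym (fromℕ-suc k)) ⟩
      fromℕ (A² ℕ.+ energy v σs) - fromℕ (suc k) * G ∎
      where
      open ≡-Reasoning
      G  = p * ∑ square (Vec.map fromℕ v)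
      A² = amplitude v σ ℕ.^ 2
      rearrange : ∀ a G e k → (a - G) + (e - k * G) ≡ (a + e) - (1ℚ + k) * G
      rearrange = solve-∀ ℚ-ring
      amplitude² : square (dot (Vec.map fromℕ v) σ) ≡ fromℕ A²
      amplitude² = trans (cong square (dot-fromℕ v σ))
        (trans (sym (square-∣-∣ (weigh positivePart v σ) (weigh negativePart v σ)))
          (trans (sym (fromℕ-* (amplitude v σ) (amplitude v σ)))
            (cong (λ z → fromℕ (amplitude v σ ℕ.* z)) (sym (ℕ.*-identityʳ (amplitude v σ))))))

    -- Here G = F / q, so multiplication by q turns the deviation Y - k G into q Y - k F. By
    -- contraposition the squared inequality is given, and its root can be taken in ℕ.
    far⇒groupBad : ∀ {n k} e (v : Vec ℕ n) (σs : Vec (Vec Ternary n) k) →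
                   Far e q v σs → GroupBad (Vec.map fromℕ v) e σs
    far⇒groupBad {n} {k} e v σs far = ≰⇒> λ notBad → ℕ.<⇒≱ far (square-cancel-≤ (fromℕ-cancel-≤ (begin
      fromℕ (e ℕ.* D ℕ.* (e ℕ.* D))
        ≡⟨ trans (cong fromℕ (ℕ.[m*n]*[o*p]≡[m*o]*[n*p] e D e D)) (trans (fromℕ-* (e ℕ.* e) (D ℕ.* D)) (cong (fromℕ (e ℕ.* e) *_) (trans (fromℕ-* D D) (square-∣-∣ (q ℕ.* Y) (k ℕ.* F))))) ⟩
      fromℕ (e ℕ.* e) * square (fromℕ (q ℕ.* Y) - fromℕ (k ℕ.* F))
        ≡⟨ cong (λ z → fromℕ (e ℕ.* e) * square z) (trans (cong₂ _-_ (fromℕ-* q Y) kF≡) (factor (fromℕ q) (fromℕ Y) (fromℕ k * G))) ⟩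
      fromℕ (e ℕ.* e) * square (fromℕ q * S′)
        ≡⟨ pull (fromℕ (e ℕ.* e)) (fromℕ q) S′ ⟩
      square (fromℕ q) * (fromℕ (e ℕ.* e) * square S′)
        ≡⟨ cong (λ z → square (fromℕ q) * (fromℕ (e ℕ.* e) * square z)) (sym (∑-deviation v σs)) ⟩
      square (fromℕ q) * (fromℕ (e ℕ.* e) * square S)
        ≤⟨ *-monoˡ-≤ (square (fromℕ q)) (square-nonNeg (fromℕ q)) notBad ⟩
      square (fromℕ q) * square (fromℕ k * G)
        ≡⟨ push (fromℕ q) (fromℕ k * G) ⟩
      square (fromℕ q * (fromℕ k * G))
        ≡⟨ cong square (sym kF≡) ⟩
      square (fromℕ (k ℕ.* F))
        ≡⟨ sym (fromℕ-* (k ℕ.* F) (k ℕ.* F)) ⟩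
      fromℕ (k ℕ.* F ℕ.* (k ℕ.* F)) ∎)))
      where
      open ≤-Reasoning
      F  = powerSum 2 v
      Y  = energy v σs
      D  = ∣ q ℕ.* Y - k ℕ.* F ∣
      G  = p * ∑ square (Vec.map fromℕ v)
      S  = ∑ (deviation (Vec.map fromℕ v)) σs
      S′ = fromℕ Y - fromℕ k * G
      reassociate : ∀ q k p F → q * (k * (p * F)) ≡ k * (p * q * F)
      reassociate = solve-∀ ℚ-ring
      kF≡ : fromℕ (k ℕ.* F) ≡ fromℕ q * (fromℕ k * G)
      kF≡ = trans (fromℕ-* k F) (sym (trans (cong (λ z → fromℕ q * (fromℕ k * (p * z))) (∑-square v))
        (trans (reassociate (fromℕ q) (fromℕ k) p (fromℕ F))
          (cong (fromℕ k *_) (trans (cong (_* fromℕ F) pq≡1) (*-identityˡ (fromℕ F)))))))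
      factor : ∀ q y g → q * y - q * g ≡ q * (y - g)
      factor = solve-∀ ℚ-ring
      pull : ∀ e q s → e * (q * s * (q * s)) ≡ q * q * (e * (s * s))
      pull = solve-∀ ℚ-ring
      push : ∀ q s → q * q * (s * s) ≡ q * s * (q * s)
      push = solve-∀ ℚ-ring

  GridFar : ℕ → ℕ → ℕ → ∀ {n k r} → Vec ℕ n → Pred (Grid n k r) 0ℓ
  GridFar s e q v g = s ℕ.≤ count (far? e q v) g

  gridFar? : ∀ s e q {n k r} (v : Vec ℕ n) → Decidable (GridFar s e q {n} {k} {r} v)
  gridFar? s e q v g = s ℕ.≤? count (far? e q v) g

  -- The sampling probability is 1/q, and q F₄ ≤ F₂² is the condition p F₄ ≤ (p F₂)² of the variance
  -- bound. The list for the union bound is filtered by it; its length stays below the number b^n of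
  -- all vectors with entries below b.
  good-table-ℕ : ∀ {n} b q e k γ a .{{_ : NonZero q}} .{{_ : NonZero k}} →
    48 ℕ.* (e ℕ.* e) ℕ.≤ k → b ℕ.^ n ℕ.< 2 ℕ.^ a →
    ∃[ T ] (∀ (v : Vec ℕ n) → (∀ i → lookup v i ℕ.< b) → 0 ℕ.< powerSum 2 v →
            q ℕ.* powerSum 4 v ℕ.≤ powerSum 2 v ℕ.* powerSum 2 v →
            count {n = 2 ℕ.^ γ ℕ.* a} (gridFar? (γ ℕ.+ 2) e q {n} {k} {2 ℕ.* (γ ℕ.+ 2)} v) T ℕ.< a)
  good-table-ℕ {n} b q e k γ a 48e²≤k b^n<2^a = proj₁ table , λ v v<b 0<F qF₄≤F² →
    ℕ.≤-<-trans
      (count-mono-≤ (gridFar? (γ ℕ.+ 2) e q v) (gridBad? (Vec.map fromℕ v))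
        (λ g s≤ → ℕ.≤-trans s≤ (count-mono-≤ (far? e q v) (groupBad? (Vec.map fromℕ v) e)
          (far⇒groupBad 0≤p p≤1 {q} pq≡1 e v) g))
        (proj₁ table))
      (proj₂ table (∈-map⁺ (Vec.map fromℕ) (∈-filter⁺ admissible? (∈-vectors v v<b) (0<F , qF₄≤F²))))
    where
    p = proj₁ (reciprocal q)
    0<p : 0ℚ < p
    0<p = proj₁ (proj₂ (reciprocal q))
    0≤p = <⇒≤ 0<p
    p≤1 : p ≤ 1ℚ
    p≤1 = proj₁ (proj₂ (proj₂ (reciprocal q)))
    pq≡1 : p * fromℕ q ≡ 1ℚ
    pq≡1 = proj₂ (proj₂ (proj₂ (reciprocal q)))
    open Amplification 0≤p p≤1 {n} e k γ a 48e²≤k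
    open Moments 0≤p p≤1 using (groupBad?)
    Admissible : Pred (Vec ℕ n) 0ℓ
    Admissible v = 0 ℕ.< powerSum 2 v × q ℕ.* powerSum 4 v ℕ.≤ powerSum 2 v ℕ.* powerSum 2 v
    admissible? : Decidable Admissible
    admissible? v = (0 ℕ.<? powerSum 2 v) ×-dec (q ℕ.* powerSum 4 v ℕ.≤? powerSum 2 v ℕ.* powerSum 2 v)
    admissible⇒light : ∀ {v} → Admissible v → Light (Vec.map fromℕ v)
    admissible⇒light {v} (0<F , qF₄≤F²) = light
      (*-pos {p} {∑ square (Vec.map fromℕ v)} 0<p (subst (0ℚ <_) (sym (∑-square v)) (fromℕ-mono-< 0<F)))
      (subst₂ (λ f g → p * g ≤ square (p * f)) (sym (∑-square v)) (sym (∑-fourth v)) (begin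
        p * F₄                       ≡⟨ sym (trans (cong (λ z → p * (z * F₄)) pq≡1) (cong (p *_) (*-identityˡ F₄))) ⟩
        p * (p * fromℕ q * F₄)       ≡⟨ regroup p (fromℕ q) F₄ ⟩
        p * p * (fromℕ q * F₄)       ≤⟨ *-monoˡ-≤ (p * p) (square-nonNeg p)
                                         (subst₂ _≤_ (fromℕ-* q (powerSum 4 v)) (fromℕ-* (powerSum 2 v) (powerSum 2 v)) (fromℕ-mono-≤ qF₄≤F²)) ⟩
        p * p * (F₂ * F₂)            ≡⟨ regroup′ p F₂ ⟩
        square (p * F₂)              ∎))
      where
      open ≤-Reasoning
      F₂ = fromℕ (powerSum 2 v)
      F₄ = fromℕ (powerSum 4 v)
      regroup : ∀ p q f → p * (p * q * f) ≡ p * p * (q * f)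
      regroup = solve-∀ ℚ-ring
      regroup′ : ∀ p f → p * p * (f * f) ≡ p * f * (p * f)
      regroup′ = solve-∀ ℚ-ring
    L : List (Vec ℚ n)
    L = List.map (Vec.map fromℕ) (filter admissible? (vectors b n))
    light-L : ∀ {w} → w ∈ L → Light w
    light-L w∈L = let v , v∈ , w≡ = ∈-map⁻ (Vec.map fromℕ) w∈L in
      subst Light (sym w≡) (admissible⇒light (proj₂ (∈-filter⁻ admissible? {xs = vectors b n} v∈)))
    ∣L∣<2^a : length L ℕ.< 2 ℕ.^ a
    ∣L∣<2^a = ℕ.≤-<-trans (ℕ.≤-trans (ℕ.≤-reflexive (List.length-map (Vec.map fromℕ) (filter admissible? (vectors b n))))
      (ℕ.≤-trans (List.length-filter admissible? (vectors b n)) (ℕ.≤-reflexive (length-vectors b n)))) b^n<2^a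
    table : ∃[ T ] (∀ {w} → w ∈ L → count {n = 2 ℕ.^ γ ℕ.* a} (gridBad? w) T ℕ.< a)
    table = good-table L light-L ∣L∣<2^a

-- Bit encodings and the success probability of seeded machines.

module Machines where

  open import Data.Nat.Base using (_+_; _*_; _^_; _≤_)
  open import Data.Vec.Base using (_++_; take; drop)
  open Expectations using (fromℕ-*; fromℕ-mono-<; fromℕ-mono-≤; ℚ-ring)

  -- A retraction of bit vectors onto `A`; on bit vectors that encode nothing, `decode` is free.
  record Coded (A : Set) (s : ℕ) : Set where
    field
      encode        : A → Vec Bool s
      decode        : Vec Bool s → A
      decode-encode : ∀ a → decode (encode a) ≡ a

  open Coded

  coded-× : ∀ {A B s t} → Coded A s → Coded B t → Coded (A × B) (s + t)
  coded-× {s = s} A B = record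
    { encode        = λ (a , b) → encode A a ++ encode B b
    ; decode        = λ v → decode A (take s v) , decode B (drop s v)
    ; decode-encode = λ (a , b) → cong₂ _,_
        (trans (cong (decode A) (Vec.++-injectiveˡ _ _ (Vec.take++drop≡id s (encode A a ++ encode B b)))) (decode-encode A a))
        (trans (cong (decode B) (Vec.++-injectiveʳ (take s (encode A a ++ encode B b)) _ (Vec.take++drop≡id s (encode A a ++ encode B b)))) (decode-encode B b))
    }

  coded-retract : ∀ {A B s} (f : A → B) (g : B → A) → (∀ a → g (f a) ≡ a) → Coded B s → Coded A s
  coded-retract f g gf≗id B = record
    { encode        = encode B ∘ f
    ; decode        = g ∘ decode B
    ; decode-encode = λ a → trans (cong g (decode-encode B (f a))) (gf≗id a)
    }

  coded-Fin-* : ∀ {m n s t} → Coded (Fin m) s → Coded (Fin n) t → Coded (Fin (m * n)) (s + t)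
  coded-Fin-* {m} {n} M N = coded-retract (remQuot {m} n) (uncurry combine) (combine-remQuot {m} n) (coded-× M N)

  coded-Fin : ∀ k → Coded (Fin (2 ^ k)) k
  coded-Fin zero    = record { encode = λ _ → [] ; decode = λ _ → zero ; decode-encode = λ { zero → refl } }
  coded-Fin (suc k) = coded-Fin-* bit (coded-Fin k)
    where
    bit : Coded (Fin 2) 1
    bit = record
      { encode        = λ { zero → false ∷ [] ; (suc zero) → true ∷ [] }
      ; decode        = λ { (false ∷ []) → zero ; (true ∷ []) → suc zero }
      ; decode-encode = λ { zero → refl ; (suc zero) → refl }
      }

  coded-Vec : ∀ {A s} → Coded A s → ∀ k → Coded (Vec A k) (k * s)
  coded-Vec A zero    = record { encode = λ _ → [] ; decode = λ _ → [] ; decode-encode = λ { [] → refl } }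
  coded-Vec A (suc k) = coded-retract (λ { (a ∷ v) → a , v }) (λ (a , v) → a ∷ v) (λ { (a ∷ v) → refl })
                          (coded-× A (coded-Vec A k))

  open CommutativeMonoidSum ℕ.+-0-commutativeMonoid using (sum; sum-cong-≗; ∑-distrib-+; ∑-comm)
  open SemiringSum ℕ.+-*-semiring using (*-distribˡ-sum)

  ∑ᶠ : ∀ n → (Fin n → ℕ) → ℕ
  ∑ᶠ n = sum

  ∑ᶠ-cong : ∀ n {f g} → (∀ i → f i ≡ g i) → ∑ᶠ n f ≡ ∑ᶠ n g
  ∑ᶠ-cong n f≗g = sum-cong-≗ f≗g

  ∑ᶠ-mono-≤ : ∀ n {f g} → (∀ i → f i ≤ g i) → ∑ᶠ n f ≤ ∑ᶠ n g
  ∑ᶠ-mono-≤ zero    f≤g = z≤n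
  ∑ᶠ-mono-≤ (suc n) f≤g = ℕ.+-mono-≤ (f≤g zero) (∑ᶠ-mono-≤ n (f≤g ∘ suc))

  ∑ᶠ-const : ∀ n c → ∑ᶠ n (λ _ → c) ≡ n * c
  ∑ᶠ-const zero    c = refl
  ∑ᶠ-const (suc n) c = cong (c +_) (∑ᶠ-const n c)

  ∑ᶠ-*ˡ : ∀ n c f → ∑ᶠ n (λ i → c * f i) ≡ c * ∑ᶠ n f
  ∑ᶠ-*ˡ n c f = sym (*-distribˡ-sum c f)

  ∑ᶠ-+ : ∀ n f g → ∑ᶠ n (λ i → f i + g i) ≡ ∑ᶠ n f + ∑ᶠ n g
  ∑ᶠ-+ n = ∑-distrib-+

  ∑ᶠ-swap : ∀ m n (f : Fin m → Fin n → ℕ) → ∑ᶠ m (λ i → ∑ᶠ n (f i)) ≡ ∑ᶠ n (λ j → ∑ᶠ m (λ i → f i j))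
  ∑ᶠ-swap m n = ∑-comm

  ∑ᶠ-↑ : ∀ m n (f : Fin (m + n) → ℕ) → ∑ᶠ (m + n) f ≡ ∑ᶠ m (λ i → f (i ↑ˡ n)) + ∑ᶠ n (λ j → f (m ↑ʳ j))
  ∑ᶠ-↑ zero    n f = refl
  ∑ᶠ-↑ (suc m) n f = trans (cong (f zero +_) (∑ᶠ-↑ m n (f ∘ suc))) (sym (ℕ.+-assoc (f zero) _ _))

  ∑ᶠ-combine : ∀ m n (f : Fin (m * n) → ℕ) → ∑ᶠ (m * n) f ≡ ∑ᶠ m (λ i → ∑ᶠ n (λ j → f (combine i j)))
  ∑ᶠ-combine zero    n f = refl
  ∑ᶠ-combine (suc m) n f = trans (∑ᶠ-↑ n (m * n) f)
    (cong (∑ᶠ n (λ j → f (j ↑ˡ (m * n))) +_) (∑ᶠ-combine m n (λ i → f (n ↑ʳ i))))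

  term≤∑ᶠ : ∀ {n} (f : Fin n → ℕ) i → f i ≤ ∑ᶠ n f
  term≤∑ᶠ f zero    = ℕ.m≤m+n (f zero) _
  term≤∑ᶠ f (suc i) = ℕ.m≤n⇒m≤o+n (f zero) (term≤∑ᶠ (f ∘ suc) i)

  ⟦_⟧ : ∀ {P : Set} → Dec P → ℕ
  ⟦ d ⟧ = if does d then 1 else 0

  ⟦yes⟧ : ∀ {P : Set} (d : Dec P) → P → 1 ≤ ⟦ d ⟧
  ⟦yes⟧ (yes _) p = s≤s z≤n
  ⟦yes⟧ (no ¬p) p = contradiction p ¬p

  count-tabulate : ∀ {A : Set} {P : Pred A 0ℓ} (P? : Decidable P) {n} (f : Fin n → A) →
                   count P? (tabulate f) ≡ ∑ᶠ n (λ i → ⟦ P? (f i) ⟧)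
  count-tabulate P? {zero}  f = refl
  count-tabulate P? {suc n} f with does (P? (f zero))
  ... | true  = cong suc (count-tabulate P? (f ∘ suc))
  ... | false = count-tabulate P? (f ∘ suc)

  fromℕ-*-/ : ∀ c N .{{_ : NonZero N}} → fromℕ N ℚ.* (ℤ.+ c ℚ./ N) ≡ fromℕ c
  fromℕ-*-/ c N@(suc N-1) = ℚ.toℚᵘ-injective (begin
    ℚ.toℚᵘ (fromℕ N ℚ.* (ℤ.+ c ℚ./ N))             ≈⟨ ℚ.toℚᵘ-homo-* (fromℕ N) (ℤ.+ c ℚ./ N) ⟩
    ℚ.toℚᵘ (fromℕ N) ℚᵘ.* ℚ.toℚᵘ (ℤ.+ c ℚ./ N)     ≈⟨ ℚᵘ.*-cong (ℚ.toℚᵘ-fromℚᵘ (ℚᵘ.mkℚᵘ (ℤ.+ N) 0)) (ℚ.toℚᵘ-fromℚᵘ (ℚᵘ.mkℚᵘ (ℤ.+ c) N-1)) ⟩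
    ℚᵘ.mkℚᵘ (ℤ.+ N) 0 ℚᵘ.* ℚᵘ.mkℚᵘ (ℤ.+ c) N-1     ≈⟨ ℚᵘ.*≡* (trans (ℤ.*-identityʳ (ℤ.+ N ℤ.* ℤ.+ c))
                                                       (trans (ℤ.*-comm (ℤ.+ N) (ℤ.+ c)) (cong (λ z → ℤ.+ c ℤ.* (ℤ.+ suc z)) (sym (ℕ.+-identityʳ N-1))))) ⟩
    ℚᵘ.mkℚᵘ (ℤ.+ c) 0                              ≈⟨ ℚᵘ.≃-sym (ℚ.toℚᵘ-fromℚᵘ (ℚᵘ.mkℚᵘ (ℤ.+ c) 0)) ⟩
    ℚ.toℚᵘ (fromℕ c)                               ∎)
    where open ℚᵘ.≃-Reasoning

  */-≥ : ∀ {b D X c} .{{_ : NonZero D}} .{{_ : NonZero X}} .{{_ : NonZero (D * (D * X))}} → X * (D * b) ≤ c →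
         fromℕ b ℚ.≤ fromℕ D ℚ.* (ℤ.+ c ℚ./ (D * (D * X)))
  */-≥ {b} {D} {X} {c} XDb≤c = ℚ.*-cancelʳ-≤-pos (fromℕ (D * X))
    {{ℚ.positive (fromℕ-mono-< {0} {D * X} (ℕ.>-nonZero⁻¹ (D * X) {{ℕ.m*n≢0 D X}}))}} (begin
    fromℕ b ℚ.* fromℕ (D * X)                 ≡⟨ sym (fromℕ-* b (D * X)) ⟩
    fromℕ (b * (D * X))                       ≤⟨ fromℕ-mono-≤ (ℕ.≤-trans (ℕ.≤-reflexive (rotate b D X)) XDb≤c) ⟩
    fromℕ c                                   ≡⟨ sym (fromℕ-*-/ c (D * (D * X))) ⟩
    fromℕ (D * (D * X)) ℚ.* x                 ≡⟨ cong (ℚ._* x) (fromℕ-* D (D * X)) ⟩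
    fromℕ D ℚ.* fromℕ (D * X) ℚ.* x           ≡⟨ swap (fromℕ D) (fromℕ (D * X)) x ⟩
    fromℕ D ℚ.* x ℚ.* fromℕ (D * X)           ∎)
    where
    open ℚ.≤-Reasoning
    x = ℤ.+ c ℚ./ (D * (D * X))
    rotate : ∀ b D X → b * (D * X) ≡ X * (D * b)
    rotate = solve-ℕ
    swap : ∀ a b c → a ℚ.* b ℚ.* c ≡ a ℚ.* c ℚ.* b
    swap = solve-∀ ℚ-ring

  foldl-stream : ∀ {S : Set} {n m} → (Fin n → S → S) → S → Stream n m → S
  foldl-stream f st []       = st
  foldl-stream f st (x ∷ xs) = foldl-stream f (f x st) xs

  -- A streaming algorithm whose only random choices are a seed, drawn at the
  -- start, and a guess, drawn at the end.
  record Machine (n : ℕ) : Set₁ where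
    field
      State       : Set
      space       : ℕ
      coded       : Coded State space
      seeds       : ℕ
      guesses     : ℕ
      {{seeds≢0}}   : NonZero seeds
      {{guesses≢0}} : NonZero guesses
      start       : Fin seeds → State
      step        : Fin n → State → State
      answer      : Fin guesses → State → ℚ

    algorithm : StreamingAlgorithm n
    algorithm = record
      { space         = space
      ; draws         = seeds * guesses
      ; draws-nonZero = ℕ.m*n≢0 seeds guesses
      ; initial       = λ ω → encode coded (start (quotient guesses ω))
      ; update        = λ _ x mem → encode coded (step x (decode coded mem))
      ; output        = λ ω mem → answer (remainder {seeds} guesses ω) (decode coded mem)
      }

    open StreamingAlgorithm algorithm using (process; run; draws)

    process-encode : ∀ {m} st (xs : Stream n m) ω → process (encode coded st) xs ω ≡ encode coded (foldl-stream step st xs)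
    process-encode st []       ω = refl
    process-encode st (x ∷ xs) ω = trans
      (cong (λ z → process (encode coded (step x z)) xs (ω ∘ suc)) (decode-encode coded st))
      (process-encode (step x st) xs (ω ∘ suc))

    module _ {m} (xs : Stream n m) where

      final : Fin seeds → State
      final s = foldl-stream step (start s) xs

      -- Every draw is a pair of a seed and a guess. Draw 0 is (s′, j) and lends its guess to the
      -- output, draw 1 is (s, j′) and lends its seed to the initial state, and ρ holds the draws of
      -- the updates.
      run-combine : ∀ s s′ j j′ ρ →
        run xs (finToFun {draws} {2 + m} (combine (combine s′ j) (combine (combine s j′) ρ))) ≡ answer j (final s)
      run-combine s s′ j j′ ρ = begin
        run xs ω
          ≡⟨ cong₂ (λ x y → answer (remainder {seeds} guesses x) (decode coded (process (encode coded (start (quotient guesses y))) xs ω₂))) ω₀ ω₁ ⟩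
        answer (remainder {seeds} guesses (combine s′ j)) (decode coded (process (encode coded (start (quotient guesses (combine s j′)))) xs ω₂))
          ≡⟨ cong₂ (λ x y → answer x (decode coded (process (encode coded (start y)) xs ω₂)))
               (cong proj₂ (remQuot-combine s′ j)) (cong proj₁ (remQuot-combine s j′)) ⟩
        answer j (decode coded (process (encode coded (start s)) xs ω₂))
          ≡⟨ cong (answer j ∘ decode coded) (process-encode (start s) xs ω₂) ⟩
        answer j (decode coded (encode coded (final s)))
          ≡⟨ cong (answer j) (decode-encode coded (final s)) ⟩
        answer j (final s) ∎
        where
        open ≡-Reasoning
        ω : Fin (2 + m) → Fin draws
        ω = finToFun (combine (combine s′ j) (combine (combine s j′) ρ))
        ω₂ : Fin m → Fin draws
        ω₂ i = ω (suc (suc i))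
        ω₀ : ω zero ≡ combine s′ j
        ω₀ = cong proj₁ (remQuot-combine (combine s′ j) (combine (combine s j′) ρ))
        ω₁ : ω (suc zero) ≡ combine s j′
        ω₁ = trans (cong (quotient (draws ^ m)) (cong proj₂ (remQuot-combine (combine s′ j) (combine (combine s j′) ρ))))
                   (cong proj₁ (remQuot-combine (combine s j′) ρ))

      module _ {P : Pred ℚ 0ℓ} (P? : Decidable P) {Q : Pred (Fin seeds) 0ℓ} (Q? : Decidable Q)
               (lucky : ∀ s → Q s → ∃[ j ] P (answer j (final s))) where

        private
          R : Fin (draws ^ (2 + m)) → ℕ
          R i = ⟦ P? (run xs (finToFun i)) ⟧

        -- A good seed s has a lucky guess j, and together they succeed for all s′, j′ and ρ. The
        -- pairs (s′, j′) give the factor `draws`, the ρ give `draws ^ m`.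
        count-lucky : draws ^ m * (draws * ∑ᶠ seeds (λ s → ⟦ Q? s ⟧)) ≤ count (λ i → P? (run xs (finToFun i))) (allFin (draws ^ (2 + m)))
        count-lucky = begin
          draws ^ m * (draws * ∑ᶠ seeds (λ s → ⟦ Q? s ⟧))
            ≡⟨ trans (ℕ.*-comm (draws ^ m) _) (trans (ℕ.*-assoc draws _ (draws ^ m)) (trans (cong (draws *_) (ℕ.*-comm (∑ᶠ seeds _) (draws ^ m)))
                 (trans (cong (draws *_) (sym (∑ᶠ-*ˡ seeds (draws ^ m) _))) (trans (ℕ.*-assoc seeds guesses _) (sym (trans (∑ᶠ-const seeds _) (cong (seeds *_) (trans (∑ᶠ-swap seeds guesses _) (∑ᶠ-const guesses _))))))))) ⟩
          ∑ᶠ seeds (λ s′ → ∑ᶠ seeds λ s → ∑ᶠ guesses λ j′ → draws ^ m * ⟦ Q? s ⟧)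
            ≤⟨ ∑ᶠ-mono-≤ seeds (λ s′ → ∑ᶠ-mono-≤ seeds λ s → ∑ᶠ-mono-≤ guesses λ j′ → guess s′ s j′) ⟩
          ∑ᶠ seeds (λ s′ → ∑ᶠ seeds λ s → ∑ᶠ guesses λ j′ → ∑ᶠ guesses λ j → ∑ᶠ (draws ^ m) λ ρ → R (combine (combine s′ j) (combine (combine s j′) ρ)))
            ≡⟨ ∑ᶠ-cong seeds (λ s′ → trans (∑ᶠ-cong seeds λ s → ∑ᶠ-swap guesses guesses _) (∑ᶠ-swap seeds guesses _)) ⟩
          ∑ᶠ seeds (λ s′ → ∑ᶠ guesses λ j → ∑ᶠ seeds λ s → ∑ᶠ guesses λ j′ → ∑ᶠ (draws ^ m) λ ρ → R (combine (combine s′ j) (combine (combine s j′) ρ)))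
            ≡⟨ ∑ᶠ-cong seeds (λ s′ → ∑ᶠ-cong guesses λ j → trans (sym (∑ᶠ-combine seeds guesses _)) (sym (∑ᶠ-combine draws (draws ^ m) _))) ⟩
          ∑ᶠ seeds (λ s′ → ∑ᶠ guesses λ j → ∑ᶠ (draws ^ suc m) λ τ → R (combine (combine s′ j) τ))
            ≡⟨ trans (sym (∑ᶠ-combine seeds guesses _)) (sym (∑ᶠ-combine draws (draws ^ suc m) R)) ⟩
          ∑ᶠ (draws ^ (2 + m)) R
            ≡⟨ sym (count-tabulate (λ i → P? (run xs (finToFun i))) id) ⟩
          count (λ i → P? (run xs (finToFun i))) (allFin (draws ^ (2 + m))) ∎
          where
          open ℕ.≤-Reasoning
          guess : ∀ s′ s j′ → draws ^ m * ⟦ Q? s ⟧ ≤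
            ∑ᶠ guesses λ j → ∑ᶠ (draws ^ m) λ ρ → R (combine (combine s′ j) (combine (combine s j′) ρ))
          guess s′ s j′ with Q? s
          ... | no  _ = ℕ.≤-trans (ℕ.≤-reflexive (ℕ.*-zeroʳ (draws ^ m))) z≤n
          ... | yes q = ℕ.≤-trans (ℕ.≤-trans (ℕ.≤-reflexive (sym (∑ᶠ-const (draws ^ m) 1)))
              (∑ᶠ-mono-≤ (draws ^ m) λ ρ → ⟦yes⟧ (P? _) (subst P (sym (run-combine s s′ (proj₁ (lucky s q)) j′ ρ)) (proj₂ (lucky s q)))))
            (term≤∑ᶠ (λ j → ∑ᶠ (draws ^ m) λ ρ → R (combine (combine s′ j) (combine (combine s j′) ρ))) (proj₁ (lucky s q)))

        PrOutput-lucky : fromℕ (∑ᶠ seeds (λ s → ⟦ Q? s ⟧)) ℚ.≤ fromℕ (seeds * guesses) ℚ.* PrOutput algorithm xs P?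
        PrOutput-lucky = */-≥ {∑ᶠ seeds (λ s → ⟦ Q? s ⟧)} {seeds * guesses} {(seeds * guesses) ^ m}
          {{ℕ.m*n≢0 seeds guesses}} {{ℕ.m^n≢0 (seeds * guesses) m {{ℕ.m*n≢0 seeds guesses}}}}
          {{ℕ.m^n≢0 (seeds * guesses) (2 + m) {{ℕ.m*n≢0 seeds guesses}}}} count-lucky

-- Histories of a stream, levels of its length, and searching.

module Histories where

  open import Data.Nat.Base using (_+_; _*_; _∸_; _^_; _≤_; _<_)
  open import Data.List.Base using (_++_)
  open SignedSums using (Ternary)
  open GoodTables using (powerSum; weigh)
  open Machines using (∑ᶠ; ∑ᶠ-cong; ∑ᶠ-mono-≤; ∑ᶠ-const; ∑ᶠ-*ˡ; ∑ᶠ-+)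

  δ : ∀ {n} → Fin n → Fin n → ℕ
  δ x i = if does (i Fin.≟ x) then 1 else 0

  occurrences : ∀ {n} → List (Fin n) → Fin n → ℕ
  occurrences []      i = 0
  occurrences (x ∷ h) i = δ x i + occurrences h i

  occurrences-++ : ∀ {n} (h h′ : List (Fin n)) i → occurrences (h ++ h′) i ≡ occurrences h i + occurrences h′ i
  occurrences-++ []      h′ i = refl
  occurrences-++ (x ∷ h) h′ i = trans (cong (δ x i +_) (occurrences-++ h h′ i)) (sym (ℕ.+-assoc (δ x i) _ _))

  frequency-∷ : ∀ {n m} x (xs : Stream n m) i → frequency (x ∷ xs) i ≡ δ x i + frequency xs i
  frequency-∷ x xs i with does (i Fin.≟ x)
  ... | true  = refl
  ... | false = refl

  occurrences-ʳ++ : ∀ {n m} (xs : Stream n m) h i →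
                    occurrences (toList xs ʳ++ h) i ≡ frequency xs i + occurrences h i
  occurrences-ʳ++ []       h i = refl
  occurrences-ʳ++ (x ∷ xs) h i = begin
    occurrences (toList xs ʳ++ (x ∷ h)) i        ≡⟨ occurrences-ʳ++ xs (x ∷ h) i ⟩
    frequency xs i + (δ x i + occurrences h i)   ≡⟨ rotate (frequency xs i) (δ x i) (occurrences h i) ⟩
    (δ x i + frequency xs i) + occurrences h i   ≡⟨ cong (_+ occurrences h i) (sym (frequency-∷ x xs i)) ⟩
    frequency (x ∷ xs) i + occurrences h i       ∎
    where
    open ≡-Reasoning
    rotate : ∀ a b c → a + (b + c) ≡ (b + a) + c
    rotate = solve-ℕ

  ∑ᶠ-δ : ∀ {n} (x : Fin n) → ∑ᶠ n (δ x) ≡ 1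
  ∑ᶠ-δ {suc n} zero    = cong suc (trans (∑ᶠ-const n 0) (ℕ.*-zeroʳ n))
  ∑ᶠ-δ {suc n} (suc x) = ∑ᶠ-δ x

  ∑ᶠ-occurrences : ∀ {n} (h : List (Fin n)) → ∑ᶠ n (occurrences h) ≡ length h
  ∑ᶠ-occurrences {n} []      = trans (∑ᶠ-const n 0) (ℕ.*-zeroʳ n)
  ∑ᶠ-occurrences {n} (x ∷ h) = trans (∑ᶠ-+ n (δ x) (occurrences h)) (cong₂ _+_ (∑ᶠ-δ x) (∑ᶠ-occurrences h))

  sum-tabulate : ∀ {n} (f : Fin n → ℕ) → Vec.sum (tabulate f) ≡ ∑ᶠ n f
  sum-tabulate {zero}  f = refl
  sum-tabulate {suc n} f = cong (f zero +_) (sum-tabulate (f ∘ suc))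

  powerSum-tabulate : ∀ d {n} (f : Fin n → ℕ) → powerSum d (tabulate f) ≡ ∑ᶠ n (λ i → f i ^ d)
  powerSum-tabulate d f = trans (cong Vec.sum (sym (Vec.tabulate-∘ (_^ d) f))) (sum-tabulate (λ i → f i ^ d))

  ‖‖²≡∑ᶠ : ∀ {n} (f : Fin n → ℕ) → ‖ f ‖² ≡ ∑ᶠ n (λ i → f i ^ 2)
  ‖‖²≡∑ᶠ f = sum-tabulate (λ i → f i ^ 2)

  hits : ∀ {n} → (Ternary → ℕ) → Vec Ternary n → List (Fin n) → ℕ
  hits g σ []      = 0
  hits g σ (x ∷ h) = g (lookup σ x) + hits g σ h

  weigh-+ : ∀ {n} g (u v : Fin n → ℕ) σ →
            weigh g (tabulate (λ i → u i + v i)) σ ≡ weigh g (tabulate u) σ + weigh g (tabulate v) σ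
  weigh-+ g u v []      = refl
  weigh-+ g u v (s ∷ σ) = begin
    (u zero + v zero) * g s + weigh g (tabulate (λ i → u (suc i) + v (suc i))) σ
      ≡⟨ cong₂ _+_ (ℕ.*-distribʳ-+ (g s) (u zero) (v zero)) (weigh-+ g (u ∘ suc) (v ∘ suc) σ) ⟩
    (u zero * g s + v zero * g s) + (weigh g (tabulate (u ∘ suc)) σ + weigh g (tabulate (v ∘ suc)) σ)
      ≡⟨ interchange ℕ.+-commutativeSemigroup (u zero * g s) (v zero * g s) _ _ ⟩
    (u zero * g s + weigh g (tabulate (u ∘ suc)) σ) + (v zero * g s + weigh g (tabulate (v ∘ suc)) σ) ∎
    where open ≡-Reasoning

  weigh-0 : ∀ {n} g (σ : Vec Ternary n) → weigh g (tabulate (λ _ → 0)) σ ≡ 0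
  weigh-0 g []      = refl
  weigh-0 g (s ∷ σ) = weigh-0 g σ

  weigh-δ : ∀ {n} g (x : Fin n) σ → weigh g (tabulate (δ x)) σ ≡ g (lookup σ x)
  weigh-δ g zero    (s ∷ σ) = trans (cong₂ _+_ (ℕ.*-identityˡ (g s)) (weigh-0 g σ)) (ℕ.+-identityʳ (g s))
  weigh-δ g (suc x) (s ∷ σ) = weigh-δ g x σ

  weigh-occurrences : ∀ {n} g (σ : Vec Ternary n) h → weigh g (tabulate (occurrences h)) σ ≡ hits g σ h
  weigh-occurrences g σ []      = weigh-0 g σ
  weigh-occurrences g σ (x ∷ h) = trans (weigh-+ g (δ x) (occurrences h) σ)
    (cong₂ _+_ (weigh-δ g x σ) (weigh-occurrences g σ h))

  -- As the latest element comes first, forgetting the first `b` elements of the stream keeps an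
  -- initial segment of the list.
  recent older : ∀ {A : Set} → ℕ → List A → List A
  recent b h = List.take (length h ∸ b) h
  older  b h = List.drop (length h ∸ b) h

  recent-∷ : ∀ {A : Set} {b} (x : A) h → b ≤ length h → recent b (x ∷ h) ≡ x ∷ recent b h
  recent-∷ {b = b} x h b≤h = cong (λ l → List.take l (x ∷ h)) (ℕ.+-∸-assoc 1 b≤h)

  recent-all : ∀ {A : Set} (h : List A) → recent (length h) h ≡ []
  recent-all h = cong (λ l → List.take l h) (ℕ.n∸n≡0 (length h))

  length-recent : ∀ {A : Set} b (h : List A) → length (recent b h) ≡ length h ∸ b
  length-recent b h = trans (List.length-take (length h ∸ b) h) (ℕ.m≤n⇒m⊓n≡m (ℕ.m∸n≤m (length h) b))

  length-older : ∀ {A : Set} b (h : List A) → length (older b h) ≤ b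
  length-older b h = ℕ.≤-trans (ℕ.≤-reflexive (List.length-drop (length h ∸ b) h))
    (ℕ.m≤n+o⇒m∸n≤o (length h) (length h ∸ b) (ℕ.≤-trans (ℕ.m≤n+m∸n (length h) b) (ℕ.≤-reflexive (ℕ.+-comm b _))))

  ∑ᶠ-square-≤ : ∀ n f → ∑ᶠ n (λ i → f i * f i) ≤ ∑ᶠ n f * ∑ᶠ n f
  ∑ᶠ-square-≤ zero    f = z≤n
  ∑ᶠ-square-≤ (suc n) f = begin
    a * a + ∑ᶠ n (λ i → f (suc i) * f (suc i)) ≤⟨ ℕ.+-monoʳ-≤ (a * a) (∑ᶠ-square-≤ n (f ∘ suc)) ⟩
    a * a + s * s                              ≤⟨ ℕ.m≤m+n (a * a + s * s) (2 * (a * s)) ⟩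
    a * a + s * s + 2 * (a * s)                ≡⟨ expand a s ⟩
    (a + s) * (a + s)                          ∎
    where
    open ℕ.≤-Reasoning
    a = f zero
    s = ∑ᶠ n (f ∘ suc)
    expand : ∀ a s → a * a + s * s + 2 * (a * s) ≡ (a + s) * (a + s)
    expand = solve-ℕ

  ∑ᶠ-≤-squares : ∀ n f → ∑ᶠ n f ≤ ∑ᶠ n (λ i → f i ^ 2)
  ∑ᶠ-≤-squares n f = ∑ᶠ-mono-≤ n λ i → a≤a² (f i)
    where
    a≤a² : ∀ a → a ≤ a ^ 2
    a≤a² zero    = z≤n
    a≤a² (suc a) = ℕ.m≤m*n (suc a) (suc a * 1) {{_}}

  ∑ᶠ-squares-≤ : ∀ {B} n f → (∀ i → f i ≤ B) → ∑ᶠ n (λ i → f i ^ 2) ≤ B * ∑ᶠ n f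
  ∑ᶠ-squares-≤ {B} n f f≤B = ℕ.≤-trans
    (∑ᶠ-mono-≤ n λ i → ℕ.≤-trans (ℕ.≤-reflexive (cong (f i *_) (ℕ.*-identityʳ (f i)))) (ℕ.*-monoˡ-≤ (f i) (f≤B i)))
    (ℕ.≤-reflexive (∑ᶠ-*ˡ n B f))

  module Bounded {n B} (h : List (Fin n)) (b : ℕ) (h≤B : ∀ i → occurrences h i ≤ B) where

    w u x : Fin n → ℕ
    w = occurrences (recent b h)
    u = occurrences (older b h)
    x = occurrences h

    F F₄ Fₓ len : ℕ
    F   = ∑ᶠ n (λ i → w i ^ 2)
    F₄  = ∑ᶠ n (λ i → w i ^ 4)
    Fₓ  = ∑ᶠ n (λ i → x i ^ 2)
    len = length (recent b h)

    x≡w+u : ∀ i → x i ≡ w i + u i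
    x≡w+u i = trans (cong (λ l → occurrences l i) (sym (List.take++drop≡id (length h ∸ b) h)))
                    (occurrences-++ (recent b h) (older b h) i)

    w≤x : ∀ i → w i ≤ x i
    w≤x i = ℕ.≤-trans (ℕ.m≤m+n (w i) (u i)) (ℕ.≤-reflexive (sym (x≡w+u i)))

    w≤B : ∀ i → w i ≤ B
    w≤B i = ℕ.≤-trans (w≤x i) (h≤B i)

    len≤F : len ≤ F
    len≤F = ℕ.≤-trans (ℕ.≤-reflexive (sym (∑ᶠ-occurrences (recent b h)))) (∑ᶠ-≤-squares n w)

    F≤B*len : F ≤ B * len
    F≤B*len = ℕ.≤-trans (∑ᶠ-squares-≤ n w w≤B) (ℕ.≤-reflexive (cong (B *_) (∑ᶠ-occurrences (recent b h))))

    F₄≤B²F : F₄ ≤ B * B * F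
    F₄≤B²F = ℕ.≤-trans (∑ᶠ-mono-≤ n λ i → ℕ.≤-trans (ℕ.≤-reflexive (split (w i))) (ℕ.*-monoˡ-≤ (w i ^ 2) (ℕ.*-mono-≤ (w≤B i) (w≤B i))))
      (ℕ.≤-reflexive (∑ᶠ-*ˡ n (B * B) _))
      where
      split : ∀ a → a * (a * (a * (a * 1))) ≡ a * a * (a * (a * 1))
      split = solve-ℕ

    F₄≤F² : F₄ ≤ F * F
    F₄≤F² = ℕ.≤-trans (ℕ.≤-reflexive (∑ᶠ-cong n λ i → split (w i))) (∑ᶠ-square-≤ n (λ i → w i ^ 2))
      where
      split : ∀ a → a * (a * (a * (a * 1))) ≡ a * (a * 1) * (a * (a * 1))
      split = solve-ℕ

    F≤Fₓ : F ≤ Fₓ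
    F≤Fₓ = ∑ᶠ-mono-≤ n λ i → ℕ.^-monoˡ-≤ 2 (w≤x i)

    -- Since (w + u)² ≤ w² + 2 (w + u) u and w + u ≤ B, each forgotten element lowers F₂ by at most
    -- 2 B.
    Fₓ≤F+2B*older : Fₓ ≤ F + 2 * B * length (older b h)
    Fₓ≤F+2B*older = begin
      Fₓ                                       ≤⟨ ∑ᶠ-mono-≤ n pointwise ⟩
      ∑ᶠ n (λ i → w i ^ 2 + 2 * B * u i)       ≡⟨ ∑ᶠ-+ n (λ i → w i ^ 2) (λ i → 2 * B * u i) ⟩
      F + ∑ᶠ n (λ i → 2 * B * u i)             ≡⟨ cong (F +_) (trans (∑ᶠ-*ˡ n (2 * B) u) (cong (2 * B *_) (∑ᶠ-occurrences (older b h)))) ⟩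
      F + 2 * B * length (older b h)           ∎
      where
      open ℕ.≤-Reasoning
      expand : ∀ w u → (w + u) * ((w + u) * 1) + u * u ≡ w * (w * 1) + 2 * (w + u) * u
      expand = solve-ℕ
      pointwise : ∀ i → x i ^ 2 ≤ w i ^ 2 + 2 * B * u i
      pointwise i = begin
        x i ^ 2                            ≡⟨ cong (_^ 2) (x≡w+u i) ⟩
        (w i + u i) ^ 2                    ≤⟨ ℕ.m≤m+n ((w i + u i) ^ 2) (u i * u i) ⟩
        (w i + u i) ^ 2 + u i * u i        ≡⟨ expand (w i) (u i) ⟩
        w i ^ 2 + 2 * (w i + u i) * u i    ≡⟨ cong (λ z → w i ^ 2 + 2 * z * u i) (sym (x≡w+u i)) ⟩
        w i ^ 2 + 2 * x i * u i            ≤⟨ ℕ.+-monoʳ-≤ (w i ^ 2) (ℕ.*-monoˡ-≤ (u i) (ℕ.*-monoʳ-≤ 2 (h≤B i))) ⟩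
        w i ^ 2 + 2 * B * u i              ∎

  length≤n*B : ∀ {n B} (h : List (Fin n)) → (∀ i → occurrences h i ≤ B) → length h ≤ n * B
  length≤n*B {n} {B} h h≤B = ℕ.≤-trans (ℕ.≤-reflexive (sym (∑ᶠ-occurrences h)))
    (ℕ.≤-trans (∑ᶠ-mono-≤ n h≤B) (ℕ.≤-reflexive (∑ᶠ-const n B)))

  if-elim : ∀ {A P : Set} (d : Dec P) {x y : A} (C : A → Set) → (P → C x) → (¬ P → C y) →
            C (if does d then x else y)
  if-elim (yes p) C Cx Cy = Cx p
  if-elim (no ¬p) C Cx Cy = Cy ¬p

  module Epochs (R : ℕ) .{{_ : NonTrivial R}} where

    private
      2≤R : 2 ≤ R
      2≤R = ℕ.nonTrivial⇒n>1 R

    instance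
      R≢0 : NonZero R
      R≢0 = ℕ.>-nonZero (ℕ.≤-trans (s≤s z≤n) 2≤R)

    -- The number of powers R, R², ... not exceeding m. The recursion follows the stream: one
    -- comparison per element decides whether the level changes.
    epoch : ℕ → ℕ
    epoch zero    = 0
    epoch (suc m) = if does (suc m ℕ.≟ R ^ suc (epoch m)) then suc (epoch m) else epoch m

    -- Level ℓ is read off at lengths in [threshold ℓ, threshold (suc ℓ)).  Its
    -- sketch samples with probability 1 / rate ℓ and only sees the stream from
    -- position birth ℓ on, so that two sketches suffice at any time.
    threshold birth rate : ℕ → ℕ
    threshold zero    = 0
    threshold (suc ℓ) = R ^ suc ℓ
    birth zero    = 0
    birth (suc ℓ) = threshold ℓ
    rate zero    = 1
    rate (suc ℓ) = R ^ ℓ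

    rate≢0 : ∀ ℓ → NonZero (rate ℓ)
    rate≢0 zero    = _
    rate≢0 (suc ℓ) = ℕ.m^n≢0 R ℓ

    -- Both sides are R^ℓ, except at level 1, which starts with the stream and has rate 1.
    birth≤rate : ∀ ℓ → birth (suc ℓ) ≤ rate (suc ℓ)
    birth≤rate zero    = z≤n
    birth≤rate (suc ℓ) = ℕ.≤-refl

    birth≤threshold : ∀ ℓ → birth ℓ ≤ threshold ℓ
    birth≤threshold zero          = z≤n
    birth≤threshold (suc zero)    = z≤n
    birth≤threshold (suc (suc ℓ)) = ℕ.m≤n*m (R ^ suc ℓ) R

    epoch-bounds : ∀ m → threshold (epoch m) ≤ m × m < R ^ suc (epoch m)
    epoch-bounds zero    = z≤n , ℕ.≤-trans (s≤s z≤n) (ℕ.≤-trans 2≤R (ℕ.≤-reflexive (sym (ℕ.*-identityʳ R))))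
    epoch-bounds (suc m) = if-elim (suc m ℕ.≟ R ^ suc (epoch m)) (λ ℓ → threshold ℓ ≤ suc m × suc m < R ^ suc ℓ)
      -- When the level changes, suc m = R^(ℓ + 1), which is below R^(ℓ + 2) because R ≥ 2.
      (λ sm≡ → ℕ.≤-reflexive (sym sm≡) , ℕ.<-≤-trans (ℕ.m<m+n (suc m) (s≤s z≤n))
        (ℕ.≤-trans (ℕ.≤-reflexive (double (suc m))) (ℕ.*-mono-≤ 2≤R (ℕ.≤-reflexive sm≡))))
      (λ sm≢ → ℕ.m≤n⇒m≤1+n (proj₁ (epoch-bounds m)) , ℕ.≤∧≢⇒< (proj₂ (epoch-bounds m)) sm≢)
      where
      double : ∀ a → a + a ≡ 2 * a
      double = solve-ℕ

  findFrom : {P : Pred ℕ 0ℓ} → Decidable P → ℕ → ℕ → ℕ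
  findFrom P? zero       i = i
  findFrom P? (suc fuel) i = if does (P? i) then i else findFrom P? fuel (suc i)

  -- When the fuel runs out, `i` is returned untested; by then y ≤ i, so i = y and the predicate
  -- holds there too.
  findFrom-least : ∀ {P : Pred ℕ 0ℓ} (P? : Decidable P) fuel i {y} → i ≤ y → y ≤ fuel + i → P y →
                   P (findFrom P? fuel i) × findFrom P? fuel i ≤ y
  findFrom-least {P} P? zero       i i≤y y≤ Py = subst P (ℕ.≤-antisym y≤ i≤y) Py , i≤y
  findFrom-least {P} P? (suc fuel) i {y} i≤y y≤ Py with P? i
  ... | yes Pi = Pi , i≤y
  ... | no ¬Pi = findFrom-least P? fuel (suc i) (ℕ.≤∧≢⇒< i≤y λ i≡y → ¬Pi (subst P (sym i≡y) Py))
                   (ℕ.≤-trans y≤ (ℕ.≤-reflexive (sym (ℕ.+-suc fuel i)))) Py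

  two-minorities : ∀ {A : Set} {P Q : Pred A 0ℓ} (P? : Decidable P) (Q? : Decidable Q) {n} (v : Vec A n) →
                   count P? v + count Q? v < n → ∃[ a ] (¬ P a × ¬ Q a)
  two-minorities P? Q? (x ∷ v) few with P? x | Q? x
  ... | no ¬p | no ¬q = x , ¬p , ¬q
  ... | yes _ | yes _ = two-minorities P? Q? v (ℕ.≤-trans (ℕ.+-monoʳ-≤ (suc (count P? v)) (ℕ.n≤1+n _)) (ℕ.≤-pred few))
  ... | yes _ | no _  = two-minorities P? Q? v (ℕ.≤-pred few)
  ... | no _  | yes _ = two-minorities P? Q? v (ℕ.≤-trans (ℕ.≤-reflexive (sym (ℕ.+-suc (count P? v) _))) (ℕ.≤-pred few))

-- Counters modulo M and the accuracy that they preserve.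

module ModularCounters where

  open import Data.Nat.Base using (_+_; _*_; _∸_; _^_; _≤_; _<_; _⊓_)
  open SignedSums using (Ternary)
  open RandomTables using (Grid)
  open GoodTables using (positivePart; negativePart; amplitude; energy; square-cancel-≤)
  open Histories

  toℕ-mod : ∀ a M .{{_ : NonZero M}} → toℕ (a mod M) ≡ a % M
  toℕ-mod a M = Fin.toℕ-fromℕ< (m%n<n a M)

  [m+n%d]%d≡[m+n]%d : ∀ m n d .{{_ : NonZero d}} → (m + n % d) % d ≡ (m + n) % d
  [m+n%d]%d≡[m+n]%d m n d = begin
    (m + n % d) % d             ≡⟨ %-distribˡ-+ m (n % d) d ⟩
    (m % d + n % d % d) % d     ≡⟨ cong (λ z → (m % d + z) % d) (m%n%n≡m%n n d) ⟩
    (m % d + n % d) % d         ≡⟨ %-distribˡ-+ m n d ⟨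
    (m + n) % d                 ∎
    where open ≡-Reasoning

  -- The absolute value of the representative of least size of the residue v.
  centre : ℕ → ℕ → ℕ
  centre M v = v ⊓ (M ∸ v)

  -- Counters hold P − N modulo M = suc M-1, with M-1 standing for −1.
  centre-% : ∀ M-1 P N → 2 * ∣ P - N ∣ ≤ suc M-1 → centre (suc M-1) ((P + M-1 * N) % suc M-1) ≡ ∣ P - N ∣
  centre-% M-1 P N 2d≤M with ℕ.≤-total N P
  ... | inj₁ N≤P = begin
    centre M ((P + M-1 * N) % M)   ≡⟨ cong (λ z → centre M ((z + M-1 * N) % M)) (sym (ℕ.m∸n+n≡m N≤P)) ⟩
    centre M ((P ∸ N + N + M-1 * N) % M) ≡⟨ cong (λ z → centre M (z % M)) (regroup (P ∸ N) N M-1) ⟩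
    centre M ((P ∸ N + N * M) % M) ≡⟨ cong (centre M) (trans ([m+kn]%n≡m%n (P ∸ N) N M) (m<n⇒m%n≡m d<M)) ⟩
    centre M (P ∸ N)               ≡⟨ ℕ.m≤n⇒m⊓n≡m (ℕ.m+n≤o⇒m≤o∸n (P ∸ N) (ℕ.≤-trans (ℕ.≤-reflexive (double (P ∸ N))) 2d′≤M)) ⟩
    P ∸ N                          ≡⟨ sym d≡ ⟩
    ∣ P - N ∣                      ∎
    where
    open ≡-Reasoning
    M = suc M-1
    d≡ : ∣ P - N ∣ ≡ P ∸ N
    d≡ = trans (ℕ.∣-∣-comm P N) (ℕ.m≤n⇒∣m-n∣≡n∸m N≤P)
    2d′≤M : 2 * (P ∸ N) ≤ M
    2d′≤M = subst (λ z → 2 * z ≤ M) d≡ 2d≤M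
    double : ∀ a → a + a ≡ 2 * a
    double = solve-ℕ
    regroup : ∀ d N m → d + N + m * N ≡ d + N * (1 + m)
    regroup = solve-ℕ
    half : ∀ d → 2 * d ≤ M → d < M
    half zero    _     = s≤s z≤n
    half (suc d) 2sd≤M = ℕ.≤-trans (ℕ.m<m+n (suc d) (s≤s z≤n)) (ℕ.≤-trans (ℕ.≤-reflexive (double (suc d))) 2sd≤M)
    d<M : P ∸ N < M
    d<M = half (P ∸ N) 2d′≤M
  ... | inj₂ P≤N with N ∸ P in N∸P≡
  ...   | zero  = begin
    centre M ((P + M-1 * N) % M)   ≡⟨ cong (λ z → centre M ((z + M-1 * N) % M)) P≡N ⟩
    centre M ((N + M-1 * N) % M)    ≡⟨ cong (λ z → centre M (z % M)) (regroup N M-1) ⟩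
    centre M ((0 + N * M) % M)     ≡⟨ cong (centre M) ([m+kn]%n≡m%n 0 N M) ⟩
    0                              ≡⟨ sym (ℕ.m≡n⇒∣m-n∣≡0 P≡N) ⟩
    ∣ P - N ∣                      ∎
    where
    open ≡-Reasoning
    M = suc M-1
    P≡N : P ≡ N
    P≡N = ℕ.≤-antisym P≤N (ℕ.m∸n≡0⇒m≤n N∸P≡)
    regroup : ∀ N m → N + m * N ≡ 0 + N * (1 + m)
    regroup = solve-ℕ
  ...   | suc d = begin
    centre M ((P + M-1 * N) % M)   ≡⟨ cong (λ z → centre M ((P + M-1 * z) % M)) N≡ ⟩
    centre M ((P + M-1 * (suc d + P)) % M) ≡⟨ cong (λ z → centre M ((P + z * (suc d + P)) % M)) M-1≡ ⟩
    centre M ((P + (M-1 ∸ d + d) * (suc d + P)) % M) ≡⟨ cong (λ z → centre M (z % M)) (regroup P (M-1 ∸ d) d) ⟩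
    centre M ((M-1 ∸ d + (P + d) * suc (M-1 ∸ d + d)) % M) ≡⟨ cong (λ z → centre M ((M-1 ∸ d + (P + d) * suc z) % M)) (sym M-1≡) ⟩
    centre M ((M-1 ∸ d + (P + d) * M) % M) ≡⟨ cong (centre M) (trans ([m+kn]%n≡m%n (M-1 ∸ d) (P + d) M) (m<n⇒m%n≡m (s≤s (ℕ.m∸n≤m M-1 d)))) ⟩
    (M ∸ suc d) ⊓ (M ∸ (M ∸ suc d)) ≡⟨ cong ((M ∸ suc d) ⊓_) (ℕ.m∸[m∸n]≡n sd≤M) ⟩
    (M ∸ suc d) ⊓ suc d            ≡⟨ ℕ.m≥n⇒m⊓n≡n (ℕ.m+n≤o⇒m≤o∸n (suc d) (ℕ.≤-trans (ℕ.≤-reflexive (double (suc d))) 2sd≤M)) ⟩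
    suc d                          ≡⟨ sym d≡ ⟩
    ∣ P - N ∣                      ∎
    where
    open ≡-Reasoning
    M = suc M-1
    d≡ : ∣ P - N ∣ ≡ suc d
    d≡ = trans (ℕ.m≤n⇒∣m-n∣≡n∸m P≤N) N∸P≡
    double : ∀ a → a + a ≡ 2 * a
    double = solve-ℕ
    2sd≤M : 2 * suc d ≤ M
    2sd≤M = subst (λ z → 2 * z ≤ M) d≡ 2d≤M
    sd≤M : suc d ≤ M
    sd≤M = ℕ.≤-trans (ℕ.m≤n*m (suc d) 2) 2sd≤M
    M-1≡ : M-1 ≡ M-1 ∸ d + d
    M-1≡ = sym (ℕ.m∸n+n≡m (ℕ.≤-pred sd≤M))
    N≡ : N ≡ suc d + P
    N≡ = trans (sym (ℕ.m∸n+n≡m P≤N)) (cong (_+ P) N∸P≡)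
    regroup : ∀ P a d → P + (a + d) * (1 + d + P) ≡ a + (P + d) * (1 + (a + d))
    regroup = solve-ℕ

  zipWith-map-self : ∀ {A B C : Set} (f : A → B → C) (g : A → B) {n} (v : Vec A n) →
                     zipWith f v (Vec.map g v) ≡ Vec.map (λ a → f a (g a)) v
  zipWith-map-self f g []      = refl
  zipWith-map-self f g (a ∷ v) = cong (f a (g a) ∷_) (zipWith-map-self f g v)

  module Counters (M-1 : ℕ) where

    M : ℕ
    M = suc M-1

    increment : Ternary → ℕ
    increment s = positivePart s + M-1 * negativePart s

    bump : Ternary → Fin M → Fin M
    bump s c = (increment s + toℕ c) mod M

    module _ {n : ℕ} where

      counter : List (Fin n) → Vec Ternary n → Fin M
      counter []      σ = zero
      counter (x ∷ h) σ = bump (lookup σ x) (counter h σ)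

      toℕ-counter : ∀ h σ → toℕ (counter h σ) ≡ (hits positivePart σ h + M-1 * hits negativePart σ h) % M
      toℕ-counter []      σ = sym (cong (_% M) (ℕ.*-zeroʳ M-1))
      toℕ-counter (x ∷ h) σ = begin
        toℕ ((increment s + toℕ (counter h σ)) mod M) ≡⟨ toℕ-mod (increment s + toℕ (counter h σ)) M ⟩
        (increment s + toℕ (counter h σ)) % M         ≡⟨ cong (λ z → (increment s + z) % M) (toℕ-counter h σ) ⟩
        (increment s + (P + M-1 * N) % M) % M         ≡⟨ [m+n%d]%d≡[m+n]%d (increment s) (P + M-1 * N) M ⟩
        (increment s + (P + M-1 * N)) % M             ≡⟨ cong (_% M) (regroup (positivePart s) (negativePart s) P N M-1) ⟩
        (positivePart s + P + M-1 * (negativePart s + N)) % M ∎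
        where
        open ≡-Reasoning
        s = lookup σ x
        P = hits positivePart σ h
        N = hits negativePart σ h
        regroup : ∀ p n P N m → p + m * n + (P + m * N) ≡ p + P + m * (n + N)
        regroup = solve-ℕ

      Sketch : ℕ → ℕ → Set
      Sketch k r = Vec (Vec (Fin M) k) r

      blank : ∀ {k r} → Sketch k r
      blank = replicate _ (replicate _ zero)

      sketch : ∀ {k r} → Grid n k r → List (Fin n) → Sketch k r
      sketch g h = Vec.map (Vec.map (counter h)) g

      advance : ∀ {k r} → Grid n k r → Fin n → Sketch k r → Sketch k r
      advance g x = zipWith (zipWith λ σ → bump (lookup σ x)) g

      sketch-[] : ∀ {k r} (g : Grid n k r) → sketch g [] ≡ blank
      sketch-[] g = trans (Vec.map-cong (λ σs → Vec.map-const σs zero) g) (Vec.map-const g _)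

      advance-sketch : ∀ {k r} (g : Grid n k r) x h → advance g x (sketch g h) ≡ sketch g (x ∷ h)
      advance-sketch g x h = trans (zipWith-map-self _ (Vec.map (counter h)) g)
        (Vec.map-cong (λ σs → zipWith-map-self _ (counter h) σs) g)

      groupEnergy : ∀ {k} → Vec (Fin M) k → ℕ
      groupEnergy cs = Vec.sum (Vec.map (λ c → centre M (toℕ c) ^ 2) cs)

      -- Each amplitude A satisfies (2 A)² ≤ M², so 2 A ≤ M, the range in which the residue
      -- determines A. The bound concerns the energy of the current history only: sums that
      -- overflowed earlier are recovered.
      groupEnergy-counter : ∀ {k} h (σs : Vec (Vec Ternary n) k) → 4 * energy (tabulate (occurrences h)) σs ≤ M * M →
                            groupEnergy (Vec.map (counter h) σs) ≡ energy (tabulate (occurrences h)) σs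
      groupEnergy-counter h []       _    = refl
      groupEnergy-counter h (σ ∷ σs) 4E≤M² = cong₂ _+_ (cong (_^ 2) centre-counter)
        (groupEnergy-counter h σs (ℕ.≤-trans (ℕ.*-monoʳ-≤ 4 (ℕ.m≤n+m (energy w σs) (A ^ 2))) 4E≤M²))
        where
        w = tabulate (occurrences h)
        A = amplitude w σ
        P = hits positivePart σ h
        N = hits negativePart σ h
        A≡ : A ≡ ∣ P - N ∣
        A≡ = cong₂ ∣_-_∣ (weigh-occurrences positivePart σ h) (weigh-occurrences negativePart σ h)
        square-double : ∀ a → 2 * a * (2 * a) ≡ 4 * (a * (a * 1))
        square-double = solve-ℕ
        2A≤M : 2 * A ≤ M
        2A≤M = square-cancel-≤ (ℕ.≤-trans (ℕ.≤-reflexive (square-double A))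
          (ℕ.≤-trans (ℕ.*-monoʳ-≤ 4 (ℕ.m≤m+n (A ^ 2) (energy w σs))) 4E≤M²))
        centre-counter : centre M (toℕ (counter h σ)) ≡ A
        centre-counter = trans (cong (centre M) (toℕ-counter h σ))
          (trans (centre-% M-1 P N (subst (λ z → 2 * z ≤ M) A≡ 2A≤M)) (sym A≡))

  -- The estimate q Y / k differs from v by at most 2 v / e. This is twice the tolerance of `Far`,
  -- which leaves room for the elements that a sketch has missed.
  Near : ℕ → ℕ → ℕ → ℕ → ℕ → Set
  Near e q k v Y = e * ∣ q * Y - k * v ∣ ≤ 2 * (k * v)

  near? : ∀ e q k v Y → Dec (Near e q k v Y)
  near? e q k v Y = _ ℕ.≤? _

  -- With F = v + D, the two tolerances give 8 E D ≤ 2 v + 2 F = 4 v + 2 D. Absorbing 2 D ≤ 4 E D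
  -- leaves E D ≤ v.
  near-ratio : ∀ {E q k Y v F} .{{_ : NonZero E}} .{{_ : NonZero k}} →
               Near (8 * E) q k v Y → Near (8 * E) q k F Y → v ≤ F → E * F ≤ E * v + v
  near-ratio {E} {q} {k} {Y} {v} {F} near-v near-F v≤F with ℕ.m≤n⇒∃[o]m+o≡n v≤F
  ... | D , refl = begin
    E * (v + D)      ≡⟨ ℕ.*-distribˡ-+ E v D ⟩
    E * v + E * D    ≤⟨ ℕ.+-monoʳ-≤ (E * v) (ℕ.*-cancelˡ-≤ 4 (ℕ.+-cancelʳ-≤ (4 * (E * D)) _ _ 8ED≤)) ⟩
    E * v + v        ∎
    where
    open ℕ.≤-Reasoning
    main : 8 * E * (v + D) ≤ 8 * E * v + (2 * v + 2 * (v + D))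
    main = ℕ.*-cancelˡ-≤ k (begin
      k * (8 * E * (v + D))                                        ≡⟨ pull k (8 * E) (v + D) ⟩
      8 * E * (k * (v + D))                                        ≤⟨ ℕ.*-monoʳ-≤ (8 * E) (ℕ.m≤n+∣n-m∣ (k * (v + D)) (q * Y)) ⟩
      8 * E * (q * Y + ∣ q * Y - k * (v + D) ∣)                    ≡⟨ ℕ.*-distribˡ-+ (8 * E) (q * Y) _ ⟩
      8 * E * (q * Y) + 8 * E * ∣ q * Y - k * (v + D) ∣            ≤⟨ ℕ.+-mono-≤ (ℕ.*-monoʳ-≤ (8 * E) (ℕ.m≤n+∣m-n∣ (q * Y) (k * v))) near-F ⟩
      8 * E * (k * v + ∣ q * Y - k * v ∣) + 2 * (k * (v + D))      ≡⟨ cong (_+ 2 * (k * (v + D))) (ℕ.*-distribˡ-+ (8 * E) (k * v) _) ⟩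
      8 * E * (k * v) + 8 * E * ∣ q * Y - k * v ∣ + 2 * (k * (v + D)) ≤⟨ ℕ.+-monoˡ-≤ (2 * (k * (v + D))) (ℕ.+-monoʳ-≤ (8 * E * (k * v)) near-v) ⟩
      8 * E * (k * v) + 2 * (k * v) + 2 * (k * (v + D))            ≡⟨ collect k E v D ⟩
      k * (8 * E * v + (2 * v + 2 * (v + D)))                      ∎)
      where
      pull : ∀ k e f → k * (e * f) ≡ e * (k * f)
      pull = solve-ℕ
      collect : ∀ k E v D → 8 * E * (k * v) + 2 * (k * v) + 2 * (k * (v + D)) ≡ k * (8 * E * v + (2 * v + 2 * (v + D)))
      collect = solve-ℕ
    8ED≤ : 4 * (E * D) + 4 * (E * D) ≤ 4 * v + 4 * (E * D)
    8ED≤ = begin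
      4 * (E * D) + 4 * (E * D) ≤⟨ ℕ.+-cancelˡ-≤ (8 * E * v) _ _ (ℕ.≤-trans (ℕ.≤-reflexive (split E v D)) (ℕ.≤-trans main (ℕ.≤-reflexive (split′ E v D)))) ⟩
      4 * v + 2 * D             ≤⟨ ℕ.+-monoʳ-≤ (4 * v) (ℕ.*-mono-≤ (ℕ.m≤m+n 2 2) (ℕ.m≤n*m D E)) ⟩
      4 * v + 4 * (E * D)       ∎
      where
      split : ∀ E v D → 8 * E * v + (4 * (E * D) + 4 * (E * D)) ≡ 8 * E * (v + D)
      split = solve-ℕ
      split′ : ∀ E v D → 8 * E * v + (2 * v + 2 * (v + D)) ≡ 8 * E * v + (4 * v + 2 * D)
      split′ = solve-ℕ

-- The sketching machine and its correctness.

module Sketches where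

  open import Data.Nat.Base using (_+_; _*_; _∸_; _^_; _≤_; _<_)
  open Expectations using (fromℕ-mono-≤)
  open SignedSums using (Ternary)
  open RandomTables using (Grid)
  open GoodTables using (powerSum; energy; Far; far?; GridFar; gridFar?; count-map-≤)
  open Machines
  open Histories
  open ModularCounters

  length-toList-ʳ++ : ∀ {A : Set} {m} (xs : Vec A m) h → length (toList xs ʳ++ h) ≡ m + length h
  length-toList-ʳ++ xs h = trans (List.length-ʳ++ (toList xs)) (cong (_+ length h) (Vec.length-toList xs))

  if-transport : ∀ {A C P : Set} (d : Dec P) {x y : A} {u v : C} (f : C → A) →
                 (P → x ≡ f u) → (¬ P → y ≡ f v) → (if does d then x else y) ≡ f (if does d then u else v)
  if-transport (yes p) f x≡ y≡ = x≡ p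
  if-transport (no ¬p) f x≡ y≡ = y≡ ¬p

  ∑ᶠ-complement : ∀ {A : Set} {P : Pred A 0ℓ} (P? : Decidable P) {t} (T : Vec A t) {Q : Pred (Fin t) 0ℓ} (Q? : Decidable Q) →
                  (∀ i → ¬ P (lookup T i) → Q i) → t ≤ ∑ᶠ t (λ i → ⟦ Q? i ⟧) + count P? T
  ∑ᶠ-complement P? []      Q? ¬P⇒Q = z≤n
  ∑ᶠ-complement P? (a ∷ T) Q? ¬P⇒Q with ∑ᶠ-complement P? T (Q? ∘ suc) (¬P⇒Q ∘ suc) | P? a
  ... | ih | yes _ = ℕ.≤-trans (s≤s (ℕ.≤-trans ih (ℕ.+-monoˡ-≤ _ (ℕ.m≤n+m _ ⟦ Q? zero ⟧)))) (ℕ.≤-reflexive (sym (ℕ.+-suc _ _)))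
  ... | ih | no ¬p = ℕ.≤-trans (ℕ.+-mono-≤ (⟦yes⟧ (Q? zero) (¬P⇒Q zero ¬p)) ih) (ℕ.≤-reflexive (sym (ℕ.+-assoc ⟦ Q? zero ⟧ _ _)))

  -- Histories list the latest element first.
  history : ∀ {n m} → Stream n m → List (Fin n)
  history xs = toList xs ʳ++ []

  length-history : ∀ {n m} (xs : Stream n m) → length (history xs) ≡ m
  length-history xs = trans (length-toList-ʳ++ xs []) (ℕ.+-identityʳ _)

  occurrences-history : ∀ {n m} (xs : Stream n m) i → occurrences (history xs) i ≡ frequency xs i
  occurrences-history xs i = trans (occurrences-ʳ++ xs [] i) (ℕ.+-identityʳ _)

  ∑ᶠ-occurrences-history : ∀ {n m} (xs : Stream n m) → ∑ᶠ n (λ i → occurrences (history xs) i ^ 2) ≡ ‖ frequency xs ‖²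
  ∑ᶠ-occurrences-history {n} xs = trans (∑ᶠ-cong n λ i → cong (_^ 2) (occurrences-history xs i)) (sym (‖‖²≡∑ᶠ (frequency xs)))

  stream-length≤ : ∀ {n B m} (xs : Stream n m) → (∀ i → frequency xs i ≤ B) → m ≤ n * B
  stream-length≤ {n} {B} xs xs≤B = subst (_≤ n * B) (length-history xs)
    (length≤n*B (history xs) λ i → subst (_≤ B) (sym (occurrences-history xs i)) (xs≤B i))

  -- `B²≤Z` secures the variance bound, `16BE≤Z` makes the missed prefix negligible, `nB<2^c` keeps
  -- the counter of the length exact, and `no-overflow` does so for centred counters. The ratio of
  -- successive levels is R = Z + 1: of R shares of the stream, at most one is missed.
  module SketchMachine
    {n : ℕ} (B c M-1 k s E Z : ℕ) .{{_ : NonZero B}} .{{_ : NonZero k}} .{{_ : NonZero E}}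
    (B²≤Z : B * B ≤ Z) (16BE≤Z : 2 * B * (8 * E) ≤ Z) (nB<2^c : n * B < 2 ^ c)
    (no-overflow : 8 * (k * B * (suc Z * suc Z)) ≤ suc M-1 * suc M-1)
    {t : ℕ} (T : ℕ → Vec (Grid n k (2 * s)) t)
    where

    private
      R : ℕ
      R = suc Z
      1≤Z : 1 ≤ Z
      1≤Z = ℕ.≤-trans (ℕ.*-mono-≤ (ℕ.>-nonZero⁻¹ B) (ℕ.>-nonZero⁻¹ B)) B²≤Z

    open Counters M-1
    private instance
      R-nonTrivial : NonTrivial R
      R-nonTrivial = ℕ.n>1⇒nonTrivial (s≤s 1≤Z)

    open Epochs R

    private instance
      2^c≢0 : NonZero (2 ^ c)
      2^c≢0 = ℕ.m^n≢0 2 c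

    -- The sketches of the current level and of the next one.
    State : Set
    State = Fin t × Fin (2 ^ c) × Sketch {n} k (2 * s) × Sketch {n} k (2 * s)

    begin-state : Fin t → State
    begin-state i = i , 0 mod (2 ^ c) , blank {n} , blank {n}

    step-at : ℕ → Fin n → State → State
    step-at m x (i , _ , cur , next) =
      if does (suc m ℕ.≟ R ^ suc (epoch m))
      -- The element that completes a level still goes into the sketch being promoted. The new blank
      -- one sees only later elements, as its birth is the current length `suc m`.
      then (i , suc m mod (2 ^ c) , advance (lookup (T (suc (epoch m))) i) x next , blank {n})
      else (i , suc m mod (2 ^ c) , advance (lookup (T (epoch m)) i) x cur , advance (lookup (T (suc (epoch m))) i) x next)

    step : Fin n → State → State
    step x st@(_ , m , _) = step-at (toℕ m) x st

    -- The invariant: what the memory should contain, as a function of seed, history and level.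
    snapshot : Fin t → List (Fin n) → ℕ → State
    snapshot i h ℓ = i , length h mod (2 ^ c) , sketch (lookup (T ℓ) i) (recent (birth ℓ) h)
                                              , sketch (lookup (T (suc ℓ)) i) (recent (birth (suc ℓ)) h)

    state : Fin t → List (Fin n) → State
    state i h = snapshot i h (epoch (length h))

    state-[] : ∀ i → begin-state i ≡ state i []
    state-[] i = cong₂ (λ x y → i , 0 mod (2 ^ c) , x , y) (sym (sketch-[] (lookup (T 0) i))) (sym (sketch-[] (lookup (T 1) i)))

    toℕ-count : ∀ {m} → m < 2 ^ c → toℕ (m mod (2 ^ c)) ≡ m
    toℕ-count {m} m<2^c = trans (toℕ-mod m (2 ^ c)) (m<n⇒m%n≡m m<2^c)

    -- Below 2^c the stored length is exact, so the machine changes level when `epoch` does. Both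
    -- stored sketches were born at or before the present length, hence a new element extends the
    -- part that they see; a newborn sketch is blank because that part is still empty.
    step-state : ∀ i x h → length h < 2 ^ c → step x (state i h) ≡ state i (x ∷ h)
    step-state i x h h<2^c = trans (cong (λ m → step-at m x (state i h)) (toℕ-count h<2^c)) go
      where
      ℓ = epoch (length h)
      lo : threshold ℓ ≤ length h
      lo = proj₁ (epoch-bounds (length h))
      advance-recent : ∀ ℓ′ → birth ℓ′ ≤ length h →
        advance (lookup (T ℓ′) i) x (sketch (lookup (T ℓ′) i) (recent (birth ℓ′) h)) ≡ sketch (lookup (T ℓ′) i) (recent (birth ℓ′) (x ∷ h))
      advance-recent ℓ′ b≤h = trans (advance-sketch (lookup (T ℓ′) i) x (recent (birth ℓ′) h))
        (cong (sketch (lookup (T ℓ′) i)) (sym (recent-∷ x h b≤h)))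
      go : step-at (length h) x (state i h) ≡ state i (x ∷ h)
      go = if-transport (suc (length h) ℕ.≟ R ^ suc ℓ) (snapshot i (x ∷ h))
        (λ sm≡ → cong₂ (λ y z → i , suc (length h) mod (2 ^ c) , y , z)
          (advance-recent (suc ℓ) lo)
          (trans (sym (sketch-[] (lookup (T (suc (suc ℓ))) i)))
            (cong (sketch (lookup (T (suc (suc ℓ))) i))
              (trans (sym (recent-all (x ∷ h))) (cong (λ b → recent b (x ∷ h)) sm≡)))))
        (λ sm≢ → cong₂ (λ y z → i , suc (length h) mod (2 ^ c) , y , z)
          (advance-recent ℓ (ℕ.≤-trans (birth≤threshold ℓ) lo))
          (advance-recent (suc ℓ) lo))

    execute-state : ∀ {m} i (xs : Stream n m) h → m + length h < 2 ^ c →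
                    foldl-stream step (state i h) xs ≡ state i (toList xs ʳ++ h)
    execute-state i []       h _     = refl
    execute-state {suc m} i (x ∷ xs) h m+h<2^c = trans
      (cong (λ st → foldl-stream step st xs) (step-state i x h (ℕ.≤-<-trans (ℕ.m≤n+m (length h) (suc m)) m+h<2^c)))
      (execute-state i xs (x ∷ h) (subst (_< 2 ^ c) (sym (ℕ.+-suc m (length h))) m+h<2^c))

    Dissents : ℕ → ℕ → Pred (Vec (Fin M) k) 0ℓ
    Dissents q v cs = ¬ Near (8 * E) q k v (groupEnergy {n} cs)

    dissents? : ∀ q v → Decidable (Dissents q v)
    dissents? q v cs = ¬? (near? (8 * E) q k v (groupEnergy {n} cs))

    -- Two plausible values are both near the energy of one common group, so
    -- even the least of them is accurate.
    Plausible : ℕ → Sketch {n} k (2 * s) → Pred ℕ 0ℓ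
    Plausible q cur v = count (dissents? q v) cur < s

    plausible? : ∀ q cur → Decidable (Plausible q cur)
    plausible? q cur v = count (dissents? q v) cur ℕ.<? s

    fuel : ℕ
    fuel = B * (n * B)

    value-at : ℕ → Sketch {n} k (2 * s) → ℕ
    -- The empty stream is answered outright, since the tables guarantee nothing for the zero
    -- vector.
    value-at zero      cur = 0
    value-at m@(suc _) cur = findFrom (plausible? (rate (epoch m)) cur) fuel 0

    value : State → ℕ
    value (_ , m , cur , _) = value-at (toℕ m) cur

    -- Cleared form of v ≤ F ≤ v + v / E. The window is measured by v, which the output knows and
    -- can subdivide.
    Captures : ℕ → ℕ → Set
    Captures F v = v ≤ F × E * F ≤ E * v + v

    captures? : ∀ F v → Dec (Captures F v)
    captures? F v = (v ℕ.≤? F) ×-dec (E * F ℕ.≤? E * v + v)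

    plausible⇒captures : ∀ {q cur v F} → Plausible q cur v → Plausible q cur F → v ≤ F → Captures F v
    plausible⇒captures {q} {cur} {v} {F} few-v few-F v≤F
      with two-minorities (dissents? q v) (dissents? q F) cur
             (ℕ.≤-trans (ℕ.+-mono-<-≤ few-v (ℕ.<⇒≤ few-F)) (ℕ.≤-reflexive (cong (s +_) (sym (ℕ.+-identityʳ s)))))
    ... | cs , ¬¬near-v , ¬¬near-F = v≤F , near-ratio {q = q} {k} {groupEnergy {n} cs}
            (decidable-stable (near? (8 * E) q k v (groupEnergy {n} cs)) ¬¬near-v)
            (decidable-stable (near? (8 * E) q k F (groupEnergy {n} cs)) ¬¬near-F) v≤F

    -- From level 1 on the length is at least R q, with q the rate, and at most q elements are
    -- missed, which leaves (R - 1) q = Z q. Level 0 samples everything and misses nothing.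
    level-bounds : ∀ (h : List (Fin n)) ℓ → threshold ℓ ≤ length h →
      (rate ℓ ≡ 1 × length (older (birth ℓ) h) ≡ 0) ⊎
      (length (older (birth ℓ) h) ≤ rate ℓ × Z * rate ℓ ≤ length (recent (birth ℓ) h))
    level-bounds h zero    _    = inj₁ (refl , ℕ.n≤0⇒n≡0 (length-older 0 h))
    level-bounds h (suc ℓ) Rq≤h = inj₂ (ℕ.≤-trans (length-older (birth (suc ℓ)) h) (birth≤rate ℓ) , (begin
      Z * R ^ ℓ                          ≤⟨ ℕ.m+n≤o⇒m≤o∸n (Z * R ^ ℓ) (ℕ.≤-trans (ℕ.≤-reflexive (ℕ.+-comm (Z * R ^ ℓ) (R ^ ℓ))) Rq≤h) ⟩
      length h ∸ R ^ ℓ                   ≤⟨ ℕ.∸-monoʳ-≤ (length h) (birth≤rate ℓ) ⟩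
      length h ∸ birth (suc ℓ)           ≡⟨ sym (length-recent (birth (suc ℓ)) h) ⟩
      length (recent (birth (suc ℓ)) h)  ∎))
      where open ℕ.≤-Reasoning

    -- Relative to the rate the length is at most R² at every level; this is why the modulus of the
    -- counters can be independent of n.
    level-short : ∀ (h : List (Fin n)) ℓ → length h < R ^ suc ℓ → length h ≤ rate ℓ * (R * R)
    level-short h zero    h<R = ℕ.≤-trans (ℕ.<⇒≤ h<R) (ℕ.≤-trans (ℕ.≤-reflexive (ℕ.*-identityʳ R))
      (ℕ.≤-trans (ℕ.m≤m*n R R) (ℕ.≤-reflexive (sym (ℕ.*-identityˡ (R * R))))))
    level-short h (suc ℓ) h<RRq = ℕ.≤-trans (ℕ.<⇒≤ h<RRq) (ℕ.≤-reflexive (rotate R (R ^ ℓ)))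
      where
      rotate : ∀ R q → R * (R * q) ≡ q * (R * R)
      rotate = solve-ℕ

    module _ (h : List (Fin n)) (h≤B : ∀ i → occurrences h i ≤ B) (1≤h : 1 ≤ length h)
             (ℓ : ℕ) (lo : threshold ℓ ≤ length h) (hi : length h < R ^ suc ℓ) where

      open Bounded h (birth ℓ) h≤B

      private
        q prefix : ℕ
        q = rate ℓ
        prefix = length (older (birth ℓ) h)

      mass-bounds : (q ≡ 1 × prefix ≡ 0) ⊎ (prefix ≤ q × Z * q ≤ len)
      mass-bounds = level-bounds h ℓ lo

      nonempty : 1 ≤ len
      nonempty with mass-bounds
      ... | inj₁ (_ , prefix≡0) = ℕ.≤-trans 1≤h (ℕ.≤-trans (ℕ.≤-reflexive len+prefix)
              (ℕ.≤-reflexive (trans (cong (len +_) prefix≡0) (ℕ.+-identityʳ len))))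
        where
        len+prefix : length h ≡ len + prefix
        len+prefix = trans (cong length (sym (List.take++drop≡id (length h ∸ birth ℓ) h))) (List.length-++ (recent (birth ℓ) h))
      ... | inj₂ (_ , Zq≤len) = ℕ.≤-trans (ℕ.*-mono-≤ 1≤Z (ℕ.>-nonZero⁻¹ q {{rate≢0 ℓ}})) Zq≤len

      -- F₄ ≤ B² F and q B² ≤ q Z ≤ `len` ≤ F; at rate 1, F₄ ≤ F² suffices. This is the condition
      -- under which the tables are good.
      spread : q * F₄ ≤ F * F
      spread with mass-bounds
      ... | inj₁ (q≡1 , _)   = ℕ.≤-trans (ℕ.≤-reflexive (trans (cong (_* F₄) q≡1) (ℕ.*-identityˡ F₄))) F₄≤F²
      ... | inj₂ (_ , Zq≤len) = begin
        q * F₄            ≤⟨ ℕ.*-monoʳ-≤ q F₄≤B²F ⟩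
        q * (B * B * F)   ≡⟨ rotate q (B * B) F ⟩
        B * B * q * F     ≤⟨ ℕ.*-monoˡ-≤ F (ℕ.≤-trans (ℕ.*-monoˡ-≤ q B²≤Z) (ℕ.≤-trans Zq≤len len≤F)) ⟩
        F * F             ∎
        where
        open ℕ.≤-Reasoning
        rotate : ∀ q b F → q * (b * F) ≡ b * q * F
        rotate = solve-ℕ

      -- The at most q missed elements cost at most 2 B each, and 16 B E q ≤ Z q ≤ F.
      prefix-small : 8 * E * Fₓ ≤ 8 * E * F + F
      prefix-small = begin
        8 * E * Fₓ                          ≤⟨ ℕ.*-monoʳ-≤ (8 * E) Fₓ≤F+2B*older ⟩
        8 * E * (F + 2 * B * prefix)        ≡⟨ expand E F B prefix ⟩
        8 * E * F + 2 * B * (8 * E) * prefix ≤⟨ ℕ.+-monoʳ-≤ (8 * E * F) small ⟩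
        8 * E * F + F                       ∎
        where
        open ℕ.≤-Reasoning
        expand : ∀ E F B p → 8 * E * (F + 2 * B * p) ≡ 8 * E * F + 2 * B * (8 * E) * p
        expand = solve-ℕ
        small : 2 * B * (8 * E) * prefix ≤ F
        small with mass-bounds
        ... | inj₁ (_ , prefix≡0) = ℕ.≤-trans (ℕ.≤-reflexive (trans (cong (2 * B * (8 * E) *_) prefix≡0) (ℕ.*-zeroʳ (2 * B * (8 * E))))) z≤n
        ... | inj₂ (prefix≤q , Zq≤len) = ℕ.≤-trans (ℕ.*-mono-≤ 16BE≤Z prefix≤q) (ℕ.≤-trans Zq≤len len≤F)

      short : length h ≤ q * (R * R)
      short = level-short h ℓ hi

      w-vector : Vec ℕ n
      w-vector = tabulate w

      powerSum-w : powerSum 2 w-vector ≡ F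
      powerSum-w = powerSum-tabulate 2 w

      -- Triangle inequality through k F: the random error is at most k F / (8 E), and so is the
      -- error from the missed prefix. Together they make the 2 in `Near`.
      close⇒near : ∀ (σs : Vec (Vec Ternary n) k) → ¬ Far (8 * E) q w-vector σs →
                   Near (8 * E) q k Fₓ (groupEnergy {n} (Vec.map (counter (recent (birth ℓ) h)) σs))
      close⇒near σs ¬far = begin
        8 * E * ∣ q * groupEnergy {n} (Vec.map (counter (recent (birth ℓ) h)) σs) - k * Fₓ ∣
          ≡⟨ cong (λ y → 8 * E * ∣ q * y - k * Fₓ ∣) (groupEnergy-counter (recent (birth ℓ) h) σs 4Y≤M²) ⟩
        8 * E * ∣ q * Y - k * Fₓ ∣
          ≤⟨ ℕ.*-monoʳ-≤ (8 * E) (ℕ.∣-∣-triangle (q * Y) (k * F) (k * Fₓ)) ⟩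
        8 * E * (∣ q * Y - k * F ∣ + ∣ k * F - k * Fₓ ∣)
          ≡⟨ trans (ℕ.*-distribˡ-+ (8 * E) ∣ q * Y - k * F ∣ _) (cong (8 * E * ∣ q * Y - k * F ∣ +_) distance) ⟩
        8 * E * ∣ q * Y - k * F ∣ + k * (8 * E * Fₓ ∸ 8 * E * F)
          ≤⟨ ℕ.+-mono-≤ deviation≤ (ℕ.*-monoʳ-≤ k (ℕ.m≤n+o⇒m∸n≤o (8 * E * Fₓ) (8 * E * F) prefix-small)) ⟩
        k * F + k * F
          ≤⟨ ℕ.+-mono-≤ (ℕ.*-monoʳ-≤ k F≤Fₓ) (ℕ.*-monoʳ-≤ k F≤Fₓ) ⟩
        k * Fₓ + k * Fₓ
          ≡⟨ cong (k * Fₓ +_) (sym (ℕ.+-identityʳ (k * Fₓ))) ⟩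
        2 * (k * Fₓ) ∎
        where
        open ℕ.≤-Reasoning
        Y : ℕ
        Y = energy w-vector σs
        deviation≤ : 8 * E * ∣ q * Y - k * F ∣ ≤ k * F
        deviation≤ = subst (λ f → 8 * E * ∣ q * Y - k * f ∣ ≤ k * f) powerSum-w (ℕ.≮⇒≥ ¬far)
        distance : 8 * E * ∣ k * F - k * Fₓ ∣ ≡ k * (8 * E * Fₓ ∸ 8 * E * F)
        distance = trans (cong (8 * E *_) (ℕ.m≤n⇒∣m-n∣≡n∸m (ℕ.*-monoʳ-≤ k F≤Fₓ)))
          (trans (ℕ.*-distribˡ-∸ (8 * E) (k * Fₓ) (k * F))
            (trans (cong₂ _∸_ (rotate (8 * E) k Fₓ) (rotate (8 * E) k F)) (sym (ℕ.*-distribˡ-∸ k (8 * E * Fₓ) (8 * E * F)))))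
          where
          rotate : ∀ a k f → a * (k * f) ≡ k * (a * f)
          rotate = solve-ℕ
        qY≤2kF : q * Y ≤ 2 * (k * F)
        qY≤2kF = begin
          q * Y                            ≤⟨ ℕ.m≤n+∣m-n∣ (q * Y) (k * F) ⟩
          k * F + ∣ q * Y - k * F ∣        ≤⟨ ℕ.+-monoʳ-≤ (k * F) (ℕ.≤-trans (ℕ.m≤n*m _ (8 * E) {{ℕ.m*n≢0 8 E}}) deviation≤) ⟩
          k * F + k * F                    ≡⟨ cong (k * F +_) (sym (ℕ.+-identityʳ (k * F))) ⟩
          2 * (k * F)                      ∎
        F≤BqR² : F ≤ B * (q * (R * R))
        F≤BqR² = ℕ.≤-trans F≤B*len (ℕ.*-monoʳ-≤ B (ℕ.≤-trans (ℕ.≤-reflexive (length-recent (birth ℓ) h))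
          (ℕ.≤-trans (ℕ.m∸n≤m (length h) (birth ℓ)) short)))
        -- In q Y ≤ 2 k F ≤ 2 k B q R² the rate cancels, so the energy of an accurate group has a
        -- bound that is the same at all levels.
        4Y≤M² : 4 * Y ≤ suc M-1 * suc M-1
        4Y≤M² = ℕ.≤-trans (ℕ.*-cancelˡ-≤ q {{rate≢0 ℓ}} (begin
          q * (4 * Y)                       ≡⟨ swap q Y ⟩
          4 * (q * Y)                       ≤⟨ ℕ.*-monoʳ-≤ 4 (ℕ.≤-trans qY≤2kF (ℕ.*-monoʳ-≤ 2 (ℕ.*-monoʳ-≤ k F≤BqR²))) ⟩
          4 * (2 * (k * (B * (q * (R * R))))) ≡⟨ collect k B q (R * R) ⟩
          q * (8 * (k * B * (R * R)))       ∎)) no-overflow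
          where
          swap : ∀ q y → q * (4 * y) ≡ 4 * (q * y)
          swap = solve-ℕ
          collect : ∀ k B q r → 4 * (2 * (k * (B * (q * r)))) ≡ q * (8 * (k * B * r))
          collect = solve-ℕ

      close⇒plausible : ∀ i → ¬ GridFar s (8 * E) q w-vector (lookup (T ℓ) i) →
                        Plausible q (sketch (lookup (T ℓ) i) (recent (birth ℓ) h)) Fₓ
      close⇒plausible i ¬gridFar = ℕ.≤-<-trans
        (count-map-≤ (dissents? q Fₓ) (far? (8 * E) q w-vector) (Vec.map (counter (recent (birth ℓ) h)))
          (λ σs ¬near → decidable-stable (far? (8 * E) q w-vector σs) λ ¬far → ¬near (close⇒near σs ¬far))
          (lookup (T ℓ) i))
        (ℕ.≰⇒> ¬gridFar)

      Fₓ≤fuel : Fₓ ≤ fuel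
      Fₓ≤fuel = begin
        Fₓ                       ≤⟨ ∑ᶠ-squares-≤ n x h≤B ⟩
        B * ∑ᶠ n x               ≡⟨ cong (B *_) (∑ᶠ-occurrences h) ⟩
        B * length h             ≤⟨ ℕ.*-monoʳ-≤ B (length≤n*B h h≤B) ⟩
        B * (n * B)              ∎
        where open ℕ.≤-Reasoning

    -- The true F₂ is plausible and within the fuel, so the search stops at it or earlier; any
    -- plausible value below the truth is accurate.
    far-or-captures : ∀ (h : List (Fin n)) (h≤B : ∀ i → occurrences h i ≤ B) i → 1 ≤ length h →
      let ℓ = epoch (length h) in
      ¬ GridFar s (8 * E) (rate ℓ) (tabulate (occurrences (recent (birth ℓ) h))) (lookup (T ℓ) i) →
      Captures (∑ᶠ n (λ j → occurrences h j ^ 2)) (value (state i h))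
    far-or-captures h h≤B i 1≤h ¬gridFar = subst (Captures Fₓ) (sym value≡)
      (plausible⇒captures {rate ℓ} {cur} (proj₁ least) plausible (proj₂ least))
      where
      ℓ = epoch (length h)
      open Bounded h (birth ℓ) h≤B using (Fₓ)
      cur : Sketch {n} k (2 * s)
      cur = sketch (lookup (T ℓ) i) (recent (birth ℓ) h)
      lo = proj₁ (epoch-bounds (length h))
      hi = proj₂ (epoch-bounds (length h))
      plausible : Plausible (rate ℓ) cur Fₓ
      plausible = close⇒plausible h h≤B 1≤h ℓ lo hi i ¬gridFar
      least = findFrom-least (plausible? (rate ℓ) cur) fuel 0 z≤n
        (ℕ.≤-trans (Fₓ≤fuel h h≤B 1≤h ℓ lo hi) (ℕ.≤-reflexive (sym (ℕ.+-identityʳ fuel)))) plausible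
      value-suc : ∀ m cur → 1 ≤ m → value-at m cur ≡ findFrom (plausible? (rate (epoch m)) cur) fuel 0
      value-suc (suc m) cur _ = refl
      value≡ : value (state i h) ≡ findFrom (plausible? (rate ℓ) cur) fuel 0
      value≡ = trans (cong (λ m → value-at m cur) (toℕ-count (ℕ.≤-<-trans (length≤n*B h h≤B) nB<2^c)))
        (value-suc (length h) cur 1≤h)

    value-[] : ∀ i → value (state i []) ≡ 0
    value-[] i = cong (λ m → value-at m (sketch (lookup (T 0) i) [])) (toℕ-count {0} (ℕ.>-nonZero⁻¹ (2 ^ c)))


    norm² : List (Fin n) → ℕ
    norm² h = ∑ᶠ n (λ i → occurrences h i ^ 2)

    module _ {a : ℕ} (few-far : ∀ ℓ v → (∀ i → lookup v i < suc B) → 0 < powerSum 2 v →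
                        rate ℓ * powerSum 4 v ≤ powerSum 2 v * powerSum 2 v →
                        count (gridFar? s (8 * E) (rate ℓ) v) (T ℓ) < a) where

      -- Only the level of the final length counts, and only the vector that its sketch has seen:
      -- fewer than `a` entries of that one table are far from it.
      most-capture : ∀ h → (∀ i → occurrences h i ≤ B) →
                     t ∸ a ≤ ∑ᶠ t (λ i → ⟦ captures? (norm² h) (value (state i h)) ⟧)
      most-capture []        _   = begin
        t ∸ a              ≤⟨ ℕ.m∸n≤m t a ⟩
        t                  ≡⟨ sym (trans (∑ᶠ-const t 1) (ℕ.*-identityʳ t)) ⟩
        ∑ᶠ t (λ i → 1)     ≤⟨ ∑ᶠ-mono-≤ t (λ i → ⟦yes⟧ (captures? (norm² []) (value (state i []))) (captured i)) ⟩
        ∑ᶠ t (λ i → ⟦ captures? (norm² []) (value (state i [])) ⟧) ∎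
        where
        open ℕ.≤-Reasoning
        norm²≡0 : norm² [] ≡ 0
        norm²≡0 = trans (∑ᶠ-const n 0) (ℕ.*-zeroʳ n)
        captured : ∀ i → Captures (norm² []) (value (state i []))
        captured i = subst₂ Captures (sym norm²≡0) (sym (value-[] i)) (z≤n , ℕ.≤-trans (ℕ.≤-reflexive (ℕ.*-zeroʳ E)) z≤n)
      most-capture h@(_ ∷ _) h≤B = begin
        t ∸ a       ≤⟨ ℕ.∸-monoʳ-≤ t (ℕ.<⇒≤ few) ⟩
        t ∸ bad     ≤⟨ ℕ.m≤n+o⇒m∸n≤o t bad (ℕ.≤-trans complement (ℕ.≤-reflexive (ℕ.+-comm _ bad))) ⟩
        ∑ᶠ t (λ i → ⟦ captures? (norm² h) (value (state i h)) ⟧) ∎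
        where
        open ℕ.≤-Reasoning
        ℓ = epoch (length h)
        open Bounded h (birth ℓ) h≤B using (w; w≤B; len≤F)
        lo = proj₁ (epoch-bounds (length h))
        hi = proj₂ (epoch-bounds (length h))
        far-w? = gridFar? s (8 * E) (rate ℓ) {n} {k} {2 * s} (tabulate w)
        bad = count far-w? (T ℓ)
        few : bad < a
        few = few-far ℓ (tabulate w)
          (λ i → s≤s (ℕ.≤-trans (ℕ.≤-reflexive (Vec.lookup∘tabulate w i)) (w≤B i)))
          (ℕ.≤-trans (nonempty h h≤B (s≤s z≤n) ℓ lo hi) (ℕ.≤-trans len≤F (ℕ.≤-reflexive (sym (powerSum-tabulate 2 w)))))
          (subst₂ (λ f f₄ → rate ℓ * f₄ ≤ f * f) (sym (powerSum-tabulate 2 w)) (sym (powerSum-tabulate 4 w))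
            (spread h h≤B (s≤s z≤n) ℓ lo hi))
        complement : t ≤ ∑ᶠ t (λ i → ⟦ captures? (norm² h) (value (state i h)) ⟧) + bad
        complement = ∑ᶠ-complement far-w? (T ℓ) (λ i → captures? (norm² h) (value (state i h)))
          (λ i → far-or-captures h h≤B i (s≤s z≤n))

      module _ {τ μ J} {{_ : NonZero t}} {{_ : NonZero J}} (seed-code : Coded (Fin t) τ) (counter-code : Coded (Fin M) μ)
               (answer : Fin J → ℕ → ℚ) where

        machine : Machine n
        machine = record
          { State   = State
          ; space   = τ + (c + (2 * s * (k * μ) + 2 * s * (k * μ)))
          ; coded   = coded-× seed-code (coded-× (coded-Fin c) (coded-× sketch-code sketch-code))
          ; seeds   = t
          ; guesses = J
          ; start   = begin-state
          ; step    = step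
          ; answer  = λ j st → answer j (value st)
          }
          where
          sketch-code : Coded (Sketch {n} k (2 * s)) (2 * s * (k * μ))
          sketch-code = coded-Vec (coded-Vec counter-code k) (2 * s)

        machine-success : ∀ {m} (xs : Stream n m) → (∀ i → frequency xs i ≤ B) → {P : Pred ℚ 0ℓ} (P? : Decidable P) →
                          (∀ v → Captures ‖ frequency xs ‖² v → ∃[ j ] P (answer j v)) →
                          fromℕ (t ∸ a) ℚ.≤ fromℕ (t * J) ℚ.* PrOutput (Machine.algorithm machine) xs P?
        machine-success {m} xs xs≤B P? lucky = ℚ.≤-trans
          (fromℕ-mono-≤ (ℕ.≤-trans (most-capture (history xs) h≤B)
            (ℕ.≤-reflexive (∑ᶠ-cong t λ i → cong (λ st → ⟦ captures? (norm² (history xs)) (value st) ⟧) (sym (final≡ i))))))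
          (Machine.PrOutput-lucky machine xs P? (λ i → captures? (norm² (history xs)) (value (Machine.final machine xs i)))
            (λ i captured → lucky _ (subst (λ F → Captures F (value (Machine.final machine xs i))) (∑ᶠ-occurrences-history xs) captured)))
          where
          h≤B : ∀ i → occurrences (history xs) i ≤ B
          h≤B i = subst (_≤ B) (sym (occurrences-history xs i)) (xs≤B i)
          final≡ : ∀ i → Machine.final machine xs i ≡ state i (history xs)
          final≡ i = trans (cong (λ st → foldl-stream step st xs) (state-[] i))
            (execute-state i xs [] (ℕ.≤-<-trans (ℕ.≤-trans (ℕ.≤-reflexive (ℕ.+-identityʳ m)) (stream-length≤ xs xs≤B)) nB<2^c))

-- Choice of the parameters of the sketch.

module SketchParameters where

  open import Data.Nat.Base using (_+_; _*_; _∸_; _^_; _≤_; _<_)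
  open Expectations
  open GoodTables using (powerSum; gridFar?; good-table-ℕ)
  open Machines
  open Histories using (module Epochs)
  open Sketches using (module SketchMachine)

  n<2^n : ∀ n → n < 2 ^ n
  n<2^n zero    = s≤s z≤n
  n<2^n (suc n) = ℕ.+-mono-≤ (ℕ.≤-trans (s≤s z≤n) (n<2^n n)) (ℕ.≤-trans (n<2^n n) (ℕ.m≤m+n (2 ^ n) 0))

  2^-mono-≤ : ∀ {m n} → m ≤ n → 2 ^ m ≤ 2 ^ n
  2^-mono-≤ = ℕ.^-monoʳ-≤ 2

  module Parameters {n B : ℕ} .{{_ : NonZero B}} (η β φ γ : ℕ) (n<2^η : n < 2 ^ η) (B<2^β : B < 2 ^ β) where

    -- The tolerance is e = 8 E, hence k = 48 e². R = 2^ρ exceeds both B² and 16 B E. The 8 in μ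
    -- stems from 8 k = 24576 E² ≤ (2^8 E)², so that M = 2^8 · E · 2^β · R satisfies 8 k B R² ≤ M².
    a c ρ μ s E k Z M-1 : ℕ
    c   = η + β
    a   = 2 ^ c
    ρ   = 2 * β + φ + 4
    μ   = 8 + φ + β + ρ
    s   = γ + 2
    E   = 2 ^ φ
    k   = 48 * (8 * E * (8 * E))
    Z   = pred (2 ^ ρ)
    M-1 = pred (2 ^ μ)

    instance
      E≢0 : NonZero E
      E≢0 = ℕ.m^n≢0 2 φ
      k≢0 : NonZero k
      k≢0 = ℕ.m*n≢0 48 (8 * E * (8 * E)) {{_}} {{ℕ.m*n≢0 (8 * E) (8 * E) {{ε≢0}} {{ε≢0}}}}
        where ε≢0 = ℕ.m*n≢0 8 E

    suc-Z : suc Z ≡ 2 ^ ρ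
    suc-Z = ℕ.suc-pred (2 ^ ρ) {{ℕ.m^n≢0 2 ρ}}

    suc-M-1 : suc M-1 ≡ 2 ^ μ
    suc-M-1 = ℕ.suc-pred (2 ^ μ) {{ℕ.m^n≢0 2 μ}}

    nB<2^c : n * B < 2 ^ c
    nB<2^c = ℕ.≤-trans (ℕ.*-mono-< n<2^η B<2^β) (ℕ.≤-reflexive (sym (ℕ.^-distribˡ-+-* 2 η β)))

    B²≤Z : B * B ≤ Z
    B²≤Z = ℕ.<⇒≤pred (ℕ.<-≤-trans (ℕ.*-mono-< B<2^β B<2^β) (begin
      2 ^ β * 2 ^ β     ≡⟨ sym (ℕ.^-distribˡ-+-* 2 β β) ⟩
      2 ^ (β + β)       ≤⟨ 2^-mono-≤ (ℕ.≤-trans (ℕ.m≤m+n (β + β) (φ + 4)) (ℕ.≤-reflexive (collect β φ))) ⟩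
      2 ^ ρ             ∎))
      where
      open ℕ.≤-Reasoning
      collect : ∀ β φ → β + β + (φ + 4) ≡ 2 * β + φ + 4
      collect = solve-ℕ

    16BE≤Z : 2 * B * (8 * E) ≤ Z
    16BE≤Z = ℕ.<⇒≤pred (begin-strict
      2 * B * (8 * E)       ≡⟨ collect B E ⟩
      16 * E * B            <⟨ ℕ.*-monoʳ-< (16 * E) {{ℕ.m*n≢0 16 E}} B<2^β ⟩
      16 * E * 2 ^ β        ≡⟨ trans (cong (_* 2 ^ β) (sym (ℕ.^-distribˡ-+-* 2 4 φ))) (sym (ℕ.^-distribˡ-+-* 2 (4 + φ) β)) ⟩
      2 ^ (4 + φ + β)       ≤⟨ 2^-mono-≤ (ℕ.≤-trans (ℕ.m≤m+n (4 + φ + β) β) (ℕ.≤-reflexive (collect′ β φ))) ⟩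
      2 ^ ρ                 ∎)
      where
      open ℕ.≤-Reasoning
      collect : ∀ B E → 2 * B * (8 * E) ≡ 16 * E * B
      collect = solve-ℕ
      collect′ : ∀ β φ → 4 + φ + β + β ≡ 2 * β + φ + 4
      collect′ = solve-ℕ

    no-overflow : 8 * (k * B * (suc Z * suc Z)) ≤ suc M-1 * suc M-1
    no-overflow = subst₂ (λ r m → 8 * (k * B * (r * r)) ≤ m * m) (sym suc-Z) (sym suc-M-1) (begin
      8 * (k * B * (2 ^ ρ * 2 ^ ρ))
        ≤⟨ ℕ.*-mono-≤ (ℕ.m≤m+n 8 8) (ℕ.*-monoˡ-≤ (2 ^ ρ * 2 ^ ρ) (ℕ.*-mono-≤ (ℕ.*-monoˡ-≤ (8 * E * (8 * E)) (ℕ.m≤m+n 48 16)) B≤b²)) ⟩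
      4 * 4 * (8 * 8 * (8 * E * (8 * E)) * (2 ^ β * 2 ^ β) * (2 ^ ρ * 2 ^ ρ))
        ≡⟨ regroup 4 8 (8 * E) (2 ^ β) (2 ^ ρ) ⟩
      4 * (8 * (8 * E)) * 2 ^ β * 2 ^ ρ * (4 * (8 * (8 * E)) * 2 ^ β * 2 ^ ρ)
        ≡⟨ cong (λ z → z * z) (sym 2^μ) ⟩
      2 ^ μ * 2 ^ μ ∎)
      where
      open ℕ.≤-Reasoning
      B≤b² : B ≤ 2 ^ β * 2 ^ β
      B≤b² = ℕ.≤-trans (ℕ.<⇒≤ B<2^β) (ℕ.m≤m*n (2 ^ β) (2 ^ β) {{ℕ.m^n≢0 2 β}})
      regroup : ∀ f g e b r → f * f * (g * g * (e * e) * (b * b) * (r * r)) ≡ f * (g * e) * b * r * (f * (g * e) * b * r)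
      regroup = solve-ℕ
      doublings : ∀ E → 2 * (2 * (2 * (2 * (2 * (2 * (2 * (2 * E))))))) ≡ 4 * (8 * (8 * E))
      doublings = solve-ℕ
      2^μ : 2 ^ μ ≡ 4 * (8 * (8 * E)) * 2 ^ β * 2 ^ ρ
      2^μ = trans (ℕ.^-distribˡ-+-* 2 (8 + φ + β) ρ) (cong (_* 2 ^ ρ)
        (trans (ℕ.^-distribˡ-+-* 2 (8 + φ) β) (cong (_* 2 ^ β) (doublings E))))

    private instance
      R-nonTrivial : NonTrivial (suc Z)
      R-nonTrivial = ℕ.n>1⇒nonTrivial (s≤s (ℕ.≤-trans (ℕ.*-mono-≤ (ℕ.>-nonZero⁻¹ B) (ℕ.>-nonZero⁻¹ B)) B²≤Z))

    open Epochs (suc Z) using (rate; rate≢0)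

    -- The crude estimate B + 1 ≤ 2^B is good enough, because the seed pays only for log `a`.
    few-vectors : suc B ^ n < 2 ^ a
    few-vectors = begin-strict
      suc B ^ n      ≤⟨ ℕ.^-monoˡ-≤ n (n<2^n B) ⟩
      (2 ^ B) ^ n    ≡⟨ ℕ.^-*-assoc 2 B n ⟩
      2 ^ (B * n)    <⟨ ℕ.^-monoʳ-< 2 (s≤s (s≤s z≤n)) (subst (_< a) (ℕ.*-comm n B) nB<2^c) ⟩
      2 ^ a          ∎
      where open ℕ.≤-Reasoning

    tables : ∀ ℓ → ∃[ T ] (∀ (v : Vec ℕ n) → (∀ i → lookup v i < suc B) → 0 < powerSum 2 v →
               rate ℓ * powerSum 4 v ≤ powerSum 2 v * powerSum 2 v →
               count {n = 2 ^ γ * a} (gridFar? s (8 * E) (rate ℓ) {n} {k} {2 * s} v) T < a)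
    tables ℓ = good-table-ℕ (suc B) (rate ℓ) (8 * E) k γ a {{rate≢0 ℓ}} ℕ.≤-refl few-vectors

  -- Seed, counter of the length and two sketches. The constant 48 and the power 2^φ become
  -- variables K and E, which makes this a polynomial that the ring solver can expand.
  sketchSpace : (K γ η β φ E : ℕ) → ℕ
  sketchSpace K γ η β φ E =
    γ + (η + β) + ((η + β) + (2 * (γ + 2) * (K * (8 * E * (8 * E)) * (8 + φ + β + (2 * β + φ + 4)))
                             + 2 * (γ + 2) * (K * (8 * E * (8 * E)) * (8 + φ + β + (2 * β + φ + 4)))))

  module _ {n B : ℕ} .{{B≢0 : NonZero B}} (η β φ γ κ : ℕ) (n<2^η : n < 2 ^ η) (B<2^β : B < 2 ^ β)
           (answer : Fin (2 ^ κ) → ℕ → ℚ) where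

    private
      module Par = Parameters {n} {B} η β φ γ n<2^η B<2^β
      open Par using (a; c; μ; s; E; k; Z; M-1)
      module Sk = SketchMachine {n} B c M-1 k s E Z {{B≢0}} {{Par.k≢0}} {{Par.E≢0}} Par.B²≤Z Par.16BE≤Z Par.nB<2^c Par.no-overflow
                    {2 ^ γ * a} (λ ℓ → proj₁ (Par.tables ℓ))

    sketchMachine : Machine n
    sketchMachine = Sk.machine (λ ℓ → proj₂ (Par.tables ℓ)) {{ℕ.m*n≢0 (2 ^ γ) a {{ℕ.m^n≢0 2 γ}} {{ℕ.m^n≢0 2 c}}}} {{ℕ.m^n≢0 2 κ}}
      (coded-Fin-* (coded-Fin γ) (coded-Fin c)) (subst (λ M → Coded (Fin M) μ) (sym Par.suc-M-1) (coded-Fin μ)) answer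

    -- At least 2^γ · a - a of the 2^γ · a seeds are good, and each has a lucky guess among 2^κ; the
    -- factor `a` cancels.
    sketchMachine-success : ∀ {m} (xs : Stream n m) → (∀ i → frequency xs i ≤ B) → {P : Pred ℚ 0ℓ} (P? : Decidable P) →
      (∀ v → v ≤ ‖ frequency xs ‖² → 2 ^ φ * ‖ frequency xs ‖² ≤ 2 ^ φ * v + v → ∃[ j ] P (answer j v)) →
      fromℕ (2 ^ γ ∸ 1) ℚ.≤ fromℕ (2 ^ γ * 2 ^ κ) ℚ.* PrOutput (Machine.algorithm sketchMachine) xs P?
    sketchMachine-success xs xs≤B P? lucky = ℚ.*-cancelʳ-≤-pos (fromℕ a) {{ℚ.positive (fromℕ-mono-< {0} {a} (ℕ.>-nonZero⁻¹ a {{ℕ.m^n≢0 2 c}}))}} (begin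
      fromℕ (2 ^ γ ∸ 1) ℚ.* fromℕ a            ≡⟨ sym (fromℕ-* (2 ^ γ ∸ 1) a) ⟩
      fromℕ ((2 ^ γ ∸ 1) * a)                  ≡⟨ cong fromℕ (trans (ℕ.*-distribʳ-∸ a (2 ^ γ) 1) (cong (2 ^ γ * a ∸_) (ℕ.*-identityˡ a))) ⟩
      fromℕ (2 ^ γ * a ∸ a)                    ≤⟨ Sk.machine-success (λ ℓ → proj₂ (Par.tables ℓ)) {{ℕ.m*n≢0 (2 ^ γ) a {{ℕ.m^n≢0 2 γ}} {{ℕ.m^n≢0 2 c}}}} {{ℕ.m^n≢0 2 κ}}
                                                    (coded-Fin-* (coded-Fin γ) (coded-Fin c)) (subst (λ M → Coded (Fin M) μ) (sym Par.suc-M-1) (coded-Fin μ)) answer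
                                                    xs xs≤B P? (λ v (v≤F , EF≤) → lucky v v≤F EF≤) ⟩
      fromℕ (2 ^ γ * a * 2 ^ κ) ℚ.* p          ≡⟨ cong (ℚ._* p) (trans (cong fromℕ (swap (2 ^ γ) a (2 ^ κ))) (fromℕ-* (2 ^ γ * 2 ^ κ) a)) ⟩
      fromℕ (2 ^ γ * 2 ^ κ) ℚ.* fromℕ a ℚ.* p  ≡⟨ rotate (fromℕ (2 ^ γ * 2 ^ κ)) (fromℕ a) p ⟩
      fromℕ (2 ^ γ * 2 ^ κ) ℚ.* p ℚ.* fromℕ a  ∎)
      where
      open ℚ.≤-Reasoning
      p = PrOutput (Machine.algorithm sketchMachine) xs P?
      swap : ∀ d a j → d * a * j ≡ d * j * a
      swap = solve-ℕ
      rotate : ∀ x y z → x ℚ.* y ℚ.* z ≡ x ℚ.* z ℚ.* y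
      rotate = solve-∀ ℚ-ring

    sketchMachine-space : Machine.space sketchMachine ≡ sketchSpace 48 γ η β φ (2 ^ φ)
    sketchMachine-space = refl

-- Lower bounds for logarithms, dyadic rounding, and grids of guesses.

module Logarithms where

  open import Data.Rational.Base hiding (NonZero; nonZero; ∣_∣)
  open import Data.Rational.Properties hiding (_≟_)
  open Expectations
  open Machines using (fromℕ-*-/)
  open SketchParameters using (n<2^n)

  ÷-inverse : ∀ q .{{_ : Positive q}} → ((1ℚ ÷ q) {{pos⇒nonZero q}}) * q ≡ 1ℚ
  ÷-inverse q = trans (cong (_* q) (*-identityˡ ((1/ q) {{pos⇒nonZero q}}))) (*-inverseˡ q {{pos⇒nonZero q}})

  ÷-≥ : ∀ {x} q .{{_ : Positive q}} → x * q ≤ 1ℚ → x ≤ (1ℚ ÷ q) {{pos⇒nonZero q}}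
  ÷-≥ {x} q xq≤1 = *-cancelʳ-≤-pos q (subst (x * q ≤_) (sym (÷-inverse q)) xq≤1)

  +∣↥r∣≡↥r : ∀ r → 0ℚ ≤ r → ℤ.+ ℤ.∣ ↥ r ∣ ≡ ↥ r
  +∣↥r∣≡↥r r@(mkℚ n _ _) 0≤r = ℤ.0≤i⇒+∣i∣≡i (ℤ.nonNegative⁻¹ n {{nonNegative {r} 0≤r}})

  fraction : ∀ {r} → 0ℚ ≤ r → fromℕ (↧ₙ r) * r ≡ fromℕ ℤ.∣ ↥ r ∣
  fraction {r} 0≤r = trans (cong (fromℕ (↧ₙ r) *_) (sym r≡)) (fromℕ-*-/ ℤ.∣ ↥ r ∣ (↧ₙ r))
    where
    r≡ : ℤ.+ ℤ.∣ ↥ r ∣ / ↧ₙ r ≡ r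
    r≡ = trans (cong (_/ ↧ₙ r) (+∣↥r∣≡↥r r 0≤r)) (↥p/↧p≡p r)

  2^-cancel-≤ : ∀ {m n} → 2 ℕ.^ m ℕ.≤ 2 ℕ.^ n → m ℕ.≤ n
  2^-cancel-≤ 2^m≤2^n = ℕ.≮⇒≥ λ n<m → ℕ.<⇒≱ (ℕ.^-monoʳ-< 2 (ℕ.s≤s (ℕ.s≤s ℕ.z≤n)) n<m) 2^m≤2^n

  -- For r = a / b, 2^(k b) ≤ q^(N b) ≤ 2^(a N). Taking N large bounds even tiny logarithms away
  -- from 0, as required when δ is near 1.
  log-≥ : ∀ {q r} N k → 0ℚ ≤ q → fromℕ (2 ℕ.^ k) ≤ q ^ℚ N → log₂ q ≤ r → fromℕ k ≤ fromℕ N * r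
  log-≥ {q} {r} N k 0≤q 2^k≤q^N (0≤r , q^b≤2^a) = *-cancelˡ-≤-pos (fromℕ b) {{positive (fromℕ-mono-< {0} {b} (ℕ.s≤s ℕ.z≤n))}} (begin
    fromℕ b * fromℕ k        ≡⟨ sym (fromℕ-* b k) ⟩
    fromℕ (b ℕ.* k)          ≤⟨ fromℕ-mono-≤ bk≤Na ⟩
    fromℕ (N ℕ.* a)          ≡⟨ fromℕ-* N a ⟩
    fromℕ N * fromℕ a        ≡⟨ cong (fromℕ N *_) (sym (fraction 0≤r)) ⟩
    fromℕ N * (fromℕ b * r)  ≡⟨ rotate (fromℕ N) (fromℕ b) r ⟩
    fromℕ b * (fromℕ N * r)  ∎)
    where
    open ≤-Reasoning
    a = ℤ.∣ ↥ r ∣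
    b = ↧ₙ r
    rotate : ∀ x y z → x * (y * z) ≡ y * (x * z)
    rotate = solve-∀ ℚ-ring
    bk≤Na : b ℕ.* k ℕ.≤ N ℕ.* a
    bk≤Na = 2^-cancel-≤ (fromℕ-cancel-≤ (begin
      fromℕ (2 ℕ.^ (b ℕ.* k))       ≡⟨ trans (cong (λ e → fromℕ (2 ℕ.^ e)) (ℕ.*-comm b k)) (trans (fromℕ-^ 2 (k ℕ.* b)) (sym (^-*-assoc (fromℕ 2) k b))) ⟩
      (fromℕ 2 ^ℚ k) ^ℚ b           ≡⟨ cong (_^ℚ b) (sym (fromℕ-^ 2 k)) ⟩
      fromℕ (2 ℕ.^ k) ^ℚ b          ≤⟨ ^-mono-≤ (0≤fromℕ (2 ℕ.^ k)) 2^k≤q^N b ⟩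
      (q ^ℚ N) ^ℚ b                 ≡⟨ trans (^-*-assoc q N b) (trans (cong (q ^ℚ_) (ℕ.*-comm N b)) (sym (^-*-assoc q b N))) ⟩
      (q ^ℚ b) ^ℚ N                 ≤⟨ ^-mono-≤ (^-nonNeg 0≤q b) q^b≤2^a N ⟩
      fromℕ (2 ℕ.^ a) ^ℚ N          ≡⟨ cong (_^ℚ N) (fromℕ-^ 2 a) ⟩
      (fromℕ 2 ^ℚ a) ^ℚ N           ≡⟨ trans (^-*-assoc (fromℕ 2) a N) (trans (sym (fromℕ-^ 2 (a ℕ.* N))) (cong (λ e → fromℕ (2 ℕ.^ e)) (ℕ.*-comm a N))) ⟩
      fromℕ (2 ℕ.^ (N ℕ.* a))       ∎))

  2^≤⇒≤log : ∀ {q r} k → fromℕ (2 ℕ.^ k) ≤ q → log₂ q ≤ r → fromℕ k ≤ r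
  2^≤⇒≤log {q} {r} k 2^k≤q log≤ = subst (fromℕ k ≤_) (*-identityˡ r)
    (log-≥ 1 k (≤-trans (0≤fromℕ (2 ℕ.^ k)) 2^k≤q) (subst (fromℕ (2 ℕ.^ k) ≤_) (sym (*-identityʳ q)) 2^k≤q) log≤)

  bernoulli : ∀ {x} → 0ℚ ≤ x → ∀ N → 1ℚ + fromℕ N * x ≤ (1ℚ + x) ^ℚ N
  bernoulli {x} 0≤x zero    = ≤-reflexive (trans (cong (1ℚ +_) (*-zeroˡ x)) (+-identityʳ 1ℚ))
  bernoulli {x} 0≤x (suc N) = begin
    1ℚ + fromℕ (suc N) * x                        ≡⟨ cong (λ c → 1ℚ + c * x) (fromℕ-suc N) ⟩
    1ℚ + (1ℚ + fromℕ N) * x                       ≤⟨ p≤p+q (*-nonNeg {fromℕ N} {x * x} (0≤fromℕ N) (square-nonNeg x)) ⟩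
    1ℚ + (1ℚ + fromℕ N) * x + fromℕ N * (x * x)   ≡⟨ expand (fromℕ N) x ⟩
    (1ℚ + x) * (1ℚ + fromℕ N * x)                 ≤⟨ *-monoˡ-≤ (1ℚ + x) (+-nonNeg 0≤1 0≤x) (bernoulli 0≤x N) ⟩
    (1ℚ + x) * (1ℚ + x) ^ℚ N                      ∎
    where
    open ≤-Reasoning
    expand : ∀ N x → 1ℚ + (1ℚ + N) * x + N * (x * x) ≡ (1ℚ + x) * (1ℚ + N * x)
    expand = solve-∀ ℚ-ring

  ≤-<-connex : ∀ p q → p ≤ q ⊎ q < p
  ≤-<-connex p q with p ≤? q
  ... | yes p≤q = inj₁ p≤q
  ... | no  p≰q = inj₂ (≰⇒> p≰q)

  dyadic : ∀ {q} → 1ℚ ≤ q → ∃[ k ] (fromℕ (2 ℕ.^ k) ≤ q × q < fromℕ (2 ℕ.^ suc k))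
  dyadic {q} 1≤q = descend ℤ.∣ ↥ q ∣ (≤-<-trans q≤∣↥q∣ (fromℕ-mono-< (n<2^n ℤ.∣ ↥ q ∣)))
    where
    q≤∣↥q∣ : q ≤ fromℕ ℤ.∣ ↥ q ∣
    q≤∣↥q∣ = subst₂ _≤_ (*-identityˡ q) (fraction (≤-trans 0≤1 1≤q))
      (*-monoʳ-≤ q (≤-trans 0≤1 1≤q) (fromℕ-mono-≤ {1} {↧ₙ q} (ℕ.s≤s ℕ.z≤n)))
    descend : ∀ N → q < fromℕ (2 ℕ.^ N) → ∃[ k ] (fromℕ (2 ℕ.^ k) ≤ q × q < fromℕ (2 ℕ.^ suc k))
    descend zero    q<1 = ⊥-elim (<-irrefl refl (≤-<-trans 1≤q q<1))
    descend (suc N) q<2^sN = [ (λ 2^N≤q → N , 2^N≤q , q<2^sN) , descend N ]′ (≤-<-connex (fromℕ (2 ℕ.^ N)) q)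

  dyadic-ℕ : ∀ m .{{_ : NonZero m}} → ∃[ k ] (2 ℕ.^ k ℕ.≤ m × m ℕ.< 2 ℕ.^ suc k)
  dyadic-ℕ m = let k , lo , hi = dyadic (fromℕ-mono-≤ {1} {m} (ℕ.>-nonZero⁻¹ m)) in
    k , fromℕ-cancel-≤ lo , fromℕ-cancel-< hi

  fromℕ-*-½^ : ∀ e → fromℕ (2 ℕ.^ e) * ½ ^ℚ e ≡ 1ℚ
  fromℕ-*-½^ zero    = *-identityʳ 1ℚ
  fromℕ-*-½^ (suc e) = trans (cong (_* (½ * ½ ^ℚ e)) (fromℕ-* 2 (2 ℕ.^ e)))
    (trans (regroup (fromℕ (2 ℕ.^ e)) (½ ^ℚ e)) (fromℕ-*-½^ e))
    where
    regroup : ∀ a b → fromℕ 2 * a * (½ * b) ≡ a * b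
    regroup = solve-∀ ℚ-ring

  0<2^ : ∀ e → 0ℚ < fromℕ (2 ℕ.^ e)
  0<2^ e = fromℕ-mono-< {0} {2 ℕ.^ e} (ℕ.m^n>0 2 e)

  -- The number v (1 + j / 2^e), on a grid of step v / 2^e.
  grid-point : ℕ → ℕ → ℕ → ℚ
  grid-point e v j = fromℕ (2 ℕ.^ e ℕ.* v ℕ.+ j ℕ.* v) * ½ ^ℚ e

  -- F exceeds the grid point by at most one step, and v / 2^e ≤ F / 2^e ≤ ε F. The error is
  -- one-sided.
  grid-point-approx : ∀ {ε e v j F} → 0ℚ ≤ ε → 1ℚ ≤ ε * fromℕ (2 ℕ.^ e) → v ℕ.≤ F →
    2 ℕ.^ e ℕ.* v ℕ.+ j ℕ.* v ℕ.≤ 2 ℕ.^ e ℕ.* F → 2 ℕ.^ e ℕ.* F ℕ.≤ 2 ℕ.^ e ℕ.* v ℕ.+ j ℕ.* v ℕ.+ v →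
    IsApprox ε (fromℕ F) (grid-point e v j)
  grid-point-approx {ε} {e} {v} {j} {F} 0≤ε 1≤εE v≤F lo hi = lower , upper
    where
    open ≤-Reasoning
    E   = fromℕ (2 ℕ.^ e)
    y   = 2 ℕ.^ e ℕ.* v ℕ.+ j ℕ.* v
    y*E : grid-point e v j * E ≡ fromℕ y
    y*E = trans (rotate (fromℕ y) (½ ^ℚ e) E) (trans (cong (fromℕ y *_) (fromℕ-*-½^ e)) (*-identityʳ (fromℕ y)))
      where
      rotate : ∀ a b c → a * b * c ≡ a * (c * b)
      rotate = solve-∀ ℚ-ring
    lower : (1ℚ - ε) * fromℕ F ≤ grid-point e v j
    lower = *-cancelʳ-≤-pos E {{positive (0<2^ e)}} (subst ((1ℚ - ε) * fromℕ F * E ≤_) (sym y*E) (0≤q-p⇒p≤q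
      (subst (0ℚ ≤_) (collect ε E (fromℕ F) (fromℕ v) (fromℕ y))
        (+-nonNeg (+-nonNeg (p≤q⇒0≤q-p hi′) (p≤q⇒0≤q-p (fromℕ-mono-≤ v≤F)))
          (*-nonNeg {ε * E - 1ℚ} {fromℕ F} (p≤q⇒0≤q-p 1≤εE) (0≤fromℕ F))))))
      where
      hi′ : E * fromℕ F ≤ fromℕ y + fromℕ v
      hi′ = subst₂ _≤_ (fromℕ-* (2 ℕ.^ e) F) (fromℕ-+ y v) (fromℕ-mono-≤ hi)
      collect : ∀ ε E F v y → ((y + v) - E * F) + (F - v) + (ε * E - 1ℚ) * F ≡ y - (1ℚ - ε) * F * E
      collect = solve-∀ ℚ-ring
    upper : grid-point e v j ≤ (1ℚ + ε) * fromℕ F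
    upper = ≤-trans {j = fromℕ F} (*-cancelʳ-≤-pos E {{positive (0<2^ e)}} (begin
        grid-point e v j * E    ≡⟨ y*E ⟩
        fromℕ y                 ≤⟨ fromℕ-mono-≤ lo ⟩
        fromℕ (2 ℕ.^ e ℕ.* F)   ≡⟨ trans (fromℕ-* (2 ℕ.^ e) F) (*-comm E (fromℕ F)) ⟩
        fromℕ F * E             ∎))
      (≤-trans (p≤p+q (*-nonNeg {ε} {fromℕ F} 0≤ε (0≤fromℕ F))) (≤-reflexive (factor ε (fromℕ F))))
      where
      factor : ∀ ε F → F + ε * F ≡ (1ℚ + ε) * F
      factor = solve-∀ ℚ-ring

  exact-approx : ∀ {ε F} → 0ℚ ≤ ε → IsApprox ε (fromℕ F) (fromℕ F)
  exact-approx {ε} {F} 0≤ε =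
    0≤q-p⇒p≤q (subst (0ℚ ≤_) (below ε (fromℕ F)) 0≤εF) ,
    0≤q-p⇒p≤q (subst (0ℚ ≤_) (above ε (fromℕ F)) 0≤εF)
    where
    0≤εF : 0ℚ ≤ ε * fromℕ F
    0≤εF = *-nonNeg {ε} {fromℕ F} 0≤ε (0≤fromℕ F)
    below : ∀ ε F → ε * F ≡ F - (1ℚ - ε) * F
    below = solve-∀ ℚ-ring
    above : ∀ ε F → ε * F ≡ (1ℚ + ε) * F - F
    above = solve-∀ ℚ-ring

  cover : ∀ J {a v x} .{{_ : NonZero J}} → a ℕ.≤ x → x ℕ.≤ a ℕ.+ J ℕ.* v →
          ∃[ j ] (a ℕ.+ toℕ {J} j ℕ.* v ℕ.≤ x × x ℕ.≤ a ℕ.+ toℕ j ℕ.* v ℕ.+ v)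
  cover (suc J) = go J
    where
    go : ∀ J {a v x} → a ℕ.≤ x → x ℕ.≤ a ℕ.+ suc J ℕ.* v →
         ∃[ j ] (a ℕ.+ toℕ {suc J} j ℕ.* v ℕ.≤ x × x ℕ.≤ a ℕ.+ toℕ j ℕ.* v ℕ.+ v)
    go zero    {a} {v} {x} a≤x x≤ = zero , ℕ.≤-trans (ℕ.≤-reflexive (ℕ.+-identityʳ a)) a≤x ,
      ℕ.≤-trans x≤ (ℕ.≤-reflexive (cong₂ ℕ._+_ (sym (ℕ.+-identityʳ a)) (ℕ.+-identityʳ v)))
    go (suc J) {a} {v} {x} a≤x x≤ with a ℕ.+ v ℕ.≤? x
    ... | no a+v≰x = zero , ℕ.≤-trans (ℕ.≤-reflexive (ℕ.+-identityʳ a)) a≤x ,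
      ℕ.≤-trans (ℕ.<⇒≤ (ℕ.≰⇒> a+v≰x)) (ℕ.≤-reflexive (cong (ℕ._+ v) (sym (ℕ.+-identityʳ a))))
    ... | yes a+v≤x = let j , lo , hi = go J {a ℕ.+ v} {v} {x} a+v≤x (ℕ.≤-trans x≤ (ℕ.≤-reflexive (sym (ℕ.+-assoc a v _)))) in
      suc j , ℕ.≤-trans (ℕ.≤-reflexive (sym (ℕ.+-assoc a v _))) lo ,
      ℕ.≤-trans hi (ℕ.≤-reflexive (cong (ℕ._+ v) (ℕ.+-assoc a v _)))

  octave : ∀ I {v x} → v ℕ.≤ x → x ℕ.< v ℕ.* 2 ℕ.^ I →
           ∃[ i ] (v ℕ.* 2 ℕ.^ toℕ {I} i ℕ.≤ x × x ℕ.≤ 2 ℕ.* (v ℕ.* 2 ℕ.^ toℕ i))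
  octave zero    {v} {x} v≤x x<v = ⊥-elim (ℕ.<⇒≱ x<v (ℕ.≤-trans (ℕ.≤-reflexive (ℕ.*-identityʳ v)) v≤x))
  octave (suc I) {v} {x} v≤x x<  with v ℕ.* 2 ℕ.≤? x
  ... | no v2≰x = zero , ℕ.≤-trans (ℕ.≤-reflexive (ℕ.*-identityʳ v)) v≤x ,
    ℕ.≤-trans (ℕ.<⇒≤ (ℕ.≰⇒> v2≰x)) (ℕ.≤-reflexive (trans (ℕ.*-comm v 2) (cong (2 ℕ.*_) (sym (ℕ.*-identityʳ v)))))
  ... | yes v2≤x = let i , lo , hi = octave I {v ℕ.* 2} {x} v2≤x (ℕ.<-≤-trans x< (ℕ.≤-reflexive (sym (ℕ.*-assoc v 2 _)))) in
    suc i , ℕ.≤-trans (ℕ.≤-reflexive (sym (ℕ.*-assoc v 2 _))) lo ,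
    ℕ.≤-trans hi (ℕ.≤-reflexive (cong (2 ℕ.*_) (ℕ.*-assoc v 2 _)))

-- Machines that store only the length and guess the rest.

module Guessing where

  open import Data.Nat.Base using (_+_; _*_; _^_; _≤_; _<_)
  open Machines
  open Histories using (‖‖²≡∑ᶠ; ∑ᶠ-occurrences; ∑ᶠ-squares-≤; ∑ᶠ-≤-squares)
  open ModularCounters using (toℕ-mod; [m+n%d]%d≡[m+n]%d)
  open Sketches using (history; length-history; occurrences-history)
  open Logarithms

  module _ {n : ℕ} (c J : ℕ) {{_ : NonZero J}} (answer : Fin J → ℕ → ℚ) where

    private instance
      2^c≢0 : NonZero (2 ^ c)
      2^c≢0 = ℕ.m^n≢0 2 c

    counterMachine : Machine n
    counterMachine = record
      { State   = Fin (2 ^ c)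
      ; space   = c
      ; coded   = coded-Fin c
      ; seeds   = 1
      ; guesses = J
      ; start   = λ _ → 0 mod (2 ^ c)
      ; step    = λ _ m → suc (toℕ m) mod (2 ^ c)
      ; answer  = λ j m → answer j (toℕ m)
      }

    open Machine counterMachine using (step; final; PrOutput-lucky)

    toℕ-foldl-stream : ∀ {m} st (xs : Stream n m) → toℕ (foldl-stream step st xs) ≡ (m + toℕ st) % 2 ^ c
    toℕ-foldl-stream st [] = sym (m<n⇒m%n≡m (Fin.toℕ<n st))
    toℕ-foldl-stream {suc m} st (x ∷ xs) = begin
      toℕ (foldl-stream step (step x st) xs)   ≡⟨ toℕ-foldl-stream (step x st) xs ⟩
      (m + toℕ (step x st)) % 2 ^ c            ≡⟨ cong (λ z → (m + z) % 2 ^ c) (toℕ-mod (suc (toℕ st)) (2 ^ c)) ⟩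
      (m + suc (toℕ st) % 2 ^ c) % 2 ^ c       ≡⟨ [m+n%d]%d≡[m+n]%d m (suc (toℕ st)) (2 ^ c) ⟩
      (m + suc (toℕ st)) % 2 ^ c               ≡⟨ cong (_% 2 ^ c) (ℕ.+-suc m (toℕ st)) ⟩
      (suc m + toℕ st) % 2 ^ c                 ∎
      where open ≡-Reasoning

    counterMachine-success : ∀ {m} (xs : Stream n m) {P : Pred ℚ 0ℓ} (P? : Decidable P) →
      ∃[ j ] P (answer j (m % 2 ^ c)) → 1ℚ ℚ.≤ fromℕ J ℚ.* PrOutput (Machine.algorithm counterMachine) xs P?
    counterMachine-success {m} xs {P} P? (j , Pj) = subst (λ z → 1ℚ ℚ.≤ fromℕ z ℚ.* PrOutput (Machine.algorithm counterMachine) xs P?) (ℕ.*-identityˡ J)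
      (PrOutput-lucky xs P? {λ _ → ⊤} (λ _ → yes tt) (λ s _ → j , subst (λ z → P (answer j z)) (sym (final≡ s)) Pj))
      where
      final≡ : ∀ s → toℕ (final xs s) ≡ m % 2 ^ c
      final≡ s = trans (toℕ-foldl-stream (0 mod (2 ^ c)) xs)
        (cong (_% 2 ^ c) (trans (cong (m +_) (toℕ-mod 0 (2 ^ c))) (trans (cong (m +_) (m<n⇒m%n≡m (ℕ.m^n>0 2 c))) (ℕ.+-identityʳ m))))

  module _ (I e : ℕ) where

    private instance
      2^e≢0 : NonZero (2 ^ e)
      2^e≢0 = ℕ.m^n≢0 2 e

    -- One guess is reserved for the value 0, which lies in no octave. The others choose an octave
    -- above v and a grid point inside it.
    guess : ℕ → Fin (suc (I * 2 ^ e)) → ℚ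
    guess v zero    = fromℕ 0
    guess v (suc t) = grid-point e (v * 2 ^ toℕ (quotient {I} (2 ^ e) t)) (toℕ (remainder {I} (2 ^ e) t))

    guess-approx : ∀ {ε v F} → 0ℚ ℚ.≤ ε → 1ℚ ℚ.≤ ε ℚ.* fromℕ (2 ^ e) → F ≡ 0 ⊎ (v ≤ F × F < v * 2 ^ I) →
                   ∃[ t ] IsApprox ε (fromℕ F) (guess v t)
    guess-approx {ε} 0≤ε _ (inj₁ refl) = zero , exact-approx {ε} {0} 0≤ε
    guess-approx {ε} {v} {F} 0≤ε 1≤εE (inj₂ (v≤F , F<v2^I))
      with octave I v≤F F<v2^I
    ... | i , lo , hi with cover (2 ^ e) {2 ^ e * (v * 2 ^ toℕ i)} {v * 2 ^ toℕ i} {2 ^ e * F} (ℕ.*-monoʳ-≤ (2 ^ e) lo)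
                             (ℕ.≤-trans (ℕ.*-monoʳ-≤ (2 ^ e) hi) (ℕ.≤-reflexive (double (2 ^ e) (v * 2 ^ toℕ i))))
      where
      double : ∀ E w → E * (2 * w) ≡ E * w + E * w
      double = solve-ℕ
    ... | j , lo′ , hi′ = suc (combine i j) ,
      subst (λ (i , j) → IsApprox ε (fromℕ F) (grid-point e (v * 2 ^ toℕ i) (toℕ j))) (sym (Fin.remQuot-combine {I} i j))
        (grid-point-approx {ε} {e} {v * 2 ^ toℕ i} {toℕ j} {F} 0≤ε 1≤εE lo lo′ hi′)

  module _ {n B m : ℕ} (xs : Stream n m) (xs≤B : ∀ i → frequency xs i ≤ B) where

    private
      total : ∑ᶠ n (frequency xs) ≡ m
      total = trans (∑ᶠ-cong n λ i → sym (occurrences-history xs i)) (trans (∑ᶠ-occurrences (history xs)) (length-history xs))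

    length≤norm² : m ≤ ‖ frequency xs ‖²
    length≤norm² = subst₂ _≤_ total (sym (‖‖²≡∑ᶠ (frequency xs))) (∑ᶠ-≤-squares n (frequency xs))

    norm²≤B*length : ‖ frequency xs ‖² ≤ B * m
    norm²≤B*length = subst₂ (λ F l → F ≤ B * l) (sym (‖‖²≡∑ᶠ (frequency xs))) total (∑ᶠ-squares-≤ n (frequency xs) xs≤B)

-- From inequalities in ℕ to the space bound.

module SpaceBounds where

  open import Data.Nat.Base using (_+_; _*_; _^_; _≤_)
  open Expectations
  open Logarithms

  reciprocal-dyadic : ∀ {x} → 0ℚ ℚ.< x → x ℚ.≤ 1ℚ →
                      ∃[ k ] (fromℕ (2 ^ k) ℚ.* x ℚ.≤ 1ℚ × 1ℚ ℚ.< x ℚ.* fromℕ (2 ^ suc k))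
  reciprocal-dyadic {x} 0<x x≤1 = k ,
    subst (fromℕ (2 ^ k) ℚ.* x ℚ.≤_) (÷-inverse x) (*-monoʳ-≤ x (ℚ.<⇒≤ 0<x) (proj₁ (proj₂ bounds))) ,
    subst (ℚ._< x ℚ.* fromℕ (2 ^ suc k)) (trans (ℚ.*-comm x 1/x) (÷-inverse x))
      (ℚ.*-monoʳ-<-pos x (proj₂ (proj₂ bounds)))
    where
    instance
      x-pos : Positive x
      x-pos = ℚ.positive 0<x
    1/x : ℚ
    1/x = (1ℚ ÷ x) {{ℚ.pos⇒nonZero x}}
    bounds = dyadic (÷-≥ x (subst (ℚ._≤ 1ℚ) (sym (ℚ.*-identityˡ x)) x≤1))
    k = proj₁ bounds

  success-≥ : ∀ {η p} a c → 0ℚ ℚ.< fromℕ c → η ℚ.* fromℕ c ℚ.≤ fromℕ a → fromℕ a ℚ.≤ fromℕ c ℚ.* p → η ℚ.≤ p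
  success-≥ {η} {p} a c 0<c ηc≤a a≤cp = ℚ.*-cancelˡ-≤-pos (fromℕ c) {{ℚ.positive 0<c}}
    (ℚ.≤-trans (ℚ.≤-reflexive (ℚ.*-comm (fromℕ c) η)) (ℚ.≤-trans ηc≤a a≤cp))

  module Space {n B : ℕ} {ε δ : ℚ} .{{_ : Positive ε}} .{{_ : Positive δ}} {b f g h : ℕ}
    (2^b≤B : 2 ^ b ≤ B) (2^h≤n : 2 ^ h ≤ n) (2^fε≤1 : fromℕ (2 ^ f) ℚ.* ε ℚ.≤ 1ℚ) (2^gδ≤1 : fromℕ (2 ^ g) ℚ.* δ ℚ.≤ 1ℚ)
    where

    private
      Λ X : ℕ
      Λ = b + f
      X = 2 ^ f
      1/ε 1/δ : ℚ
      1/ε = (1ℚ ÷ ε) {{ℚ.pos⇒nonZero ε}}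
      1/δ = (1ℚ ÷ δ) {{ℚ.pos⇒nonZero δ}}

      X≤1/ε : fromℕ X ℚ.≤ 1/ε
      X≤1/ε = ÷-≥ ε 2^fε≤1

      2^g≤1/δ : fromℕ (2 ^ g) ℚ.≤ 1/δ
      2^g≤1/δ = ÷-≥ δ 2^gδ≤1

    2^-÷-≤ : ∀ i j {m} {x} .{{_ : Positive x}} → 2 ^ i ≤ m → fromℕ (2 ^ j) ℚ.≤ (1ℚ ÷ x) {{ℚ.pos⇒nonZero x}} →
             fromℕ (2 ^ (i + j)) ℚ.≤ (fromℕ m ÷ x) {{ℚ.pos⇒nonZero x}}
    2^-÷-≤ i j {m} {x} 2^i≤m 2^j≤1/x = subst (ℚ._≤ (fromℕ m ÷ x) {{ℚ.pos⇒nonZero x}})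
      (sym (trans (cong fromℕ (ℕ.^-distribˡ-+-* 2 i j)) (fromℕ-* (2 ^ i) (2 ^ j))))
      (*-mono-≤ (0≤fromℕ (2 ^ i)) (ℚ.≤-trans (0≤fromℕ (2 ^ j)) 2^j≤1/x′) (fromℕ-mono-≤ 2^i≤m) 2^j≤1/x′)
      where
      2^j≤1/x′ : fromℕ (2 ^ j) ℚ.≤ (ℚ.1/ x) {{ℚ.pos⇒nonZero x}}
      2^j≤1/x′ = subst (fromℕ (2 ^ j) ℚ.≤_) (ℚ.*-identityˡ ((ℚ.1/ x) {{ℚ.pos⇒nonZero x}})) 2^j≤1/x

    -- The fraction d / 2^e is a lower bound for log (1/δ), possibly far below 1; scaling by 2^e
    -- leaves an inequality in ℕ. The one number Λ = b + f bounds both log (B/ε) and log B + log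
    -- (1/ε) from below.
    space-bound : ∀ {C₁ C₂ s} d e → (∀ r → log₂ 1/δ ≤ r → fromℕ d ℚ.* ½ ^ℚ e ℚ.≤ r) →
                  s * 2 ^ e ≤ C₁ * (X * X * (Λ * Λ) * d * Λ) + C₂ * (h + g) * 2 ^ e →
                  SpaceBound C₁ C₂ n B ε δ s
    space-bound {C₁} {C₂} {s} d e d≤log s≤ ℓB/ε ℓ1/δ ℓB ℓ1/ε ℓn/δ B/ε≤ 1/δ≤ B≤ 1/ε≤ n/δ≤ = begin
      fromℕ s
        ≤⟨ ℚ.*-cancelʳ-≤-pos (fromℕ (2 ^ e)) {{ℚ.positive (0<2^ e)}} scaled ⟩
      fromℕ C₁ ℚ.* (x ℚ.* x ℚ.* (λq ℚ.* λq) ℚ.* d/2^e ℚ.* λq) ℚ.+ fromℕ C₂ ℚ.* fromℕ (h + g)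
        ≡⟨ cong (λ z → fromℕ C₁ ℚ.* z ℚ.+ fromℕ C₂ ℚ.* fromℕ (h + g)) (squares x λq d/2^e) ⟩
      fromℕ C₁ ℚ.* (x ^ℚ 2 ℚ.* λq ^ℚ 2 ℚ.* d/2^e ℚ.* λq) ℚ.+ fromℕ C₂ ℚ.* fromℕ (h + g)
        ≤⟨ ℚ.+-mono-≤ (*-monoˡ-≤ (fromℕ C₁) (0≤fromℕ C₁) product) (*-monoˡ-≤ (fromℕ C₂) (0≤fromℕ C₂) (2^≤⇒≤log (h + g) (2^-÷-≤ h g 2^h≤n 2^g≤1/δ) n/δ≤)) ⟩
      fromℕ C₁ ℚ.* (1/ε ^ℚ 2 ℚ.* ℓB/ε ^ℚ 2 ℚ.* ℓ1/δ ℚ.* (ℓB ℚ.+ ℓ1/ε)) ℚ.+ fromℕ C₂ ℚ.* ℓn/δ ∎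
      where
      open ℚ.≤-Reasoning
      x λq d/2^e : ℚ
      x  = fromℕ X
      λq = fromℕ Λ
      d/2^e = fromℕ d ℚ.* ½ ^ℚ e
      squares : ∀ x l d → x ℚ.* x ℚ.* (l ℚ.* l) ℚ.* d ℚ.* l ≡ x ℚ.* (x ℚ.* 1ℚ) ℚ.* (l ℚ.* (l ℚ.* 1ℚ)) ℚ.* d ℚ.* l
      squares = solve-∀ ℚ-ring
      0≤x² : 0ℚ ℚ.≤ x ^ℚ 2
      0≤x² = ^-nonNeg (0≤fromℕ X) 2
      0≤λ² : 0ℚ ℚ.≤ λq ^ℚ 2
      0≤λ² = ^-nonNeg (0≤fromℕ Λ) 2
      0≤½^e : ∀ e → 0ℚ ℚ.≤ ½ ^ℚ e
      0≤½^e = ^-nonNeg (ℚ.nonNegative⁻¹ ½)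
      0≤d : 0ℚ ℚ.≤ d/2^e
      0≤d = *-nonNeg {fromℕ d} {½ ^ℚ e} (0≤fromℕ d) (0≤½^e e)
      d≤ : d/2^e ℚ.≤ ℓ1/δ
      d≤ = d≤log ℓ1/δ 1/δ≤
      λ≤B/ε : λq ℚ.≤ ℓB/ε
      λ≤B/ε = 2^≤⇒≤log Λ (2^-÷-≤ b f 2^b≤B X≤1/ε) B/ε≤
      λ≤sum : λq ℚ.≤ ℓB ℚ.+ ℓ1/ε
      λ≤sum = subst (ℚ._≤ ℓB ℚ.+ ℓ1/ε) (sym (fromℕ-+ b f))
        (ℚ.+-mono-≤ (2^≤⇒≤log b (fromℕ-mono-≤ 2^b≤B) B≤) (2^≤⇒≤log f X≤1/ε 1/ε≤))
      0≤sum : 0ℚ ℚ.≤ ℓB ℚ.+ ℓ1/ε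
      0≤sum = ℚ.≤-trans (0≤fromℕ Λ) λ≤sum
      product : x ^ℚ 2 ℚ.* λq ^ℚ 2 ℚ.* d/2^e ℚ.* λq ℚ.≤ 1/ε ^ℚ 2 ℚ.* ℓB/ε ^ℚ 2 ℚ.* ℓ1/δ ℚ.* (ℓB ℚ.+ ℓ1/ε)
      product = *-mono-≤ (*-nonNeg {x ^ℚ 2 ℚ.* λq ^ℚ 2} {d/2^e} (*-nonNeg {x ^ℚ 2} {λq ^ℚ 2} 0≤x² 0≤λ²) 0≤d) 0≤sum
        (*-mono-≤ (*-nonNeg {x ^ℚ 2} {λq ^ℚ 2} 0≤x² 0≤λ²) (ℚ.≤-trans 0≤d d≤)
          (*-mono-≤ 0≤x² (^-nonNeg (ℚ.≤-trans (0≤fromℕ Λ) λ≤B/ε) 2) (^-mono-≤ (0≤fromℕ X) X≤1/ε 2) (^-mono-≤ (0≤fromℕ Λ) λ≤B/ε 2))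
          d≤)
        λ≤sum
      scaled : fromℕ s ℚ.* fromℕ (2 ^ e) ℚ.≤
               (fromℕ C₁ ℚ.* (x ℚ.* x ℚ.* (λq ℚ.* λq) ℚ.* d/2^e ℚ.* λq) ℚ.+ fromℕ C₂ ℚ.* fromℕ (h + g)) ℚ.* fromℕ (2 ^ e)
      scaled = begin
        fromℕ s ℚ.* fromℕ (2 ^ e)
          ≡⟨ sym (fromℕ-* s (2 ^ e)) ⟩
        fromℕ (s * 2 ^ e)
          ≤⟨ fromℕ-mono-≤ s≤ ⟩
        fromℕ (C₁ * (X * X * (Λ * Λ) * d * Λ) + C₂ * (h + g) * 2 ^ e)
          ≡⟨ trans (fromℕ-+ (C₁ * (X * X * (Λ * Λ) * d * Λ)) (C₂ * (h + g) * 2 ^ e)) (cong₂ ℚ._+_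
               (trans (fromℕ-* C₁ (X * X * (Λ * Λ) * d * Λ)) (cong (fromℕ C₁ ℚ.*_) monomial))
               (trans (fromℕ-* (C₂ * (h + g)) (2 ^ e)) (cong (ℚ._* fromℕ (2 ^ e)) (fromℕ-* C₂ (h + g))))) ⟩
        fromℕ C₁ ℚ.* (x ℚ.* x ℚ.* (λq ℚ.* λq) ℚ.* fromℕ d ℚ.* λq) ℚ.+ fromℕ C₂ ℚ.* fromℕ (h + g) ℚ.* fromℕ (2 ^ e)
          ≡⟨ cong (λ z → fromℕ C₁ ℚ.* (x ℚ.* x ℚ.* (λq ℚ.* λq) ℚ.* z ℚ.* λq) ℚ.+ fromℕ C₂ ℚ.* fromℕ (h + g) ℚ.* fromℕ (2 ^ e)) d≡ ⟩
        fromℕ C₁ ℚ.* (x ℚ.* x ℚ.* (λq ℚ.* λq) ℚ.* (d/2^e ℚ.* fromℕ (2 ^ e)) ℚ.* λq) ℚ.+ fromℕ C₂ ℚ.* fromℕ (h + g) ℚ.* fromℕ (2 ^ e)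
          ≡⟨ collect (fromℕ C₁) x λq d/2^e (fromℕ (2 ^ e)) (fromℕ C₂ ℚ.* fromℕ (h + g)) ⟩
        (fromℕ C₁ ℚ.* (x ℚ.* x ℚ.* (λq ℚ.* λq) ℚ.* d/2^e ℚ.* λq) ℚ.+ fromℕ C₂ ℚ.* fromℕ (h + g)) ℚ.* fromℕ (2 ^ e) ∎
        where
        monomial : fromℕ (X * X * (Λ * Λ) * d * Λ) ≡ x ℚ.* x ℚ.* (λq ℚ.* λq) ℚ.* fromℕ d ℚ.* λq
        monomial = trans (fromℕ-* (X * X * (Λ * Λ) * d) Λ) (cong (ℚ._* λq)
          (trans (fromℕ-* (X * X * (Λ * Λ)) d) (cong (ℚ._* fromℕ d)
            (trans (fromℕ-* (X * X) (Λ * Λ)) (cong₂ ℚ._*_ (fromℕ-* X X) (fromℕ-* Λ Λ))))))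
        d≡ : fromℕ d ≡ d/2^e ℚ.* fromℕ (2 ^ e)
        d≡ = sym (trans (rotate (fromℕ d) (½ ^ℚ e) (fromℕ (2 ^ e))) (trans (cong (fromℕ d ℚ.*_) (fromℕ-*-½^ e)) (ℚ.*-identityʳ (fromℕ d))))
          where
          rotate : ∀ a b c → a ℚ.* b ℚ.* c ≡ a ℚ.* (c ℚ.* b)
          rotate = solve-∀ ℚ-ring
        collect : ∀ c x l d e k → c ℚ.* (x ℚ.* x ℚ.* (l ℚ.* l) ℚ.* (d ℚ.* e) ℚ.* l) ℚ.+ k ℚ.* e ≡ (c ℚ.* (x ℚ.* x ℚ.* (l ℚ.* l) ℚ.* d ℚ.* l) ℚ.+ k) ℚ.* e
        collect = solve-∀ ℚ-ring

    log-g : ∀ r → log₂ 1/δ ≤ r → fromℕ g ℚ.* ½ ^ℚ 0 ℚ.≤ r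
    log-g r log≤r = subst (ℚ._≤ r) (sym (ℚ.*-identityʳ (fromℕ g))) (2^≤⇒≤log g 2^g≤1/δ log≤r)

    log-0 : ∀ r → log₂ 1/δ ≤ r → fromℕ 0 ℚ.* ½ ^ℚ 0 ℚ.≤ r
    log-0 r (0≤r , _) = subst (ℚ._≤ r) (sym (ℚ.*-zeroˡ 1ℚ)) 0≤r

    -- (1 / δ) ^ N ≥ (1 + 1 / N) ^ N ≥ 2 for N = 2 ^ e.
    log-½^ : ∀ e → 1ℚ ℚ.≤ (1ℚ ℚ.- δ) ℚ.* fromℕ (2 ^ e) → ∀ r → log₂ 1/δ ≤ r → fromℕ 1 ℚ.* ½ ^ℚ e ℚ.≤ r
    log-½^ e 1≤ηN r log≤r = begin
      fromℕ 1 ℚ.* t          ≤⟨ *-monoʳ-≤ t 0≤t (log-≥ N 1 (ℚ.≤-trans (0≤fromℕ (2 ^ g)) 2^g≤1/δ) 2≤ log≤r) ⟩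
      fromℕ N ℚ.* r ℚ.* t    ≡⟨ rotate (fromℕ N) r t ⟩
      fromℕ N ℚ.* t ℚ.* r    ≡⟨ trans (cong (ℚ._* r) (fromℕ-*-½^ e)) (ℚ.*-identityˡ r) ⟩
      r                      ∎
      where
      open ℚ.≤-Reasoning
      N : ℕ
      N = 2 ^ e
      t : ℚ
      t = ½ ^ℚ e
      0≤t : 0ℚ ℚ.≤ t
      0≤t = ^-nonNeg (ℚ.nonNegative⁻¹ ½) e
      rotate : ∀ a b c → a ℚ.* b ℚ.* c ≡ a ℚ.* c ℚ.* b
      rotate = solve-∀ ℚ-ring
      t≤η : t ℚ.≤ 1ℚ ℚ.- δ
      t≤η = ℚ.*-cancelʳ-≤-pos (fromℕ N) {{ℚ.positive (0<2^ e)}}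
        (subst (ℚ._≤ (1ℚ ℚ.- δ) ℚ.* fromℕ N) (sym (trans (ℚ.*-comm t (fromℕ N)) (fromℕ-*-½^ e))) 1≤ηN)
      1+t≤1/δ : 1ℚ ℚ.+ t ℚ.≤ 1/δ
      1+t≤1/δ = ÷-≥ δ (begin
        (1ℚ ℚ.+ t) ℚ.* δ                  ≤⟨ *-monoʳ-≤ δ (ℚ.<⇒≤ (ℚ.positive⁻¹ δ)) (ℚ.+-monoʳ-≤ 1ℚ t≤η) ⟩
        (1ℚ ℚ.+ (1ℚ ℚ.- δ)) ℚ.* δ         ≤⟨ p≤p+q (square-nonNeg (1ℚ ℚ.- δ)) ⟩
        (1ℚ ℚ.+ (1ℚ ℚ.- δ)) ℚ.* δ ℚ.+ (1ℚ ℚ.- δ) ℚ.* (1ℚ ℚ.- δ) ≡⟨ expand δ ⟩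
        1ℚ ∎)
        where
        expand : ∀ δ → (1ℚ ℚ.+ (1ℚ ℚ.- δ)) ℚ.* δ ℚ.+ (1ℚ ℚ.- δ) ℚ.* (1ℚ ℚ.- δ) ≡ 1ℚ
        expand = solve-∀ ℚ-ring
      2≤ : fromℕ 2 ℚ.≤ 1/δ ^ℚ N
      2≤ = begin
        fromℕ 2                 ≡⟨ cong (1ℚ ℚ.+_) (sym (fromℕ-*-½^ e)) ⟩
        1ℚ ℚ.+ fromℕ N ℚ.* t    ≤⟨ bernoulli 0≤t N ⟩
        (1ℚ ℚ.+ t) ^ℚ N         ≤⟨ ^-mono-≤ (+-nonNeg 0≤1 0≤t) 1+t≤1/δ N ⟩
        1/δ ^ℚ N                ∎

-- Arithmetic of the space used by the sketch.

module SketchSpace where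

  open import Data.Nat.Base using (_+_; _*_; _∸_; _^_; _≤_)
  open SketchParameters using (sketchSpace; 2^-mono-≤)

  sketchSpace-split : ∀ K γ η β φ E → sketchSpace K γ η β φ E ≡
    γ + 2 * (η + β) + 4 * ((γ + 2) * (K * (8 * E * (8 * E)) * (12 + 2 * φ + 3 * β)))
  sketchSpace-split K γ η β φ E = expand K γ η β φ E
    where
    expand : ∀ K γ η β φ E →
      γ + (η + β) + ((η + β) + (2 * (γ + 2) * (K * (8 * E * (8 * E)) * (8 + φ + β + (2 * β + φ + 4)))
                               + 2 * (γ + 2) * (K * (8 * E * (8 * E)) * (8 + φ + β + (2 * β + φ + 4)))))
      ≡ γ + 2 * (η + β) + 4 * ((γ + 2) * (K * (8 * E * (8 * E)) * (12 + 2 * φ + 3 * β)))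
    expand = solve-ℕ

  volume : (X Λ g : ℕ) → ℕ
  volume X Λ g = X * X * (Λ * Λ) * g * Λ

  XXgΛ≤volume : ∀ X Λ g .{{_ : NonZero Λ}} → X * X * g * Λ ≤ volume X Λ g
  XXgΛ≤volume X Λ g = ℕ.*-monoˡ-≤ Λ (ℕ.*-monoˡ-≤ g (ℕ.m≤m*n (X * X) (Λ * Λ) {{ℕ.m*n≢0 Λ Λ}}))

  Λ≤volume : ∀ X Λ g .{{_ : NonZero X}} .{{_ : NonZero Λ}} .{{_ : NonZero g}} → Λ ≤ volume X Λ g
  Λ≤volume X Λ g = ℕ.≤-trans (ℕ.m≤n*m Λ (X * X * g) {{ℕ.m*n≢0 (X * X) g {{ℕ.m*n≢0 X X}}}}) (XXgΛ≤volume X Λ g)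

  -- As Λ ≥ 1, a counter has at most 20 Λ bits, and 81920 = 4 · 4 · 256 · 20 with 256 X² = (8 · 2
  -- X)². The term 7 Λ takes up the share of log B in the seed and in the counter of the length.
  sketchSpace-≤ : ∀ K b f g h X {E} .{{_ : NonZero X}} → E ≡ 2 * X →
    sketchSpace K (suc (suc g)) (suc h) (suc (suc b)) (suc f) E ≤
    (81920 * K + 7) * volume X (suc b + f) (suc g) + 4 * (h + suc g)
  sketchSpace-≤ K b f g h X refl = begin
    sketchSpace K (suc (suc g)) (suc h) (suc (suc b)) (suc f) (2 * X)
      ≡⟨ sketchSpace-split K (suc (suc g)) (suc h) (suc (suc b)) (suc f) (2 * X) ⟩
    suc (suc g) + 2 * (suc h + suc (suc b)) + 4 * ((suc (suc g) + 2) * (K * (8 * (2 * X) * (8 * (2 * X))) * (12 + 2 * suc f + 3 * suc (suc b))))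
      ≤⟨ ℕ.+-mono-≤ (ℕ.≤-trans (ℕ.m≤m+n (suc (suc g) + 2 * (suc h + suc (suc b))) (3 + 3 * g + 2 * h + 5 * b + 7 * f)) (ℕ.≤-reflexive (slack b f g h)))
           (ℕ.*-monoʳ-≤ 4 (ℕ.*-mono-≤ (ℕ.≤-trans (ℕ.m≤m+n (suc (suc g) + 2) (3 * g)) (ℕ.≤-reflexive (slack₁ g)))
             (ℕ.*-monoʳ-≤ (K * (8 * (2 * X) * (8 * (2 * X)))) (ℕ.≤-trans (ℕ.m≤m+n (12 + 2 * suc f + 3 * suc (suc b)) (17 * b + 18 * f)) (ℕ.≤-reflexive (slack₂ b f)))))) ⟩
    4 * (h + suc g) + 7 * Λ + 4 * (4 * suc g * (K * (8 * (2 * X) * (8 * (2 * X))) * (20 * Λ)))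
      ≡⟨ regroup K X (suc g) Λ (4 * (h + suc g)) ⟩
    4 * (h + suc g) + 7 * Λ + 81920 * K * (X * X * suc g * Λ)
      ≤⟨ ℕ.+-mono-≤ (ℕ.+-monoʳ-≤ (4 * (h + suc g)) (ℕ.*-monoʳ-≤ 7 (Λ≤volume X Λ (suc g)))) (ℕ.*-monoʳ-≤ (81920 * K) (XXgΛ≤volume X Λ (suc g))) ⟩
    4 * (h + suc g) + 7 * volume X Λ (suc g) + 81920 * K * volume X Λ (suc g)
      ≡⟨ collect (81920 * K) (volume X Λ (suc g)) (4 * (h + suc g)) ⟩
    (81920 * K + 7) * volume X Λ (suc g) + 4 * (h + suc g) ∎
    where
    open ℕ.≤-Reasoning
    Λ = suc b + f
    slack : ∀ b f g h → 2 + g + 2 * (1 + h + (2 + b)) + (3 + 3 * g + 2 * h + 5 * b + 7 * f) ≡ 4 * (h + (1 + g)) + 7 * (1 + b + f)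
    slack = solve-ℕ
    slack₁ : ∀ g → 2 + g + 2 + 3 * g ≡ 4 * (1 + g)
    slack₁ = solve-ℕ
    slack₂ : ∀ b f → 12 + 2 * (1 + f) + 3 * (2 + b) + (17 * b + 18 * f) ≡ 20 * (1 + b + f)
    slack₂ = solve-ℕ
    regroup : ∀ K X g Λ a → a + 7 * Λ + 4 * (4 * g * (K * (8 * (2 * X) * (8 * (2 * X))) * (20 * Λ))) ≡ a + 7 * Λ + 81920 * K * (X * X * g * Λ)
    regroup = solve-ℕ
    collect : ∀ c w a → a + 7 * w + c * w ≡ (c + 7) * w + a
    collect = solve-ℕ

  -- Here log (1/δ) is bounded below only by 1 / (2 U), so everything is multiplied by 2 U. The
  -- sketch is paid for by E² U = O (X² Λ), the bits for log B by U = O (X Λ): 491520 = 4 · 3 · 64 ·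
  -- 20 · 2 · 16 and 224 = 14 · 16.
  sketchSpace-≤′ : ∀ K b f h X U φ E .{{_ : NonZero X}} → φ ≤ suc f → U ≤ 16 * (X * (suc b + f)) → E * E * U ≤ 16 * (X * X * (suc b + f)) →
    sketchSpace K 1 (suc h) (suc (suc b)) φ E * (2 * U) ≤
    (491520 * K + 224) * volume X (suc b + f) 1 + 4 * (h + 0) * (2 * U)
  sketchSpace-≤′ K b f h X U φ E φ≤ U≤ EEU≤ = begin
    sketchSpace K 1 (suc h) (suc (suc b)) φ E * (2 * U)
      ≡⟨ cong (_* (2 * U)) (sketchSpace-split K 1 (suc h) (suc (suc b)) φ E) ⟩
    (1 + 2 * (suc h + suc (suc b)) + 4 * (3 * (K * (8 * E * (8 * E)) * (12 + 2 * φ + 3 * suc (suc b))))) * (2 * U)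
      ≤⟨ ℕ.*-monoˡ-≤ (2 * U) (ℕ.+-mono-≤ (ℕ.≤-trans (ℕ.m≤m+n (1 + 2 * (suc h + suc (suc b))) (2 * h + 5 * b + 7 * f)) (ℕ.≤-reflexive (slack b f h)))
           (ℕ.*-monoʳ-≤ 4 (ℕ.*-monoʳ-≤ 3 (ℕ.*-monoʳ-≤ (K * (8 * E * (8 * E))) μ≤)))) ⟩
    (4 * h + 7 * Λ + 4 * (3 * (K * (8 * E * (8 * E)) * (20 * Λ)))) * (2 * U)
      ≡⟨ regroup K E U Λ h ⟩
    4 * (h + 0) * (2 * U) + 14 * (Λ * U) + 30720 * K * (Λ * (E * E * U))
      ≤⟨ ℕ.+-mono-≤ (ℕ.+-monoʳ-≤ (4 * (h + 0) * (2 * U)) (ℕ.*-monoʳ-≤ 14 (ℕ.*-monoʳ-≤ Λ U≤)))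
           (ℕ.*-monoʳ-≤ (30720 * K) (ℕ.*-monoʳ-≤ Λ EEU≤)) ⟩
    4 * (h + 0) * (2 * U) + 14 * (Λ * (16 * (X * Λ))) + 30720 * K * (Λ * (16 * (X * X * Λ)))
      ≤⟨ ℕ.+-monoˡ-≤ (30720 * K * (Λ * (16 * (X * X * Λ)))) (ℕ.+-monoʳ-≤ (4 * (h + 0) * (2 * U))
           (ℕ.*-monoʳ-≤ 14 (ℕ.*-monoʳ-≤ Λ (ℕ.*-monoʳ-≤ 16 (ℕ.*-monoˡ-≤ Λ (ℕ.m≤m*n X X)))))) ⟩
    4 * (h + 0) * (2 * U) + 14 * (Λ * (16 * (X * X * Λ))) + 30720 * K * (Λ * (16 * (X * X * Λ)))
      ≡⟨ collect K X Λ (4 * (h + 0) * (2 * U)) ⟩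
    (491520 * K + 224) * (X * X * (Λ * Λ)) + 4 * (h + 0) * (2 * U)
      ≤⟨ ℕ.+-monoˡ-≤ (4 * (h + 0) * (2 * U)) (ℕ.*-monoʳ-≤ (491520 * K + 224)
           (ℕ.≤-trans (ℕ.m≤m*n (X * X * (Λ * Λ)) Λ) (ℕ.≤-reflexive (cong (_* Λ) (sym (ℕ.*-identityʳ (X * X * (Λ * Λ)))))))) ⟩
    (491520 * K + 224) * volume X Λ 1 + 4 * (h + 0) * (2 * U) ∎
    where
    open ℕ.≤-Reasoning
    Λ = suc b + f
    slack : ∀ b f h → 1 + 2 * (1 + h + (2 + b)) + (2 * h + 5 * b + 7 * f) ≡ 4 * h + 7 * (1 + b + f)
    slack = solve-ℕ
    slack₂ : ∀ b f → 12 + 2 * (1 + f) + 3 * (2 + b) + (17 * b + 18 * f) ≡ 20 * (1 + b + f)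
    slack₂ = solve-ℕ
    μ≤ : 12 + 2 * φ + 3 * suc (suc b) ≤ 20 * Λ
    μ≤ = ℕ.≤-trans (ℕ.+-monoˡ-≤ (3 * suc (suc b)) (ℕ.+-monoʳ-≤ 12 (ℕ.*-monoʳ-≤ 2 φ≤)))
      (ℕ.≤-trans (ℕ.m≤m+n (12 + 2 * suc f + 3 * suc (suc b)) (17 * b + 18 * f)) (ℕ.≤-reflexive (slack₂ b f)))
    regroup : ∀ K E U Λ h → (4 * h + 7 * Λ + 4 * (3 * (K * (8 * E * (8 * E)) * (20 * Λ)))) * (2 * U) ≡
              4 * (h + 0) * (2 * U) + 14 * (Λ * U) + 30720 * K * (Λ * (E * E * U))
    regroup = solve-ℕ
    collect : ∀ K X Λ a → a + 14 * (Λ * (16 * (X * X * Λ))) + 30720 * K * (Λ * (16 * (X * X * Λ))) ≡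
              (491520 * K + 224) * (X * X * (Λ * Λ)) + a
    collect = solve-ℕ

  -- If E = 2 X / 2^u, one factor E cancels against 2^u and the other is at most 2 X. For u > f + 1
  -- the precision has dropped to E = 1, and the hypothesis on 2^(u + 1) is used.
  sketch-precision : ∀ f u Λ .{{_ : NonZero Λ}} → 2 ^ suc u ≤ 16 * (2 ^ f * Λ) →
                     2 ^ (suc f ∸ u) * 2 ^ (suc f ∸ u) * 2 ^ suc u ≤ 16 * (2 ^ f * 2 ^ f * Λ)
  sketch-precision f u Λ U≤ with u ℕ.≤? suc f
  ... | yes u≤sf = begin
    E * E * (2 * 2 ^ u)            ≡⟨ regroup E (2 ^ u) ⟩
    2 * (E * (E * 2 ^ u))          ≤⟨ ℕ.*-monoʳ-≤ 2 (ℕ.*-mono-≤ E≤ (ℕ.≤-reflexive E2^u≡)) ⟩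
    2 * (2 * X * (2 * X))          ≡⟨ eight X ⟩
    8 * (X * X)                    ≤⟨ ℕ.*-mono-≤ (ℕ.m≤m+n 8 8) (ℕ.m≤m*n (X * X) Λ) ⟩
    16 * (X * X * Λ)               ∎
    where
    open ℕ.≤-Reasoning
    X = 2 ^ f
    E = 2 ^ (suc f ∸ u)
    E≤ : E ≤ 2 * X
    E≤ = 2^-mono-≤ (ℕ.m∸n≤m (suc f) u)
    E2^u≡ : E * 2 ^ u ≡ 2 * X
    E2^u≡ = trans (sym (ℕ.^-distribˡ-+-* 2 (suc f ∸ u) u)) (cong (2 ^_) (ℕ.m∸n+n≡m u≤sf))
    regroup : ∀ E w → E * E * (2 * w) ≡ 2 * (E * (E * w))
    regroup = solve-ℕ
    eight : ∀ X → 2 * (2 * X * (2 * X)) ≡ 8 * (X * X)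
    eight = solve-ℕ
  ... | no u≰sf = begin
    2 ^ (suc f ∸ u) * 2 ^ (suc f ∸ u) * 2 ^ suc u   ≡⟨ cong (λ z → 2 ^ z * 2 ^ z * 2 ^ suc u) (ℕ.m≤n⇒m∸n≡0 (ℕ.<⇒≤ (ℕ.≰⇒> u≰sf))) ⟩
    1 * 2 ^ suc u                                   ≡⟨ ℕ.*-identityˡ (2 ^ suc u) ⟩
    2 ^ suc u                                       ≤⟨ U≤ ⟩
    16 * (2 ^ f * Λ)                                ≤⟨ ℕ.*-monoʳ-≤ 16 (ℕ.*-monoˡ-≤ Λ (ℕ.m≤m*n (2 ^ f) (2 ^ f) {{ℕ.m^n≢0 2 f}})) ⟩
    16 * (2 ^ f * 2 ^ f * Λ)                        ∎
    where open ℕ.≤-Reasoning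

-- The case distinction on B and δ.

module Solutions where

  open import Data.Nat.Base using (_+_; _*_; _∸_; _^_; _≤_; _<_)
  open import Data.Rational.Base using (_-_)
  open Expectations
  open GoodTables using (fromℕ-∸)
  open Machines
  open Sketches using (stream-length≤)
  open SketchParameters
  open Logarithms
  open Guessing
  open SpaceBounds
  open SketchSpace

  Solution : (C₁ C₂ n B : ℕ) (ε δ : ℚ) .{{_ : Positive ε}} .{{_ : Positive δ}} → Set
  Solution C₁ C₂ n B ε δ =
    Σ[ A ∈ StreamingAlgorithm n ]
      (SpaceBound C₁ C₂ n B ε δ (StreamingAlgorithm.space A) ×
       ((m : ℕ) (xs : Stream n m) → ((i : Fin n) → frequency xs i ≤ B) →
         1ℚ - δ ℚ.≤ PrOutput A xs (isApprox? ε (fromℕ ‖ frequency xs ‖²))))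

  -- The guess supplies the κ bits of precision that the sketch lacks; for κ = 0 the answer is v.
  sketch-answer : ∀ f κ → Fin (2 ^ κ) → ℕ → ℚ
  sketch-answer f κ j v = grid-point (suc f) v (toℕ j)

  -- The window from v to v + v / 2^φ is covered by 2^κ grid steps of length v / 2^(f + 1), as f + 1
  -- ≤ κ + φ.
  sketch-answer-approx : ∀ {ε f φ} κ → 0ℚ ℚ.≤ ε → 1ℚ ℚ.≤ ε ℚ.* fromℕ (2 ^ suc f) → suc f ≤ κ + φ →
    ∀ {F} v → v ≤ F → 2 ^ φ * F ≤ 2 ^ φ * v + v → ∃[ j ] IsApprox ε (fromℕ F) (sketch-answer f κ j v)
  sketch-answer-approx {ε} {f} {φ} κ 0≤ε 1≤εE f<κ+φ {F} v v≤F close =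
    let j , lo , hi = cover (2 ^ κ) {E * v} {v} {E * F} {{ℕ.m^n≢0 2 κ}} (ℕ.*-monoʳ-≤ E v≤F) window in
    j , grid-point-approx {ε} {suc f} {v} {toℕ j} {F} 0≤ε 1≤εE v≤F lo hi
    where
    open ℕ.≤-Reasoning
    E D : ℕ
    E = 2 ^ suc f
    D = F ∸ v
    split : ∀ c → c * F ≡ c * v + c * D
    split c = trans (cong (c *_) (sym (ℕ.m+[n∸m]≡n v≤F))) (ℕ.*-distribˡ-+ c v D)
    2^φD≤v : 2 ^ φ * D ≤ v
    2^φD≤v = ℕ.+-cancelˡ-≤ (2 ^ φ * v) (2 ^ φ * D) v (ℕ.≤-trans (ℕ.≤-reflexive (sym (split (2 ^ φ)))) close)
    window : E * F ≤ E * v + 2 ^ κ * v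
    window = begin
      E * F                        ≡⟨ split E ⟩
      E * v + E * D                ≤⟨ ℕ.+-monoʳ-≤ (E * v) (ℕ.*-monoˡ-≤ D (2^-mono-≤ f<κ+φ)) ⟩
      E * v + 2 ^ (κ + φ) * D      ≡⟨ cong (λ z → E * v + z) (trans (cong (_* D) (ℕ.^-distribˡ-+-* 2 κ φ)) (ℕ.*-assoc (2 ^ κ) (2 ^ φ) D)) ⟩
      E * v + 2 ^ κ * (2 ^ φ * D)  ≤⟨ ℕ.+-monoʳ-≤ (E * v) (ℕ.*-monoʳ-≤ (2 ^ κ) 2^φD≤v) ⟩
      E * v + 2 ^ κ * v            ∎

  -- This fixes the threshold 16 X Λ for 2^u, at which sketching gives way to guessing the octave.
  guesses-≤ : ∀ b f → suc ((3 * suc b + 3) * 2 ^ suc f) ≤ 16 * (2 ^ f * (suc b + f))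
  guesses-≤ b f = begin
    1 + (3 * suc b + 3) * (2 * X)                   ≤⟨ ℕ.+-monoˡ-≤ _ (ℕ.m^n>0 2 f) ⟩
    X + (3 * suc b + 3) * (2 * X)                   ≤⟨ ℕ.m≤m+n _ (X * (3 + 10 * b + 16 * f)) ⟩
    X + (3 * suc b + 3) * (2 * X) + X * (3 + 10 * b + 16 * f) ≡⟨ slack b f X ⟩
    16 * (X * (suc b + f))                          ∎
    where
    open ℕ.≤-Reasoning
    X = 2 ^ f
    slack : ∀ b f X → X + (3 * (1 + b) + 3) * (2 * X) + X * (3 + 10 * b + 16 * f) ≡ 16 * (X * (1 + b + f))
    slack = solve-ℕ

  zero-or-positive : ∀ F {W} → F < W → F ≡ 0 ⊎ (1 ≤ F × F < W)
  zero-or-positive zero    _   = inj₁ refl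
  zero-or-positive (suc F) F<W = inj₂ (s≤s z≤n , F<W)

  module Cases {C₁ C₂ n B : ℕ} .{{_ : NonZero B}} {ε δ : ℚ} .{{_ : Positive ε}} .{{_ : Positive δ}}
    (C₁≥ : 491520 * 48 + 224 ≤ C₁) (C₂≥ : 4 ≤ C₂) {h f g u : ℕ}
    (2^h≤n : 2 ^ h ≤ n) (n<2^h+1 : n < 2 ^ suc h)
    (2^fε≤1 : fromℕ (2 ^ f) ℚ.* ε ℚ.≤ 1ℚ) (1≤ε2^f+1 : 1ℚ ℚ.≤ ε ℚ.* fromℕ (2 ^ suc f))
    (2^gδ≤1 : fromℕ (2 ^ g) ℚ.* δ ℚ.≤ 1ℚ) (1≤δ2^g+1 : 1ℚ ℚ.≤ δ ℚ.* fromℕ (2 ^ suc g))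
    (2^uη≤1 : fromℕ (2 ^ u) ℚ.* (1ℚ - δ) ℚ.≤ 1ℚ) (1≤η2^u+1 : 1ℚ ℚ.≤ (1ℚ - δ) ℚ.* fromℕ (2 ^ suc u))
    where

    private
      X : ℕ
      X = 2 ^ f
      instance
        X≢0 : NonZero X
        X≢0 = ℕ.m^n≢0 2 f
      0≤ε : 0ℚ ℚ.≤ ε
      0≤ε = ℚ.<⇒≤ (ℚ.positive⁻¹ ε)
      0≤δ : 0ℚ ℚ.≤ δ
      0≤δ = ℚ.<⇒≤ (ℚ.positive⁻¹ δ)
      η : ℚ
      η = 1ℚ - δ

    from-success : (M : Machine n) → ∀ a c → 0ℚ ℚ.< fromℕ c → η ℚ.* fromℕ c ℚ.≤ fromℕ a →
      (∀ {m} (xs : Stream n m) → (∀ i → frequency xs i ≤ B) →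
        fromℕ a ℚ.≤ fromℕ c ℚ.* PrOutput (Machine.algorithm M) xs (isApprox? ε (fromℕ ‖ frequency xs ‖²))) →
      SpaceBound C₁ C₂ n B ε δ (Machine.space M) → Solution C₁ C₂ n B ε δ
    from-success M a c 0<c ηc≤a success bound = Machine.algorithm M , bound , λ m xs xs≤B → success-≥ a c 0<c ηc≤a (success xs xs≤B)

    -- The case δ ≤ ½: with γ = g + 1 at most a fraction 2^-(g + 1) ≤ δ of the seeds fails, and
    -- there is only one guess.
    full-precision : ∀ {b} → 2 ^ suc b ≤ B → B < 2 ^ suc (suc b) → ∀ {g′} → g ≡ suc g′ → Solution C₁ C₂ n B ε δ
    full-precision {b} 2^b≤B B<2^b+1 {g′} refl = from-success
      (sketchMachine (suc h) (suc (suc b)) (suc f) (suc g) 0 n<2^h+1 B<2^b+1 (sketch-answer f 0))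
      (2 ^ suc g ∸ 1) (2 ^ suc g * 2 ^ 0) (subst (λ c → 0ℚ ℚ.< fromℕ c) (sym (ℕ.*-identityʳ (2 ^ suc g))) (0<2^ (suc g))) η2^≤
      (λ xs xs≤B → sketchMachine-success (suc h) (suc (suc b)) (suc f) (suc g) 0 n<2^h+1 B<2^b+1 (sketch-answer f 0) xs xs≤B
        {IsApprox ε (fromℕ ‖ frequency xs ‖²)} (isApprox? ε (fromℕ ‖ frequency xs ‖²))
        (sketch-answer-approx {ε} {f} {suc f} 0 0≤ε 1≤ε2^f+1 ℕ.≤-refl {‖ frequency xs ‖²}))
      (subst (SpaceBound C₁ C₂ n B ε δ)
        (sym (sketchMachine-space (suc h) (suc (suc b)) (suc f) (suc g) 0 n<2^h+1 B<2^b+1 (sketch-answer f 0)))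
        (space-bound {C₁} {C₂} {sketchSpace 48 (suc g) (suc h) (suc (suc b)) (suc f) (2 ^ suc f)} g 0 log-g space≤))
      where
      open Space {n} {B} {ε} {δ} {suc b} {f} {g} {h} 2^b≤B 2^h≤n 2^fε≤1 2^gδ≤1
      space≤ : sketchSpace 48 (suc g) (suc h) (suc (suc b)) (suc f) (2 ^ suc f) * 1 ≤ C₁ * volume X (suc b + f) g + C₂ * (h + g) * 1
      space≤ = begin
        sketchSpace 48 (suc g) (suc h) (suc (suc b)) (suc f) (2 ^ suc f) * 1
          ≡⟨ ℕ.*-identityʳ (sketchSpace 48 (suc g) (suc h) (suc (suc b)) (suc f) (2 ^ suc f)) ⟩
        sketchSpace 48 (suc g) (suc h) (suc (suc b)) (suc f) (2 ^ suc f)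
          ≤⟨ sketchSpace-≤ 48 b f g′ h X refl ⟩
        (81920 * 48 + 7) * volume X (suc b + f) g + 4 * (h + g)
          ≤⟨ ℕ.+-mono-≤ (ℕ.*-monoˡ-≤ (volume X (suc b + f) g) (ℕ.≤-trans (ℕ.≤ᵇ⇒≤ (81920 * 48 + 7) (491520 * 48 + 224) tt) C₁≥)) (ℕ.*-monoˡ-≤ (h + g) C₂≥) ⟩
        C₁ * volume X (suc b + f) g + C₂ * (h + g)
          ≡⟨ cong (λ z → C₁ * volume X (suc b + f) g + z) (sym (ℕ.*-identityʳ (C₂ * (h + g)))) ⟩
        C₁ * volume X (suc b + f) g + C₂ * (h + g) * 1 ∎
        where open ℕ.≤-Reasoning
      η2^≤ : η ℚ.* fromℕ (2 ^ suc g * 1) ℚ.≤ fromℕ (2 ^ suc g ∸ 1)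
      η2^≤ = subst₂ (λ x y → η ℚ.* fromℕ x ℚ.≤ y) (sym (ℕ.*-identityʳ (2 ^ suc g))) (sym (fromℕ-∸ {1} {2 ^ suc g} (ℕ.m^n>0 2 (suc g))))
        (0≤q-p⇒p≤q (subst (0ℚ ℚ.≤_) (rearrange δ (fromℕ (2 ^ suc g))) (p≤q⇒0≤q-p 1≤δ2^g+1)))
        where
        rearrange : ∀ δ N → δ ℚ.* N - 1ℚ ≡ (N - 1ℚ) - (1ℚ - δ) ℚ.* N
        rearrange = solve-∀ ℚ-ring

    -- At least half of the seeds are good and one of 2^u′ guesses is right, so the success
    -- probability is at least 2^-u ≥ 1 - δ. The sketch gives up the u′ bits of precision that the
    -- guess supplies.
    reduced-precision : ∀ {b} → 2 ^ suc b ≤ B → B < 2 ^ suc (suc b) → ∀ {u′} → g ≡ 0 → u ≡ suc u′ →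
               2 ^ u ≤ 16 * (2 ^ f * (suc b + f)) → Solution C₁ C₂ n B ε δ
    reduced-precision {b} 2^b≤B B<2^b+1 {u′} refl refl 2^u≤ = from-success
      (sketchMachine (suc h) (suc (suc b)) φ 1 u′ n<2^h+1 B<2^b+1 (sketch-answer f u′))
      (2 ^ 1 ∸ 1) (2 ^ 1 * 2 ^ u′) (subst (λ c → 0ℚ ℚ.< fromℕ c) {2 ^ u} {2 ^ 1 * 2 ^ u′} refl (0<2^ u))
      (subst₂ (λ a c → η ℚ.* fromℕ c ℚ.≤ fromℕ a) {1} {2 ^ 1 ∸ 1} {2 ^ u} {2 ^ 1 * 2 ^ u′} refl refl
        (subst (ℚ._≤ 1ℚ) (ℚ.*-comm (fromℕ (2 ^ u)) η) 2^uη≤1))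
      (λ xs xs≤B → sketchMachine-success (suc h) (suc (suc b)) φ 1 u′ n<2^h+1 B<2^b+1 (sketch-answer f u′) xs xs≤B
        {IsApprox ε (fromℕ ‖ frequency xs ‖²)} (isApprox? ε (fromℕ ‖ frequency xs ‖²))
        (sketch-answer-approx {ε} {f} {φ} u′ 0≤ε 1≤ε2^f+1 (ℕ.m≤n+m∸n (suc f) u′) {‖ frequency xs ‖²}))
      (subst (SpaceBound C₁ C₂ n B ε δ)
        (sym (sketchMachine-space (suc h) (suc (suc b)) φ 1 u′ n<2^h+1 B<2^b+1 (sketch-answer f u′)))
        (space-bound {C₁} {C₂} {sketchSpace 48 1 (suc h) (suc (suc b)) φ (2 ^ φ)} 1 (suc u) (log-½^ (suc u) 1≤η2^u+1) space≤))
      where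
      open Space {n} {B} {ε} {δ} {suc b} {f} {g} {h} 2^b≤B 2^h≤n 2^fε≤1 2^gδ≤1
      φ : ℕ
      φ = suc f ∸ u′
      space≤ : sketchSpace 48 1 (suc h) (suc (suc b)) φ (2 ^ φ) * (2 * 2 ^ u) ≤ C₁ * volume X (suc b + f) 1 + C₂ * (h + 0) * (2 * 2 ^ u)
      space≤ = ℕ.≤-trans
        (sketchSpace-≤′ 48 b f h X (2 ^ u) φ (2 ^ φ) (ℕ.m∸n≤m (suc f) u′) 2^u≤ (sketch-precision f u′ (suc b + f) 2^u≤))
        (ℕ.+-mono-≤ (ℕ.*-monoˡ-≤ (volume X (suc b + f) 1) C₁≥) (ℕ.*-monoˡ-≤ (2 * 2 ^ u) (ℕ.*-monoˡ-≤ (h + 0) C₂≥)))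

    -- The c bits are charged to log (n/δ) alone, so log (1/δ) may be arbitrarily small; the lower
    -- bound 0 for it is enough.
    counting : ∀ {b} → 2 ^ b ≤ B → ∀ c J {{_ : NonZero J}} (answer : Fin J → ℕ → ℚ) → c ≤ 4 * (h + g) → η ℚ.* fromℕ J ℚ.≤ 1ℚ →
               (∀ {m} (xs : Stream n m) → (∀ i → frequency xs i ≤ B) → ∃[ j ] IsApprox ε (fromℕ ‖ frequency xs ‖²) (answer j ((m % 2 ^ c) {{ℕ.m^n≢0 2 c}}))) →
               Solution C₁ C₂ n B ε δ
    counting {b} 2^b≤B c J answer c≤ ηJ≤1 approx = from-success (counterMachine c J answer) 1 J
      (fromℕ-mono-< {0} {J} (ℕ.>-nonZero⁻¹ J)) ηJ≤1
      (λ xs xs≤B → counterMachine-success c J answer xs {IsApprox ε (fromℕ ‖ frequency xs ‖²)} (isApprox? ε (fromℕ ‖ frequency xs ‖²)) (approx xs xs≤B))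
      (space-bound {C₁} {C₂} {c} 0 0 log-0 space≤)
      where
      open Space {n} {B} {ε} {δ} {b} {f} {g} {h} 2^b≤B 2^h≤n 2^fε≤1 2^gδ≤1
      space≤ : c * 1 ≤ C₁ * volume X (b + f) 0 + C₂ * (h + g) * 1
      space≤ = begin
        c * 1                                         ≡⟨ ℕ.*-identityʳ c ⟩
        c                                             ≤⟨ c≤ ⟩
        4 * (h + g)                                   ≤⟨ ℕ.*-monoˡ-≤ (h + g) C₂≥ ⟩
        C₂ * (h + g)                                  ≡⟨ sym (ℕ.*-identityʳ (C₂ * (h + g))) ⟩
        C₂ * (h + g) * 1                              ≤⟨ ℕ.m≤n+m (C₂ * (h + g) * 1) (C₁ * volume X (b + f) 0) ⟩
        C₁ * volume X (b + f) 0 + C₂ * (h + g) * 1    ∎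
        where open ℕ.≤-Reasoning

    η≤1 : η ℚ.≤ 1ℚ
    η≤1 = 0≤q-p⇒p≤q (subst (0ℚ ℚ.≤_) (cancel δ) 0≤δ)
      where
      cancel : ∀ δ → δ ≡ 1ℚ - (1ℚ - δ)
      cancel = solve-∀ ℚ-ring

    0≤η : 0ℚ ℚ.≤ η
    0≤η = ℚ.*-cancelʳ-≤-pos (fromℕ (2 ^ suc u)) {{ℚ.positive (0<2^ (suc u))}}
      (ℚ.≤-trans (ℚ.≤-reflexive (ℚ.*-zeroˡ (fromℕ (2 ^ suc u)))) (ℚ.≤-trans 0≤1 1≤η2^u+1))

    ηJ≤1 : ∀ {J} → J ≤ 2 ^ u → η ℚ.* fromℕ J ℚ.≤ 1ℚ
    ηJ≤1 {J} J≤2^u = ℚ.≤-trans (*-monoˡ-≤ η 0≤η (fromℕ-mono-≤ J≤2^u)) (subst (ℚ._≤ 1ℚ) (ℚ.*-comm (fromℕ (2 ^ u)) η) 2^uη≤1)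

    module _ (B<2 : B < 2) where

      norm²≡length : ∀ {m} (xs : Stream n m) → (∀ i → frequency xs i ≤ B) → ‖ frequency xs ‖² ≡ m
      norm²≡length {m} xs xs≤B = ℕ.≤-antisym
        (ℕ.≤-trans (norm²≤B*length xs xs≤B) (ℕ.≤-trans (ℕ.*-monoˡ-≤ m (ℕ.≤-pred B<2)) (ℕ.≤-reflexive (ℕ.*-identityˡ m))))
        (length≤norm² xs xs≤B)

      length≤n : ∀ {m} (xs : Stream n m) → (∀ i → frequency xs i ≤ B) → m ≤ n
      length≤n xs xs≤B = ℕ.≤-trans (stream-length≤ xs xs≤B) (ℕ.≤-trans (ℕ.*-monoʳ-≤ n (ℕ.≤-pred B<2)) (ℕ.≤-reflexive (ℕ.*-identityʳ n)))

      exact-count : 1 ≤ h + g → Solution C₁ C₂ n B ε δ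
      exact-count 1≤h+g = counting {0} (ℕ.>-nonZero⁻¹ B) (suc h) 1 (λ _ m → fromℕ m)
        (ℕ.≤-trans (ℕ.+-mono-≤ 1≤h+g (ℕ.m≤m+n h g)) (ℕ.+-monoʳ-≤ (h + g) (ℕ.m≤m+n (h + g) _)))
        (subst (ℚ._≤ 1ℚ) (sym (ℚ.*-identityʳ η)) η≤1)
        λ {m} xs xs≤B → zero , subst₂ (λ F v → IsApprox ε (fromℕ F) (fromℕ v)) (sym (norm²≡length xs xs≤B))
          (sym (m<n⇒m%n≡m {{ℕ.m^n≢0 2 (suc h)}} (ℕ.≤-<-trans (length≤n xs xs≤B) n<2^h+1))) (exact-approx {ε} {m} 0≤ε)

      -- Here n = B = 1, so the length is 0 or 1, and a blind guess succeeds with probability ½ ≥ 1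
      -- - δ.
      coin-flip : h ≡ 0 → ∀ {u′} → u ≡ suc u′ → Solution C₁ C₂ n B ε δ
      coin-flip refl {u′} refl = counting {0} (ℕ.>-nonZero⁻¹ B) 0 2 (λ j _ → fromℕ (toℕ j)) z≤n
        (ηJ≤1 {2} (2^-mono-≤ {1} {u} (s≤s z≤n)))
        λ {m} xs xs≤B → Fin.fromℕ< (m<2 xs xs≤B) ,
          subst₂ (λ F v → IsApprox ε (fromℕ F) (fromℕ v)) (sym (norm²≡length xs xs≤B)) (sym (Fin.toℕ-fromℕ< (m<2 xs xs≤B))) (exact-approx {ε} {m} 0≤ε)
        where
        m<2 : ∀ {m} (xs : Stream n m) → (∀ i → frequency xs i ≤ B) → m < 2
        m<2 xs xs≤B = ℕ.≤-<-trans (length≤n xs xs≤B) n<2^h+1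

    -- Since b < h, a counter of the length fits into 4 h bits. F₂ lies between m and B m, so the
    -- octaves above m that matter number O (log B).
    guess-from-length : ∀ {b} → 2 ^ suc b ≤ B → B < 2 ^ suc (suc b) → 16 * (2 ^ f * (suc b + f)) ≤ 2 ^ u → suc b ≤ h → Solution C₁ C₂ n B ε δ
    guess-from-length {b} 2^b≤B B<2^b+1 ≤2^u b<h = counting {suc b} 2^b≤B c (suc (I * 2 ^ suc f)) (λ t m → guess I (suc f) m t)
        c≤ (ηJ≤1 {suc (I * 2 ^ suc f)} J≤2^u)
        λ {m} xs xs≤B → subst (λ v → ∃[ t ] IsApprox ε (fromℕ ‖ frequency xs ‖²) (guess I (suc f) v t))
          (sym (m<n⇒m%n≡m {{ℕ.m^n≢0 2 c}} (ℕ.≤-<-trans (stream-length≤ xs xs≤B) nB<2^c)))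
          (guess-approx I (suc f) {ε} {m} {‖ frequency xs ‖²} 0≤ε 1≤ε2^f+1 (window xs xs≤B))
      where
      open ℕ.≤-Reasoning
      I c : ℕ
      I = 3 * suc b + 3
      c = suc h + suc (suc b)
      J≤2^u : suc (I * 2 ^ suc f) ≤ 2 ^ u
      J≤2^u = ℕ.≤-trans (guesses-≤ b f) ≤2^u
      nB<2^c : n * B < 2 ^ c
      nB<2^c = ℕ.<-≤-trans (ℕ.*-mono-< n<2^h+1 B<2^b+1) (ℕ.≤-reflexive (sym (ℕ.^-distribˡ-+-* 2 (suc h) (suc (suc b)))))
      c≤ : c ≤ 4 * (h + g)
      c≤ = begin
        suc h + suc (suc b)      ≤⟨ ℕ.+-monoʳ-≤ (suc h) (s≤s b<h) ⟩
        suc h + suc h            ≤⟨ ℕ.+-mono-≤ (ℕ.+-monoˡ-≤ h 1≤h) (ℕ.+-monoˡ-≤ h 1≤h) ⟩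
        h + h + (h + h)          ≡⟨ four h ⟩
        4 * h                    ≤⟨ ℕ.*-monoʳ-≤ 4 (ℕ.m≤m+n h g) ⟩
        4 * (h + g)              ∎
        where
        1≤h : 1 ≤ h
        1≤h = ℕ.≤-trans (s≤s z≤n) b<h
        four : ∀ h → h + h + (h + h) ≡ 4 * h
        four = solve-ℕ
      window : ∀ {m} (xs : Stream n m) → (∀ i → frequency xs i ≤ B) →
               ‖ frequency xs ‖² ≡ 0 ⊎ (m ≤ ‖ frequency xs ‖² × ‖ frequency xs ‖² < m * 2 ^ I)
      window {zero}      xs xs≤B = inj₁ (ℕ.n≤0⇒n≡0 (ℕ.≤-trans (norm²≤B*length xs xs≤B) (ℕ.≤-reflexive (ℕ.*-zeroʳ B))))
      window {m@(suc _)} xs xs≤B = inj₂ (length≤norm² xs xs≤B , (begin-strict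
        ‖ frequency xs ‖²      ≤⟨ norm²≤B*length xs xs≤B ⟩
        B * m                  <⟨ ℕ.*-monoˡ-< m B<2^b+1 ⟩
        2 ^ suc (suc b) * m    ≤⟨ ℕ.*-monoˡ-≤ m (2^-mono-≤ (ℕ.≤-trans (ℕ.m≤m+n (suc (suc b)) (2 * b + 4)) (ℕ.≤-reflexive (slack b)))) ⟩
        2 ^ I * m              ≡⟨ ℕ.*-comm (2 ^ I) m ⟩
        m * 2 ^ I              ∎))
        where
        slack : ∀ b → 2 + b + (2 * b + 4) ≡ 3 * (1 + b) + 3
        slack = solve-ℕ
    -- Since h ≤ b, even the a priori bound n B² on F₂ is below 2^I. The 3 in I stems from its three
    -- factors of size O (B).
    guess-blindly : ∀ {b} → 2 ^ suc b ≤ B → B < 2 ^ suc (suc b) → 16 * (2 ^ f * (suc b + f)) ≤ 2 ^ u → h < suc b → Solution C₁ C₂ n B ε δ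
    guess-blindly {b} 2^b≤B B<2^b+1 ≤2^u h≤b = counting {suc b} 2^b≤B 0 (suc (I * 2 ^ suc f)) (λ t _ → guess I (suc f) 1 t) z≤n
        (ηJ≤1 {suc (I * 2 ^ suc f)} J≤2^u)
        λ {m} xs xs≤B → guess-approx I (suc f) {ε} {1} {‖ frequency xs ‖²} 0≤ε 1≤ε2^f+1 (window xs xs≤B)
      where
      open ℕ.≤-Reasoning
      I : ℕ
      I = 3 * suc b + 3
      J≤2^u : suc (I * 2 ^ suc f) ≤ 2 ^ u
      J≤2^u = ℕ.≤-trans (guesses-≤ b f) ≤2^u
      window : ∀ {m} (xs : Stream n m) → (∀ i → frequency xs i ≤ B) →
               ‖ frequency xs ‖² ≡ 0 ⊎ (1 ≤ ‖ frequency xs ‖² × ‖ frequency xs ‖² < 1 * 2 ^ I)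
      window {m} xs xs≤B = zero-or-positive ‖ frequency xs ‖² (begin-strict
        ‖ frequency xs ‖²                                  ≤⟨ norm²≤B*length xs xs≤B ⟩
        B * m                                              ≤⟨ ℕ.*-monoʳ-≤ B (stream-length≤ xs xs≤B) ⟩
        B * (n * B)                                        <⟨ ℕ.*-mono-< B<2^b+1 (ℕ.*-mono-< n<2^h+1 B<2^b+1) ⟩
        2 ^ β * (2 ^ suc h * 2 ^ β)                        ≡⟨ trans (cong (2 ^ β *_) (sym (ℕ.^-distribˡ-+-* 2 (suc h) β))) (sym (ℕ.^-distribˡ-+-* 2 β (suc h + β))) ⟩
        2 ^ (β + (suc h + β))                              ≤⟨ 2^-mono-≤ (ℕ.≤-trans (ℕ.+-monoʳ-≤ β (ℕ.+-monoˡ-≤ β h≤b)) (ℕ.≤-trans (ℕ.n≤1+n (β + (suc b + β))) (ℕ.≤-reflexive (slack b)))) ⟩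
        2 ^ I                                              ≡⟨ sym (ℕ.*-identityˡ (2 ^ I)) ⟩
        1 * 2 ^ I                                          ∎)
        where
        β = suc (suc b)
        slack : ∀ b → 1 + (2 + b + (1 + b + (2 + b))) ≡ 3 * (1 + b) + 3
        slack = solve-ℕ

    guess-octave : ∀ {b} → 2 ^ suc b ≤ B → B < 2 ^ suc (suc b) → 16 * (2 ^ f * (suc b + f)) ≤ 2 ^ u → Solution C₁ C₂ n B ε δ
    guess-octave {b} 2^b≤B B<2^b+1 ≤2^u =
      [ guess-from-length 2^b≤B B<2^b+1 ≤2^u , guess-blindly 2^b≤B B<2^b+1 ≤2^u ]′ (ℕ.≤-<-connex (suc b) h)

  solution : ∀ {C₁ C₂} → 491520 * 48 + 224 ≤ C₁ → 4 ≤ C₂ → (n B : ℕ) .{{_ : NonZero n}} .{{_ : NonZero B}}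
             (ε δ : ℚ) .{{_ : Positive ε}} .{{_ : Positive δ}} → ε ℚ.< 1ℚ → δ ℚ.< 1ℚ → Solution C₁ C₂ n B ε δ
  solution {C₁} {C₂} C₁≥ C₂≥ n B ε δ ε<1 δ<1 =
    let b , 2^b≤B , B<2^b+1 = dyadic-ℕ B
        h , 2^h≤n , n<2^h+1 = dyadic-ℕ n
        f , f≤ , f> = reciprocal-dyadic {ε} (ℚ.positive⁻¹ ε) (ℚ.<⇒≤ ε<1)
        g , g≤ , g> = reciprocal-dyadic {δ} (ℚ.positive⁻¹ δ) (ℚ.<⇒≤ δ<1)
        u , u≤ , u> = reciprocal-dyadic {1ℚ - δ} 0<η η≤1
    in split b h f g u 2^b≤B B<2^b+1 2^h≤n n<2^h+1 f≤ f> g≤ g> u≤ u>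
    where
    0<η : 0ℚ ℚ.< 1ℚ - δ
    0<η = subst (ℚ._< 1ℚ - δ) (ℚ.+-inverseʳ δ) (ℚ.+-monoˡ-< (ℚ.- δ) δ<1)
    η≤1 : 1ℚ - δ ℚ.≤ 1ℚ
    η≤1 = ℚ.+-monoʳ-≤ 1ℚ (ℚ.neg-antimono-≤ (ℚ.<⇒≤ (ℚ.positive⁻¹ δ)))
    total : ∀ δ → 1ℚ ℚ.+ 1ℚ ≡ δ ℚ.* fromℕ 2 ℚ.+ (1ℚ - δ) ℚ.* fromℕ 2
    total = solve-∀ ℚ-ring
    split : ∀ b h f g u → 2 ^ b ≤ B → B < 2 ^ suc b → 2 ^ h ≤ n → n < 2 ^ suc h →
      fromℕ (2 ^ f) ℚ.* ε ℚ.≤ 1ℚ → 1ℚ ℚ.< ε ℚ.* fromℕ (2 ^ suc f) →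
      fromℕ (2 ^ g) ℚ.* δ ℚ.≤ 1ℚ → 1ℚ ℚ.< δ ℚ.* fromℕ (2 ^ suc g) →
      fromℕ (2 ^ u) ℚ.* (1ℚ - δ) ℚ.≤ 1ℚ → 1ℚ ℚ.< (1ℚ - δ) ℚ.* fromℕ (2 ^ suc u) → Solution C₁ C₂ n B ε δ
    -- δ and 1 - δ cannot both exceed ½.
    split b h f zero zero _ _ _ _ _ _ _ g> _ u> = ⊥-elim (ℚ.<-irrefl (total δ) (ℚ.+-mono-< g> u>))
    split (suc b) h f g@(suc _) u 2^b≤B B<2^b+1 2^h≤n n<2^h+1 f≤ f> g≤ g> u≤ u> = full-precision {b} 2^b≤B B<2^b+1 refl
      where open Cases {C₁} {C₂} {n} {B} {ε} {δ} C₁≥ C₂≥ {h} {f} {g} {u} 2^h≤n n<2^h+1 f≤ (ℚ.<⇒≤ f>) g≤ (ℚ.<⇒≤ g>) u≤ (ℚ.<⇒≤ u>)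
    split (suc b) h f zero u@(suc _) 2^b≤B B<2^b+1 2^h≤n n<2^h+1 f≤ f> g≤ g> u≤ u> =
      [ reduced-precision {b} 2^b≤B B<2^b+1 refl refl , guess-octave {b} 2^b≤B B<2^b+1 ]′ (ℕ.≤-total (2 ^ u) (16 * (2 ^ f * (suc b + f))))
      where open Cases {C₁} {C₂} {n} {B} {ε} {δ} C₁≥ C₂≥ {h} {f} {0} {u} 2^h≤n n<2^h+1 f≤ (ℚ.<⇒≤ f>) g≤ (ℚ.<⇒≤ g>) u≤ (ℚ.<⇒≤ u>)
    split zero h f g@(suc g′) u 2^b≤B B<2 2^h≤n n<2^h+1 f≤ f> g≤ g> u≤ u> = exact-count B<2 (ℕ.≤-trans (s≤s z≤n) (ℕ.m≤n+m g h))
      where open Cases {C₁} {C₂} {n} {B} {ε} {δ} C₁≥ C₂≥ {h} {f} {g} {u} 2^h≤n n<2^h+1 f≤ (ℚ.<⇒≤ f>) g≤ (ℚ.<⇒≤ g>) u≤ (ℚ.<⇒≤ u>)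
    split zero zero f zero u@(suc _) 2^b≤B B<2 2^h≤n n<2^h+1 f≤ f> g≤ g> u≤ u> = coin-flip B<2 refl refl
      where open Cases {C₁} {C₂} {n} {B} {ε} {δ} C₁≥ C₂≥ {0} {f} {0} {u} 2^h≤n n<2^h+1 f≤ (ℚ.<⇒≤ f>) g≤ (ℚ.<⇒≤ g>) u≤ (ℚ.<⇒≤ u>)
    split zero h@(suc _) f zero u@(suc _) 2^b≤B B<2 2^h≤n n<2^h+1 f≤ f> g≤ g> u≤ u> = exact-count B<2 (ℕ.≤-trans (s≤s z≤n) (ℕ.m≤m+n h 0))
      where open Cases {C₁} {C₂} {n} {B} {ε} {δ} C₁≥ C₂≥ {h} {f} {0} {u} 2^h≤n n<2^h+1 f≤ (ℚ.<⇒≤ f>) g≤ (ℚ.<⇒≤ g>) u≤ (ℚ.<⇒≤ u>)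

open import Data.Rational.Base using (_-_; _≤_; _<_)

theorem3 : ∃[ C₁ ] ∃[ C₂ ]
    ((n B : ℕ) .{{_ : NonZero n}} .{{_ : NonZero B}}
    (ε δ : ℚ) .{{_ : Positive ε}} .{{_ : Positive δ}} → ε < 1ℚ → δ < 1ℚ →
    Σ[ A ∈ StreamingAlgorithm n ]
    (SpaceBound C₁ C₂ n B ε δ (StreamingAlgorithm.space A) ×
    ((m : ℕ) (xs : Stream n m) → ((i : Fin n) → frequency xs i ℕ.≤ B) →
    1ℚ - δ ≤ PrOutput A xs (isApprox? ε (fromℕ ‖ frequency xs ‖²)))))
theorem3 = 491520 ℕ.* 48 ℕ.+ 224 , 4 , Solutions.solution ℕ.≤-refl ℕ.≤-refl
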